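{- Given an oracle for computing an $\epsilon$-approximate solution to the optimal transport problem (under the assumption $\|C\|_\infty=O(1)$) in time $T(n,\epsilon)$, one can, for an undirected bipartite graph $G=(V,E)$ with $V=L\cup R$, $L\cap R=\emptyset$, $|L|=|R|=n$ and $E\subseteq L\times R$, compute a maximum cardinality matching $F$ of $G$ in time $O\left(T(n,\epsilon)+n^3\epsilon\right)$.
   Context: A matching in $G$ is a set $F\subseteq E$ with $|\{j\in V:\{i,j\}\in F\}|\le 1$ for all $i\in V$; it has maximum cardinality if it maximizes $|F|$ over all matchings. $\mathbb{R}_{\ge 0}$ is the set of non-negative reals, $\mathbf{1}$ is the all-ones vector, $\Delta^n=\{x\in\mathbb{R}_{\ge 0}^n:\sum_i x_i=1\}$, $\langle A,B\rangle=\sum_{i,j}A_{ij}B_{ij}$, and $\|C\|_\infty$ denotes the largest entry of $C$. An instance of the optimal transport problem consists of marginals $r,c\in\Delta^n$ with strictly positive entries and a non-negative cost matrix $C\in\mathbb{R}_{\ge 0}^{n\times n}$; the problem is $\min_{X\in\mathcal{U}(r,c)}\langle C,X\rangle$ where $\mathcal{U}(r,c)=\{X\in\mathbb{R}_{\ge 0}^{n\times n}: X\mathbf{1}=r,\ X^T\mathbf{1}=c\}$. An $\epsilon$-approximate solution is $\widehat{X}\in\mathcal{U}(r,c)$ with $\langle C,\widehat{X}\rangle\le\min_{X\in\mathcal{U}(r,c)}\langle C,X\rangle+\epsilon$.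
   Formalization: The oracle time is assumed to satisfy T(n,ε) ≥ n²; for a black-box oracle with smaller T (say T = 1, ε = 0) the stated bound would fail, since reading the graph already takes about n² time. -}

module Defs where

open import Algebra.Bundles using (CommutativeRing)
open import Algebra.Definitions.RawMonoid using (sum) renaming (_×_ to multiple)
open import Algebra.Structures using (IsCommutativeRing)
open import Data.Bool using (Bool; true; false; if_then_else_; not; _∧_)
open import Data.Fin using (Fin; toℕ; fromℕ<)
open import Data.Fin.Subset using (Subset; ∣_∣)
open import Data.Nat using (ℕ; zero; suc; _≡ᵇ_; _<ᵇ_; _<?_)
import Data.Nat as ℕ
open import Data.Product using (∃; ∃-syntax; _×_; _,_)
open import Data.Sum using (_⊎_; inj₁; inj₂)
import Data.Vec as Vec
open import Level using (0ℓ)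
open import Relation.Binary using (IsDecTotalOrder)
import Relation.Binary.Construct.NonStrictToStrict as ToStrict
open import Relation.Binary.PropositionalEquality using (_≡_; _≢_)
open import Relation.Nullary using (yes; no)
open import Relation.Nullary.Decidable using (⌊_⌋)

-- The real numbers, given axiomatically as a Dedekind-complete ordered field.
-- The order is decidable, as it is classically.  The value of 0# ⁻¹ is
-- unspecified.
record Reals : Set₁ where
  infixl 6 _+_
  infixl 7 _*_
  infix  8 -_ _⁻¹
  infix  4 _≤_
  field
    ℝ       : Set
    _+_ _*_ : ℝ → ℝ → ℝ
    -_ _⁻¹  : ℝ → ℝ
    0# 1#   : ℝ
    _≤_     : ℝ → ℝ → Set
    isCommutativeRing : IsCommutativeRing _≡_ _+_ _*_ -_ 0# 1#
    0≢1               : 0# ≢ 1#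
    *-inverseʳ        : ∀ x → x ≢ 0# → x * x ⁻¹ ≡ 1#
    isDecTotalOrder   : IsDecTotalOrder _≡_ _≤_
    +-monoˡ-≤         : ∀ z {x y} → x ≤ y → x + z ≤ y + z
    *-nonNegative     : ∀ {x y} → 0# ≤ x → 0# ≤ y → 0# ≤ x * y

  UpperBound : (ℝ → Set) → ℝ → Set
  UpperBound P b = ∀ x → P x → x ≤ b

  field
    supremum : (P : ℝ → Set) → ∃ P → ∃ (UpperBound P) →
               ∃[ s ] UpperBound P s × (∀ b → UpperBound P b → s ≤ b)

  commutativeRing : CommutativeRing 0ℓ 0ℓ
  commutativeRing = record { isCommutativeRing = isCommutativeRing }

  open CommutativeRing commutativeRing public using (_-_; +-rawMonoid)
  open IsDecTotalOrder isDecTotalOrder public using (_≤?_)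
  open ToStrict _≡_ _≤_ public using (_<_)

  fromℕ : ℕ → ℝ
  fromℕ k = multiple +-rawMonoid k 1#

  ∑ : ∀ {n} → (Fin n → ℝ) → ℝ
  ∑ = sum +-rawMonoid

------------------------------------------------------------------------
-- Bipartite graphs and matchings

-- Edge sets E ⊆ L × R with L and R two disjoint copies of Fin n.
EdgeSet : ℕ → Set
EdgeSet n = Fin n → Fin n → Bool

Vertex : ℕ → Set
Vertex n = Fin n ⊎ Fin n

-- The neighbours of a vertex, as a subset of the opposite side.
neighbours : ∀ {n} → EdgeSet n → Vertex n → Subset n
neighbours F (inj₁ i) = Vec.tabulate (λ j → F i j)
neighbours F (inj₂ j) = Vec.tabulate (λ i → F i j)

size : ∀ {n} → EdgeSet n → ℕ
size F = Vec.sum (Vec.tabulate (λ i → ∣ neighbours F (inj₁ i) ∣))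

record IsMatching {n : ℕ} (E F : EdgeSet n) : Set where
  field
    isSubset : ∀ i j → F i j ≡ true → E i j ≡ true
    degree≤1 : ∀ v → ∣ neighbours F v ∣ ℕ.≤ 1

record IsMaximumMatching {n : ℕ} (E F : EdgeSet n) : Set where
  field
    isMatching : IsMatching E F
    maximum    : ∀ F′ → IsMatching E F′ → size F′ ℕ.≤ size F

------------------------------------------------------------------------
-- Optimal transport

module OptimalTransport (𝓡 : Reals) where
  open Reals 𝓡

  Vector : ℕ → Set
  Vector n = Fin n → ℝ

  Matrix : ℕ → Set
  Matrix n = Fin n → Fin n → ℝ

  ⟨_,_⟩ : ∀ {n} → Matrix n → Matrix n → ℝ
  ⟨ A , B ⟩ = ∑ (λ i → ∑ (λ j → A i j * B i j))

  record InSimplex {n : ℕ} (x : Vector n) : Set where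
    field
      nonNegative : ∀ i → 0# ≤ x i
      total       : ∑ x ≡ 1#

  IsLargestEntry : ∀ {n} → Matrix n → ℝ → Set
  IsLargestEntry C m = (∃[ i ] ∃[ j ] C i j ≡ m) × (∀ i j → C i j ≤ m)

  ‖_‖∞≤_ : ∀ {n} → Matrix n → ℝ → Set
  ‖ C ‖∞≤ B = ∃[ m ] IsLargestEntry C m × m ≤ B

  record IsInstance {n : ℕ} (r c : Vector n) (C : Matrix n) : Set where
    field
      r∈Δ           : InSimplex r
      c∈Δ           : InSimplex c
      r-positive    : ∀ i → 0# < r i
      c-positive    : ∀ i → 0# < c i
      C-nonNegative : ∀ i j → 0# ≤ C i j

  record _∈𝓤[_,_] {n : ℕ} (X : Matrix n) (r c : Vector n) : Set where
    field
      nonNegative : ∀ i j → 0# ≤ X i j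
      rowSums     : ∀ i → ∑ (λ j → X i j) ≡ r i
      columnSums  : ∀ j → ∑ (λ i → X i j) ≡ c j

  IsOptimalValue : ∀ {n} → Vector n → Vector n → Matrix n → ℝ → Set
  IsOptimalValue r c C m =
    (∃[ X ] X ∈𝓤[ r , c ] × ⟨ C , X ⟩ ≡ m) ×
    (∀ X → X ∈𝓤[ r , c ] → m ≤ ⟨ C , X ⟩)

  IsApproximateSolution : ∀ {n} → ℝ → Vector n → Vector n → Matrix n →
                          Matrix n → Set
  IsApproximateSolution ε r c C X =
    X ∈𝓤[ r , c ] × (∃[ m ] IsOptimalValue r c C m × ⟨ C , X ⟩ ≤ m + ε)

  Oracle : ℕ → Set
  Oracle n = Vector n → Vector n → Matrix n → Matrix n

  -- Nothing is required of the answer to a query that is not an instance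
  -- with costs bounded by B.
  IsTransportOracle : ∀ {n} → ℝ → ℝ → Oracle n → Set
  IsTransportOracle B ε O = ∀ r c C → IsInstance r c C → ‖ C ‖∞≤ B →
                            IsApproximateSolution ε r c C (O r c C)

------------------------------------------------------------------------
-- Programs for a random access machine over ℕ and ℝ

-- Variables and two-dimensional arrays are named by numbers, separately for
-- the two sorts.  Naturals have no multiplication and reals cannot be
-- rounded to naturals, since either would make unit costs unrealistic.

Name : Set
Name = ℕ

data NatExp : Set where
  lit       : ℕ → NatExp
  var       : Name → NatExp
  _[_,_]    : Name → NatExp → NatExp → NatExp
  _⊕_ _⊖_   : NatExp → NatExp → NatExp

data RealExp : Set where
  zeroᴿ oneᴿ      : RealExp
  var             : Name → RealExp
  _[_,_]          : Name → NatExp → NatExp → RealExp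
  _⊕_ _⊖_ _⊗_ _⊘_ : RealExp → RealExp → RealExp

data BoolExp : Set where
  _<ᴺ_ : NatExp → NatExp → BoolExp
  _≤ᴿ_ : RealExp → RealExp → BoolExp
  neg  : BoolExp → BoolExp
  _&_  : BoolExp → BoolExp → BoolExp

infixr 4 _⨾_

data Program : Set where
  skip            : Program
  _≔ᴺ_            : Name → NatExp → Program
  _≔ᴿ_            : Name → RealExp → Program
  _[_,_]≔ᴺ_       : Name → NatExp → NatExp → NatExp → Program
  _[_,_]≔ᴿ_       : Name → NatExp → NatExp → RealExp → Program
  _⨾_             : Program → Program → Program
  cond            : BoolExp → Program → Program → Program
  while           : BoolExp → Program → Program
  -- transport r c C X queries the oracle with the marginals in row 0 of the
  -- real arrays r and c and the costs in C, and writes the answer to X.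
  transport       : (r c C X : Name) → Program

module RealRAM (𝓡 : Reals) where
  open Reals 𝓡
  open OptimalTransport 𝓡

  record Store : Set where
    field
      natVar    : Name → ℕ
      realVar   : Name → ℝ
      natArray  : Name → ℕ → ℕ → ℕ
      realArray : Name → ℕ → ℕ → ℝ
  open Store public

  update : {A : Set} → ℕ → A → (ℕ → A) → ℕ → A
  update k a f x = if x ≡ᵇ k then a else f x

  update₂ : {A : Set} → ℕ → ℕ → A → (ℕ → ℕ → A) → ℕ → ℕ → A
  update₂ i j a f = update i (update j a (f i)) f

  -- Replaces the upper left n × n block.
  writeBlock : {A : Set} {n : ℕ} → (Fin n → Fin n → A) →
               (ℕ → ℕ → A) → ℕ → ℕ → A
  writeBlock {n = n} M f i j with i <? n | j <? n
  ... | yes i<n | yes j<n = M (fromℕ< i<n) (fromℕ< j<n)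
  ... | _       | _       = f i j

  readBlock : {A : Set} (n : ℕ) → (ℕ → ℕ → A) → Fin n → Fin n → A
  readBlock n f i j = f (toℕ i) (toℕ j)

  evalᴺ : NatExp → Store → ℕ
  evalᴺ (lit k)       s = k
  evalᴺ (var x)       s = natVar s x
  evalᴺ (a [ i , j ]) s = natArray s a (evalᴺ i s) (evalᴺ j s)
  evalᴺ (d ⊕ e)       s = evalᴺ d s ℕ.+ evalᴺ e s
  evalᴺ (d ⊖ e)       s = evalᴺ d s ℕ.∸ evalᴺ e s

  evalᴿ : RealExp → Store → ℝ
  evalᴿ zeroᴿ         s = 0#
  evalᴿ oneᴿ          s = 1#
  evalᴿ (var x)       s = realVar s x
  evalᴿ (a [ i , j ]) s = realArray s a (evalᴺ i s) (evalᴺ j s)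
  evalᴿ (d ⊕ e)       s = evalᴿ d s + evalᴿ e s
  evalᴿ (d ⊖ e)       s = evalᴿ d s - evalᴿ e s
  evalᴿ (d ⊗ e)       s = evalᴿ d s * evalᴿ e s
  evalᴿ (d ⊘ e)       s = evalᴿ d s * evalᴿ e s ⁻¹

  evalᴮ : BoolExp → Store → Bool
  evalᴮ (d <ᴺ e) s = evalᴺ d s <ᵇ evalᴺ e s
  evalᴮ (d ≤ᴿ e) s = ⌊ evalᴿ d s ≤? evalᴿ e s ⌋
  evalᴮ (neg b)  s = not (evalᴮ b s)
  evalᴮ (b & b′) s = evalᴮ b s ∧ evalᴮ b′ s

  -- The input is n (natural variable 0), the adjacency matrix of the graph
  -- (natural array 0), and ε and B (real variables 0 and 1).  All other
  -- memory is zero.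
  initial : ∀ {n} → EdgeSet n → (ε B : ℝ) → Store
  initial {n} E ε B = record
    { natVar    = update 0 n (λ _ → 0)
    ; realVar   = update 0 ε (update 1 B (λ _ → 0#))
    ; natArray  = update 0 (writeBlock (λ i j → if E i j then 1 else 0) (λ _ _ → 0))
                           (λ _ _ _ → 0)
    ; realArray = λ _ _ _ → 0#
    }

  -- The output is the adjacency matrix in natural array 1.
  output : (n : ℕ) → Store → EdgeSet n
  output n s i j = readBlock n (natArray s 1) i j ≡ᵇ 1

  -- Run O τ p s s′ t: with oracle O, each call of which takes time τ, program
  -- p started in s halts in s′ after time t.  Evaluating an expression is
  -- charged to the command containing it; a program is fixed independently of
  -- its input, so this affects running times only by a constant factor.
  data Run {n : ℕ} (O : Oracle n) (τ : ℕ) : Program → Store → Store → ℕ → Set where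

    skip : ∀ {s} → Run O τ skip s s 1

    assignᴺ : ∀ {s x e} →
      Run O τ (x ≔ᴺ e) s (record s { natVar = update x (evalᴺ e s) (natVar s) }) 1

    assignᴿ : ∀ {s x e} →
      Run O τ (x ≔ᴿ e) s (record s { realVar = update x (evalᴿ e s) (realVar s) }) 1

    storeᴺ : ∀ {s a i j e} →
      Run O τ (a [ i , j ]≔ᴺ e) s
        (record s { natArray = update a
          (update₂ (evalᴺ i s) (evalᴺ j s) (evalᴺ e s) (natArray s a)) (natArray s) })
        1

    storeᴿ : ∀ {s a i j e} →
      Run O τ (a [ i , j ]≔ᴿ e) s
        (record s { realArray = update a
          (update₂ (evalᴺ i s) (evalᴺ j s) (evalᴿ e s) (realArray s a)) (realArray s) })
        1

    seq : ∀ {p q s s′ s″ t u} →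
      Run O τ p s s′ t → Run O τ q s′ s″ u → Run O τ (p ⨾ q) s s″ (t ℕ.+ u)

    cond-true : ∀ {b p q s s′ t} → evalᴮ b s ≡ true →
      Run O τ p s s′ t → Run O τ (cond b p q) s s′ (suc t)

    cond-false : ∀ {b p q s s′ t} → evalᴮ b s ≡ false →
      Run O τ q s s′ t → Run O τ (cond b p q) s s′ (suc t)

    while-true : ∀ {b p s s′ s″ t u} → evalᴮ b s ≡ true →
      Run O τ p s s′ t → Run O τ (while b p) s′ s″ u →
      Run O τ (while b p) s s″ (suc (t ℕ.+ u))

    while-false : ∀ {b p s} → evalᴮ b s ≡ false → Run O τ (while b p) s s 1

    transport : ∀ {s r c C X} →
      Run O τ (transport r c C X) s
        (record s { realArray = update X
          (writeBlock
            (O (λ i → realArray s r 0 (toℕ i))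
               (λ i → realArray s c 0 (toℕ i))
               (readBlock n (realArray s C)))
            (realArray s X))
          (realArray s) })
        τ

-- One query with all marginals 1/n and cost B on the non-edges, 0 on the edges,
-- yields a plan X.  In each block of h = ⌈√n⌉ columns, cancelling 4-cycles of
-- edges leaves an X supported on O(n) of the block's edges, so on O(nh)
-- edges altogether; row sums, column sums and cost do not change.  In this
-- sparse graph an auction with h price levels finds, in time O(n²), a matching
-- that is maximum up to n/h edges, and n/h augmentations in time O(nh) each
-- complete it.  The vertex cover certifying that the result F₁ is maximum,
-- weighed with X and compared with a plan built from a maximum matching F₂ of
-- the whole graph, shows B(|F₂| − |F₁|) ≤ nε, so that O(nε) augmentations in
-- time O(n²) each remain.

module Submission where

open import Defs
open import Algebra.Bundles using (CommutativeMonoid; CommutativeRing)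
open import Data.Bool using (Bool; true; false; not; _∧_; _∨_; if_then_else_; T)
open import Data.Empty using (⊥; ⊥-elim)
open import Data.Fin using (Fin; toℕ; fromℕ<)
open import Data.Fin.Properties using (toℕ<n; toℕ-fromℕ<; fromℕ<-toℕ; any?)
open import Data.Fin.Subset using (∣_∣)
open import Data.Nat using (ℕ; zero; suc; _∸_; z≤n; s≤s; _≡ᵇ_; _<ᵇ_; NonZero)
open import Data.Nat.Tactic.RingSolver using (solve-∀)
open import Data.Product using (∃-syntax; _×_; _,_; proj₁; proj₂)
open import Data.Sum using (_⊎_; inj₁; inj₂)
open import Function using (_∘_; flip)
open import Level using (0ℓ)
open import Relation.Binary using (IsDecTotalOrder)
open import Relation.Binary.PropositionalEquality hiding ([_])
open import Relation.Nullary using (¬_; Dec; yes; no)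
open import Relation.Nullary.Decidable using (⌊_⌋)
import Algebra.Properties.CommutativeMonoid.Sum
import Algebra.Properties.Ring
import Algebra.Properties.Semiring.Mult
import Algebra.Properties.Semiring.Sum
import Data.Nat as ℕ
import Data.Nat.Properties as ℕ
import Data.Vec as Vec

module Combinatorial where
  open import Data.Nat using (_+_; _*_; _≤_; _<_)
  open import Data.Nat.Properties

  for : Name → NatExp → Program → Program
  for x e p = x ≔ᴺ lit 0 ⨾ while (var x <ᴺ e) (p ⨾ x ≔ᴺ (lit 1 ⊕ var x))

  forCost : ℕ → ℕ → ℕ
  forCost m c = 2 + m * (2 + c)

  data Location : Set where
    natVarᴸ realVarᴸ natArrayᴸ realArrayᴸ : Name → Location

  changes : Program → Location → Bool
  changes (y ≔ᴺ _)            (natVarᴸ x)    = x ≡ᵇ y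
  changes (y ≔ᴿ _)            (realVarᴸ x)   = x ≡ᵇ y
  changes (b [ _ , _ ]≔ᴺ _)   (natArrayᴸ a)  = a ≡ᵇ b
  changes (b [ _ , _ ]≔ᴿ _)   (realArrayᴸ a) = a ≡ᵇ b
  changes (p ⨾ q)             l             = changes p l ∨ changes q l
  changes (cond _ p q)        l             = changes p l ∨ changes q l
  changes (while _ p)         l             = changes p l
  changes (transport _ _ _ b) (realArrayᴸ a) = a ≡ᵇ b
  changes _                   _             = false

  module Update (𝓡 : Reals) where
    open RealRAM 𝓡

    update-elim : ∀ {A : Set} (P : A → Set) {k x : ℕ} {a : A} {f : ℕ → A} →
                  (x ≡ k → P a) → (x ≢ k → P (f x)) → P (update k a f x)
    update-elim P {k} {x} same other with x ≡ᵇ k in eq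
    ... | true  = same (≡ᵇ⇒≡ x k (subst T (sym eq) _))
    ... | false = other λ x≡k → subst T eq (≡⇒≡ᵇ x k x≡k)

    update-same : ∀ {A : Set} k (a : A) f → update k a f k ≡ a
    update-same k a f = update-elim (_≡ a) {k} {k} {f = f} (λ _ → refl) (λ k≢k → ⊥-elim (k≢k refl))

    update-other : ∀ {A : Set} {k x} {a : A} {f} → x ≢ k → update k a f x ≡ f x
    update-other {k = k} {x} {a} {f} x≢k =
      update-elim (_≡ f x) {k} {x} {f = f} (λ x≡k → ⊥-elim (x≢k x≡k)) (λ _ → refl)

    update₂-elim : ∀ {A : Set} (P : A → Set) {k l i j : ℕ} {a : A} {f : ℕ → ℕ → A} →
                   (i ≡ k → j ≡ l → P a) → (¬ (i ≡ k × j ≡ l) → P (f i j)) → P (update₂ k l a f i j)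
    update₂-elim P {k} {l} {i} {j} {a} {f} same other =
      update-elim (λ g → P (g j)) {k} {i} {update l a (f k)} {f}
        (λ { refl → update-elim P {l} {j} {f = f k} (same refl) (λ j≢l → other (λ (_ , e) → j≢l e)) })
        (λ i≢k → other (λ (e , _) → i≢k e))

    update₂-same : ∀ {A : Set} k l (a : A) f → update₂ k l a f k l ≡ a
    update₂-same k l a f = update₂-elim (_≡ a) {k} {l} {k} {l} {f = f} (λ _ _ → refl) (λ ne → ⊥-elim (ne (refl , refl)))

    update₂-other : ∀ {A : Set} {k l i j} {a : A} {f} → ¬ (i ≡ k × j ≡ l) → update₂ k l a f i j ≡ f i j
    update₂-other {k = k} {l} {i} {j} {a} {f} ne =
      update₂-elim (_≡ f i j) {k} {l} {i} {j} {f = f} (λ e e′ → ⊥-elim (ne (e , e′))) (λ _ → refl)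

    update-upTo : ∀ {A : Set} (P : ℕ → A → Set) {i a f} → (∀ {k} → k < i → P k (f k)) → P i a →
                  ∀ {k} → k < suc i → P k (update i a f k)
    update-upTo P {i} {a} {f} below here {k} k<1+i = update-elim (P k) {i} {k} {a} {f}
      (λ { refl → here }) (λ k≢i → below (≤∧≢⇒< (≤-pred k<1+i) k≢i))

  module Logic (𝓡 : Reals) {size : ℕ} (O : OptimalTransport.Oracle 𝓡 size) (τ : ℕ) where
    open RealRAM 𝓡
    open Update 𝓡

    -- The number is the time still available.
    Assertion : Set₁
    Assertion = ℕ → Store → Set

    record Ends (p : Program) (k : ℕ) (s : Store) (Q : Assertion) : Set where
      constructor ends
      field
        {final} : Store
        {time rest} : ℕ
        run  : Run O τ p s final time
        paid : time + rest ≤ k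
        post : Q rest final

    spend : (ℕ → Set) → ℕ → Set
    spend A zero    = ⊥
    spend A (suc k) = A k

    assignN : Name → ℕ → Store → Store
    assignN x v s = record s { natVar = update x v (natVar s) }

    assignR : Name → Reals.ℝ 𝓡 → Store → Store
    assignR x v s = record s { realVar = update x v (realVar s) }

    storeN : Name → ℕ → ℕ → ℕ → Store → Store
    storeN a i j v s = record s { natArray = update a (update₂ i j v (natArray s a)) (natArray s) }

    storeR : Name → ℕ → ℕ → Reals.ℝ 𝓡 → Store → Store
    storeR a i j v s = record s { realArray = update a (update₂ i j v (realArray s a)) (realArray s) }

    answer : (r c C X : Name) → Store → Store
    answer r c C X s = record s { realArray = update X
      (writeBlock
        (O (λ i → realArray s r 0 (toℕ i))
           (λ i → realArray s c 0 (toℕ i))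
           (readBlock size (realArray s C)))
        (realArray s X))
      (realArray s) }

    -- The values computed by a command are given explicitly: with the
    -- expressions in their place the stores would grow exponentially.
    wp : Program → Assertion → Assertion
    wp skip                Q k s = spend (λ k → Q k s) k
    wp (x ≔ᴺ e)            Q k s = spend (λ k → ∃[ v ] evalᴺ e s ≡ v × Q k (assignN x v s)) k
    wp (x ≔ᴿ e)            Q k s = spend (λ k → ∃[ v ] evalᴿ e s ≡ v × Q k (assignR x v s)) k
    wp (a [ i , j ]≔ᴺ e)   Q k s = spend (λ k → ∃[ i′ ] ∃[ j′ ] ∃[ v ]
      (evalᴺ i s , evalᴺ j s , evalᴺ e s) ≡ (i′ , j′ , v) × Q k (storeN a i′ j′ v s)) k
    wp (a [ i , j ]≔ᴿ e)   Q k s = spend (λ k → ∃[ i′ ] ∃[ j′ ] ∃[ v ]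
      (evalᴺ i s , evalᴺ j s , evalᴿ e s) ≡ (i′ , j′ , v) × Q k (storeR a i′ j′ v s)) k
    wp (p ⨾ q)             Q k s = wp p (wp q Q) k s
    wp (cond b p q)        Q k s = spend (λ k → (evalᴮ b s ≡ true  → wp p Q k s) ×
                                                (evalᴮ b s ≡ false → wp q Q k s)) k
    wp (while b p)         Q k s = Ends (while b p) k s Q
    wp (transport r c C X) Q k s = ∃[ k′ ] τ + k′ ≤ k × Q k′ (answer r c C X s)

    private
      then : ∀ {t t′ r r′ k} → t + r ≤ k → t′ + r′ ≤ r → t + t′ + r′ ≤ k
      then {t} {t′} {r} {r′} p q =
        ≤-trans (≤-reflexive (+-assoc t t′ r′)) (≤-trans (+-monoʳ-≤ t q) p)

    sound : ∀ p {Q k s} → wp p Q k s → Ends p k s Q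
    sound skip              {k = suc k} h = ends skip ≤-refl h
    sound (x ≔ᴺ e)          {k = suc k} (_ , refl , h) = ends assignᴺ ≤-refl h
    sound (x ≔ᴿ e)          {k = suc k} (_ , refl , h) = ends assignᴿ ≤-refl h
    sound (a [ i , j ]≔ᴺ e) {k = suc k} (_ , _ , _ , refl , h) = ends storeᴺ ≤-refl h
    sound (a [ i , j ]≔ᴿ e) {k = suc k} (_ , _ , _ , refl , h) = ends storeᴿ ≤-refl h
    sound (p ⨾ q) h with sound p h
    ... | ends r paid h′ with sound q h′
    ...   | ends r′ paid′ h″ = ends (seq r r′) (then paid paid′) h″
    sound (cond b p q) {k = suc k} {s} (t , f) with evalᴮ b s in eq
    ... | true  = let ends r paid h = sound p (t refl) in ends (cond-true eq r) (s≤s paid) h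
    ... | false = let ends r paid h = sound q (f refl) in ends (cond-false eq r) (s≤s paid) h
    sound (while b p) h = h
    sound (transport r c C X) (k′ , le , h) = ends transport le h

    infixl 1 _followedBy_

    _followedBy_ : ∀ {p q k s Q R} → Ends p k s Q → (∀ {k s} → Q k s → Ends q k s R) → Ends (p ⨾ q) k s R
    ends r paid h followedBy f with f h
    ... | ends r′ paid′ h′ = ends (seq r r′) (then paid paid′) h′

    andThen : ∀ p {q k s R} → wp p (λ k s → Ends q k s R) k s → Ends (p ⨾ q) k s R
    andThen p h = sound p h followedBy λ e → e

    weaken : ∀ {p k s} {Q Q′ : Assertion} → (∀ {k s} → Q k s → Q′ k s) → Ends p k s Q → Ends p k s Q′
    weaken f (ends r paid h) = ends r paid (f h)

    more : ∀ {p k k′ s Q} → k ≤ k′ → Ends p k s Q → Ends p k′ s Q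
    more le (ends r paid h) = ends r (≤-trans paid le) h

    Value : Location → Set
    Value (natVarᴸ x)    = ℕ
    Value (realVarᴸ x)   = Reals.ℝ 𝓡
    Value (natArrayᴸ x)  = ℕ → ℕ → ℕ
    Value (realArrayᴸ x) = ℕ → ℕ → Reals.ℝ 𝓡

    value : ∀ l → Store → Value l
    value (natVarᴸ x)    s = natVar s x
    value (realVarᴸ x)   s = realVar s x
    value (natArrayᴸ x)  s = natArray s x
    value (realArrayᴸ x) s = realArray s x

    private
      ∨-false : ∀ b {c} → b ∨ c ≡ false → b ≡ false × c ≡ false
      ∨-false false e = refl , e

    unchanged : ∀ {p s s′ t} → Run O τ p s s′ t → ∀ l → changes p l ≡ false → value l s′ ≡ value l s
    unchanged skip l e = refl
    unchanged assignᴺ (natVarᴸ x) e rewrite e = refl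
    unchanged assignᴺ (realVarᴸ x) e = refl
    unchanged assignᴺ (natArrayᴸ x) e = refl
    unchanged assignᴺ (realArrayᴸ x) e = refl
    unchanged assignᴿ (natVarᴸ x) e = refl
    unchanged assignᴿ (realVarᴸ x) e rewrite e = refl
    unchanged assignᴿ (natArrayᴸ x) e = refl
    unchanged assignᴿ (realArrayᴸ x) e = refl
    unchanged storeᴺ (natVarᴸ x) e = refl
    unchanged storeᴺ (realVarᴸ x) e = refl
    unchanged storeᴺ (natArrayᴸ x) e rewrite e = refl
    unchanged storeᴺ (realArrayᴸ x) e = refl
    unchanged storeᴿ (natVarᴸ x) e = refl
    unchanged storeᴿ (realVarᴸ x) e = refl
    unchanged storeᴿ (natArrayᴸ x) e = refl
    unchanged storeᴿ (realArrayᴸ x) e rewrite e = refl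
    unchanged transport (natVarᴸ x) e = refl
    unchanged transport (realVarᴸ x) e = refl
    unchanged transport (natArrayᴸ x) e = refl
    unchanged transport (realArrayᴸ x) e rewrite e = refl
    unchanged {p ⨾ q} (seq r r′) l e =
      let e₁ , e₂ = ∨-false (changes p l) e in trans (unchanged r′ l e₂) (unchanged r l e₁)
    unchanged {cond b p q} (cond-true _ r) l e = unchanged r l (proj₁ (∨-false (changes p l) e))
    unchanged {cond b p q} (cond-false _ r) l e = unchanged r l (proj₂ (∨-false (changes p l) e))
    unchanged (while-true _ r r′) l e = trans (unchanged r′ l e) (unchanged r l e)
    unchanged (while-false _) l e = refl

    Frame : Program → Store → Store → Set
    Frame p s s′ = ∀ l → changes p l ≡ false → value l s′ ≡ value l s

    framed : ∀ {p k s Q} → Ends p k s Q → Ends p k s (λ k s′ → Q k s′ × Frame p s s′)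
    framed (ends r paid h) = ends r paid (h , unchanged r)

    ↓ : Assertion → Assertion
    ↓ Q k s = ∃[ k′ ] k′ ≤ k × Q k′ s

    loop : ∀ b p {Q} (I : Assertion) →
           (∀ k s → I k s → evalᴮ b s ≡ true  → spend (λ k → Ends p k s (↓ I)) k) →
           (∀ k s → I k s → evalᴮ b s ≡ false → spend (λ k → Q k s) k) →
           ∀ {k s} → I k s → wp (while b p) Q k s
    loop b p {Q} I step stop {k} {s} inv = go (suc k) ≤-refl s inv
      where
      go : ∀ fuel {k} → k < fuel → ∀ s → I k s → Ends (while b p) k s Q
      go (suc fuel) {k} (s≤s k≤) s inv with evalᴮ b s in eq
      ... | false with k | stop k s inv eq
      ...   | suc k′ | q = ends (while-false eq) ≤-refl q
      go (suc fuel) {k} (s≤s k≤) s inv | true with k | k≤ | step k s inv eq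
      ...   | suc k′ | k′<fuel | h with h
      ...     | ends {time = t} {rest = r} run paid (k″ , le , inv′)
            with go fuel {k″} (≤-trans (s≤s (≤-trans le (≤-trans (m≤n+m r t) paid))) k′<fuel) _ inv′
      ...       | ends run′ paid′ q =
        ends (while-true eq run run′) (s≤s (then paid (≤-trans paid′ le))) q

    Advanced : Name → ℕ → ℕ → (ℕ → Store → Set) → Assertion
    Advanced x i r J k s = ∃[ y ] r + y ≤ k × natVar s x ≡ i × J y (assignN x (suc i) s)

    -- J i y s: the body has been run for all indices below i, and the time y
    -- has been saved.
    forRule : ∀ x e p (m c : ℕ) (J : ℕ → ℕ → Store → Set) →
      (∀ i y s → J i y s → evalᴺ e s ≡ m) →
      (∀ i r y s → i < m → natVar s x ≡ i → J i y s →
        Ends p (c + (r + y)) s (Advanced x i r (J (suc i)))) →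
      ∀ {r y s} → J 0 y (assignN x 0 s) →
      wp (for x e p) (λ k s′ → ∃[ y′ ] r + y′ ≤ k × J m y′ s′) (forCost m c + (r + y)) s
    forRule x e p m c J bound step {r} {y} {s} init =
      0 , refl , loop (var x <ᴺ e) (p ⨾ x ≔ᴺ (lit 1 ⊕ var x)) I next stop
        (0 , m , y , refl , update-same x 0 (natVar s) , refl , init)
      where
      I : Assertion
      I k s = ∃[ i ] ∃[ d ] ∃[ y ] i + d ≡ m × natVar s x ≡ i × suc (d * suc (suc c)) + (r + y) ≡ k × J i y s
      next : ∀ k s → I k s → (natVar s x <ᵇ evalᴺ e s) ≡ true →
             spend (λ k → Ends (p ⨾ x ≔ᴺ (lit 1 ⊕ var x)) k s (↓ I)) k
      next k s (i , d , y , sum , xi , refl , j) lt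
        with refl ← xi
        with <ᵇ⇒< (natVar s x) (evalᴺ e s) (subst T (sym lt) _)
      ... | i<e rewrite bound _ _ _ j with d
      ... | zero  = ⊥-elim (<-irrefl (trans (sym (+-identityʳ _)) sum) i<e)
      ... | suc d = subst (λ k → Ends (p ⨾ x ≔ᴺ (lit 1 ⊕ var x)) k s (↓ I)) (cost c)
            (step _ (2 + (d * suc (suc c) + r)) y s i<e refl j followedBy
              λ h → sound (x ≔ᴺ (lit 1 ⊕ var x)) (after h))
        where
        cost : ∀ c′ → c′ + (2 + (d * suc (suc c) + r) + y) ≡ suc (suc c′) + d * suc (suc c) + (r + y)
        cost c′ = begin
          c′ + (2 + (d * suc (suc c) + r) + y)     ≡⟨ +-suc c′ _ ⟩
          suc (c′ + (1 + (d * suc (suc c) + r) + y)) ≡⟨ cong suc (+-suc c′ _) ⟩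
          2 + (c′ + (d * suc (suc c) + r + y))     ≡⟨ cong (λ z → 2 + (c′ + z)) (+-assoc (d * suc (suc c)) r y) ⟩
          2 + (c′ + (d * suc (suc c) + (r + y)))   ≡⟨ cong (2 +_) (sym (+-assoc c′ _ _)) ⟩
          2 + (c′ + d * suc (suc c) + (r + y))     ∎
          where open ≡-Reasoning
        after : ∀ {k s′} → ∃[ y′ ] 2 + (d * suc (suc c) + r) + y′ ≤ k × natVar s′ x ≡ natVar s x ×
                  J (suc (natVar s x)) y′ (assignN x (suc (natVar s x)) s′) →
                wp (x ≔ᴺ (lit 1 ⊕ var x)) (↓ I) k s′
        after {suc k} {s′} (y′ , s≤s le , eq , j′) =
          _ , refl , suc (d * suc (suc c)) + (r + y′) ,
          ≤-trans (≤-reflexive (cong suc (sym (+-assoc (d * suc (suc c)) r y′)))) le ,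
          suc (natVar s′ x) , d , y′ , trans (cong (λ i → suc i + d) eq) (trans (sym (+-suc _ d)) sum) ,
          update-same x _ (natVar s′) , refl ,
          subst (λ i → J (suc i) y′ (assignN x (suc i) s′)) (sym eq) j′
      stop : ∀ k s → I k s → (natVar s x <ᵇ evalᴺ e s) ≡ false →
             spend (λ k → ∃[ y′ ] r + y′ ≤ k × J m y′ s) k
      stop k s (i , d , y , sum , xi , refl , j) ge = y , m≤n+m _ (d * suc (suc c)) , subst (λ i → J i y s) i≡m j
        where
        i≡m : i ≡ m
        i≡m = ≤-antisym (≤-trans (m≤m+n i d) (≤-reflexive sum))
                (≮⇒≥ λ i<m → subst T ge (<⇒<ᵇ (subst₂ _<_ (sym xi) (sym (bound _ _ _ j)) i<m)))

  module SumTo (M : CommutativeMonoid 0ℓ 0ℓ) where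
    open CommutativeMonoid M using (Carrier; _≈_; _∙_; ε; ∙-cong; ∙-congˡ; ∙-congʳ; assoc; comm)
      renaming (refl to ≈-refl; sym to ≈-sym; trans to ≈-trans)
    open Algebra.Properties.CommutativeMonoid.Sum M
    open import Algebra.Solver.CommutativeMonoid M using (solve; _⊕_; _⊜_)

    abstract
      sumTo : ℕ → (ℕ → Carrier) → Carrier
      sumTo n f = sum {n} (λ i → f (toℕ i))

      sumTo-cong : ∀ n {f g} → (∀ i → i < n → f i ≈ g i) → sumTo n f ≈ sumTo n g
      sumTo-cong n eq = sum-cong-≋ {n} (λ i → eq (toℕ i) (toℕ<n i))

      sumTo-∙ : ∀ n f g → sumTo n (λ i → f i ∙ g i) ≈ sumTo n f ∙ sumTo n g
      sumTo-∙ n f g = ∑-distrib-+ {n} (λ i → f (toℕ i)) (λ i → g (toℕ i))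

      sumTo-comm : ∀ m n (f : ℕ → ℕ → Carrier) → sumTo m (λ i → sumTo n (f i)) ≈ sumTo n (λ j → sumTo m (λ i → f i j))
      sumTo-comm m n f = ∑-comm {m} {n} (λ i j → f (toℕ i) (toℕ j))

      sumTo-ε : ∀ n → sumTo n (λ _ → ε) ≈ ε
      sumTo-ε n = sum-replicate-zero n

      sumTo-def : ∀ n f → sumTo n f ≡ sum {n} (λ i → f (toℕ i))
      sumTo-def n f = refl

      sumTo-zero : ∀ f → sumTo 0 f ≡ ε
      sumTo-zero f = refl

      sumTo-step : ∀ n f → sumTo (suc n) f ≡ f 0 ∙ sumTo n (λ i → f (suc i))
      sumTo-step n f = refl

    sumTo-change : ∀ {n k} → k < n → ∀ {f g} → (∀ i → i ≢ k → f i ≈ g i) →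
                   sumTo n f ∙ g k ≈ sumTo n g ∙ f k
    sumTo-change {suc n} {zero} _ {f} {g} eq rewrite sumTo-step n f | sumTo-step n g = ≈-trans
      (∙-congʳ (∙-congˡ (sumTo-cong n (λ i _ → eq (suc i) (λ ())))))
      (solve 3 (λ a b c → (a ⊕ b) ⊕ c ⊜ (c ⊕ b) ⊕ a) ≈-refl (f 0) _ (g 0))
    sumTo-change {suc n} {suc k} (s≤s k<n) {f} {g} eq rewrite sumTo-step n f | sumTo-step n g = ≈-trans
      (assoc _ _ _)
      (≈-trans (∙-cong (eq 0 (λ ())) (sumTo-change k<n (λ i i≢k → eq (suc i) (λ { refl → i≢k refl }))))
               (≈-sym (assoc _ _ _)))

    sumTo-single : ∀ {n k} → k < n → ∀ {f} → (∀ i → i ≢ k → f i ≈ ε) → sumTo n f ≈ f k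
    sumTo-single {n} {k} k<n {f} zeros =
      ≈-trans (≈-sym (CommutativeMonoid.identityʳ M _))
        (≈-trans (sumTo-change k<n {f} {λ _ → ε} zeros)
          (≈-trans (∙-congʳ (sumTo-ε n)) (CommutativeMonoid.identityˡ M _)))

  module ℕ-Sums where
    open SumTo +-0-commutativeMonoid public
    private
      module S = Algebra.Properties.Semiring.Sum +-*-semiring

    sumTo-*ˡ : ∀ n c f → c * sumTo n f ≡ sumTo n (λ i → c * f i)
    sumTo-*ˡ n c f rewrite sumTo-def n f | sumTo-def n (λ i → c * f i) =
      S.*-distribˡ-sum {n} c (λ i → f (toℕ i))

    sumTo-*ʳ : ∀ n c f → sumTo n f * c ≡ sumTo n (λ i → f i * c)
    sumTo-*ʳ n c f rewrite sumTo-def n f | sumTo-def n (λ i → f i * c) =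
      S.*-distribʳ-sum {n} c (λ i → f (toℕ i))

    sumTo-mono : ∀ n {f g} → (∀ i → i < n → f i ≤ g i) → sumTo n f ≤ sumTo n g
    sumTo-mono zero    {f} {g} _  rewrite sumTo-zero f | sumTo-zero g = z≤n
    sumTo-mono (suc n) {f} {g} le rewrite sumTo-step n f | sumTo-step n g =
      +-mono-≤ (le 0 (s≤s z≤n)) (sumTo-mono n (λ i i<n → le (suc i) (s≤s i<n)))

    term≤sumTo : ∀ {n k f} → k < n → f k ≤ sumTo n f
    term≤sumTo {suc n} {zero}  {f} _         rewrite sumTo-step n f = m≤m+n (f 0) _
    term≤sumTo {suc n} {suc k} {f} (s≤s k<n) rewrite sumTo-step n f =
      ≤-trans (term≤sumTo {f = λ i → f (suc i)} k<n) (m≤n+m _ (f 0))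

    sumTo-const : ∀ n c → sumTo n (λ _ → c) ≡ n * c
    sumTo-const zero    c = sumTo-zero _
    sumTo-const (suc n) c = trans (sumTo-step n _) (cong (c +_) (sumTo-const n c))

    sumTo-suc : ∀ {n k} → k < n → ∀ {f g} → (∀ i → i ≢ k → f i ≡ g i) → f k ≡ suc (g k) →
                sumTo n f ≡ suc (sumTo n g)
    sumTo-suc {n} {k} k<n {f} {g} eq fk = +-cancelʳ-≡ (g k) _ _ (begin
      sumTo n f + g k        ≡⟨ sumTo-change k<n eq ⟩
      sumTo n g + f k        ≡⟨ cong (sumTo n g +_) fk ⟩
      sumTo n g + suc (g k)  ≡⟨ +-suc (sumTo n g) (g k) ⟩
      suc (sumTo n g) + g k  ∎)
      where open ≡-Reasoning

    sumTo-same : ∀ {n k} → k < n → ∀ {f g} → (∀ i → i ≢ k → f i ≡ g i) → f k ≡ g k →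
                 sumTo n f ≡ sumTo n g
    sumTo-same {n} {k} k<n {f} {g} eq fk = +-cancelʳ-≡ (g k) _ _
      (trans (sumTo-change k<n eq) (cong (sumTo n g +_) fk))

    sign : ℕ → ℕ
    sign zero    = 0
    sign (suc _) = 1

    sign≤1 : ∀ x → sign x ≤ 1
    sign≤1 zero    = z≤n
    sign≤1 (suc x) = s≤s z≤n

    count : ℕ → (ℕ → ℕ) → ℕ
    count n f = sumTo n (λ i → sign (f i))

    count≤ : ∀ n f → count n f ≤ n
    count≤ n f = ≤-trans (sumTo-mono n (λ i _ → sign≤1 (f i)))
      (≤-reflexive (trans (sumTo-const n 1) (*-identityʳ n)))

  Graph : Set₁
  Graph = ℕ → ℕ → Set

  -- A matching is stored as the two maps to the partner's index plus one,
  -- which is zero for unmatched vertices.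
  record Matched (G : Graph) (A B : ℕ → ℕ) : Set where
    field
      to   : ∀ {i j} → A i ≡ suc j → B j ≡ suc i × G i j
      from : ∀ {i j} → B j ≡ suc i → A i ≡ suc j

  module Matchings where
    open ℕ-Sums

    transpose : ∀ {G A B} → Matched G A B → Matched (flip G) B A
    transpose M = record
      { to   = λ b → let a = from b in a , proj₂ (to a)
      ; from = λ a → proj₁ (to a)
      }
      where open Matched M

    monotone : ∀ {G H A B} → (∀ {i j} → G i j → H i j) → Matched G A B → Matched H A B
    monotone G⊆H M = record { to = λ a → let b , g = to a in b , G⊆H g ; from = from }
      where open Matched M

    ind : (ℕ → ℕ) → ℕ → ℕ → ℕ
    ind A i j = if A i ≡ᵇ suc j then 1 else 0

    ind-elim : ∀ (P : ℕ → Set) A i j → (A i ≡ suc j → P 1) → (A i ≢ suc j → P 0) → P (ind A i j)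
    ind-elim P A i j same other with A i ≡ᵇ suc j in eq
    ... | true  = same (≡ᵇ⇒≡ (A i) (suc j) (subst T (sym eq) _))
    ... | false = other λ e → subst T eq (≡⇒≡ᵇ (A i) (suc j) e)

    module _ {n : ℕ} {G : Graph} (bounded : ∀ {i j} → G i j → i < n × j < n) where

      ind-row : ∀ {A B} → Matched G A B → ∀ i → sumTo n (ind A i) ≡ sign (A i)
      ind-row {A} M i with A i in eq
      ... | zero  = trans (sumTo-cong n (λ j _ → refl)) (sumTo-ε n)
      ... | suc j = trans (sumTo-single (proj₂ (bounded (proj₂ (Matched.to M eq)))) (λ j′ j′≢j →
                      one (λ e → ⊥-elim (j′≢j (sym (suc-injective e)))) (λ _ → refl)))
                    (one {j} (λ _ → refl) (λ ne → ⊥-elim (ne refl)))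
        where
        one : ∀ {j′ x} → (suc j ≡ suc j′ → 1 ≡ x) → (suc j ≢ suc j′ → 0 ≡ x) →
              (if j ≡ᵇ j′ then 1 else 0) ≡ x
        one {j′} {x} = ind-elim (_≡ x) (λ _ → suc j) 0 j′

      ind-transpose : ∀ {A B} → Matched G A B → ∀ i j → ind A i j ≡ ind B j i
      ind-transpose {A} {B} M i j = ind-elim (_≡ ind B j i) A i j
        (λ a → ind-elim (1 ≡_) B j i (λ _ → refl) (λ ne → ⊥-elim (ne (proj₁ (Matched.to M a)))))
        (λ na → ind-elim (0 ≡_) B j i (λ b → ⊥-elim (na (Matched.from M b))) (λ _ → refl))

    ind-column : ∀ {n G A B} → (∀ {i j} → G i j → i < n × j < n) → Matched G A B →
                 ∀ j → sumTo n (λ i → ind A i j) ≡ sign (B j)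
    ind-column {n} {G} {A} {B} bounded M j = trans (sumTo-cong n (λ i _ → ind-transpose bounded M i j))
      (ind-row (λ g → let a , b = bounded g in b , a) (transpose M) j)

    -- Complementary slackness.
    labels≤ : ∀ {n G A B} → (∀ {i j} → G i j → i < n × j < n) → Matched G A B → ∀ c (u p : ℕ → ℕ) →
              (∀ i → i < n → A i ≡ 0 → u i ≡ 0) → (∀ j → j < n → B j ≡ 0 → p j ≡ 0) →
              (∀ {i j} → A i ≡ suc j → u i + p j ≤ c) →
              sumTo n u + sumTo n p ≤ c * count n A
    labels≤ {n} {G} {A} {B} bounded M c u p u0 p0 tight = begin
      sumTo n u + sumTo n p
        ≡⟨ cong (sumTo n u +_) (sumTo-cong n column) ⟩
      sumTo n u + sumTo n (λ j → sumTo n (λ i → ind A i j * p j))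
        ≡⟨ cong (sumTo n u +_) (sumTo-comm n n (λ j i → ind A i j * p j)) ⟩
      sumTo n u + sumTo n (λ i → sumTo n (λ j → ind A i j * p j))
        ≡⟨ sumTo-∙ n _ _ ⟨
      sumTo n (λ i → u i + sumTo n (λ j → ind A i j * p j))
        ≤⟨ sumTo-mono n row ⟩
      sumTo n (λ i → c * sign (A i))
        ≡⟨ sumTo-*ˡ n c _ ⟨
      c * count n A ∎
      where
      open ≤-Reasoning
      column : ∀ j → j < n → p j ≡ sumTo n (λ i → ind A i j * p j)
      column j j<n = trans (weight (B j) (λ e → p0 j j<n e))
        (trans (cong (_* p j) (sym (ind-column bounded M j))) (sumTo-*ʳ n (p j) _))
        where
        weight : ∀ x → (x ≡ 0 → p j ≡ 0) → p j ≡ sign x * p j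
        weight zero    z = z refl
        weight (suc x) z = sym (+-identityʳ (p j))
      row : ∀ i → i < n → u i + sumTo n (λ j → ind A i j * p j) ≤ c * sign (A i)
      row i i<n = begin
        u i + sumTo n (λ j → ind A i j * p j)       ≤⟨ +-monoʳ-≤ (u i) (sumTo-mono n λ j _ → term j) ⟩
        u i + sumTo n (λ j → ind A i j * (c ∸ u i)) ≡⟨ cong (u i +_) (sumTo-*ʳ n (c ∸ u i) _) ⟨
        u i + sumTo n (ind A i) * (c ∸ u i)         ≡⟨ cong (λ x → u i + x * (c ∸ u i)) (ind-row bounded M i) ⟩
        u i + sign (A i) * (c ∸ u i)                ≤⟨ total (A i) refl ⟩
        c * sign (A i)                              ∎
        where
        term : ∀ j → ind A i j * p j ≤ ind A i j * (c ∸ u i)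
        term j = ind-elim (λ x → x * p j ≤ x * (c ∸ u i)) A i j
          (λ e → *-monoʳ-≤ 1 (≤-trans (≤-reflexive (sym (m+n∸m≡n (u i) (p j)))) (∸-monoˡ-≤ (u i) (tight e))))
          (λ _ → z≤n)
        total : ∀ x → A i ≡ x → u i + sign x * (c ∸ u i) ≤ c * sign x
        total zero    e = ≤-trans (≤-reflexive (trans (+-identityʳ _) (u0 i i<n e))) z≤n
        total (suc j) e = ≤-reflexive (trans (cong (u i +_) (+-identityʳ _))
          (trans (m+[n∸m]≡n (≤-trans (m≤m+n (u i) (p j)) (tight e))) (sym (*-identityʳ c))))

    -- Weak duality.
    labels≥ : ∀ n d (u p : ℕ → ℕ) (w : ℕ → ℕ → ℕ) →
              (∀ i → i < n → sumTo n (w i) ≤ 1) → (∀ j → j < n → sumTo n (λ i → w i j) ≤ 1) →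
              (∀ i j → i < n → j < n → w i j ≢ 0 → d ≤ u i + p j) →
              d * sumTo n (λ i → sumTo n (w i)) ≤ sumTo n u + sumTo n p
    labels≥ n d u p w rows columns cover = begin
      d * sumTo n (λ i → sumTo n (w i))
        ≡⟨ trans (sumTo-*ˡ n d _) (sumTo-cong n λ i _ → sumTo-*ˡ n d _) ⟩
      sumTo n (λ i → sumTo n (λ j → d * w i j))
        ≤⟨ sumTo-mono n (λ i i<n → sumTo-mono n (λ j j<n → term i j i<n j<n (w i j) refl)) ⟩
      sumTo n (λ i → sumTo n (λ j → u i * w i j + p j * w i j))
        ≡⟨ sumTo-cong n (λ i _ → sumTo-∙ n _ _) ⟩
      sumTo n (λ i → sumTo n (λ j → u i * w i j) + sumTo n (λ j → p j * w i j))
        ≡⟨ sumTo-∙ n _ _ ⟩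
      sumTo n (λ i → sumTo n (λ j → u i * w i j)) + sumTo n (λ i → sumTo n (λ j → p j * w i j))
        ≡⟨ cong (sumTo n (λ i → sumTo n (λ j → u i * w i j)) +_) (sumTo-comm n n _) ⟩
      sumTo n (λ i → sumTo n (λ j → u i * w i j)) + sumTo n (λ j → sumTo n (λ i → p j * w i j))
        ≤⟨ +-mono-≤ (sumTo-mono n (λ i i<n → part (u i) _ (rows i i<n)))
                    (sumTo-mono n (λ j j<n → part (p j) _ (columns j j<n))) ⟩
      sumTo n u + sumTo n p ∎
      where
      open ≤-Reasoning
      term : ∀ i j → i < n → j < n → ∀ x → w i j ≡ x → d * x ≤ u i * x + p j * x
      term i j i<n j<n zero    e rewrite *-zeroʳ d = z≤n
      term i j i<n j<n (suc x) e = ≤-trans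
        (*-monoˡ-≤ (suc x) (cover i j i<n j<n (λ z → 0≢1+n (trans (sym z) e))))
        (≤-reflexive (*-distribʳ-+ (suc x) (u i) (p j)))
      part : ∀ c f → sumTo n f ≤ 1 → sumTo n (λ i → c * f i) ≤ c
      part c f le = ≤-trans (≤-reflexive (sym (sumTo-*ˡ n c f)))
        (≤-trans (*-monoʳ-≤ c le) (≤-reflexive (*-identityʳ c)))

    matched-labels≥ : ∀ {n G A B} → (∀ {i j} → G i j → i < n × j < n) → Matched G A B → ∀ d (u p : ℕ → ℕ) →
                      (∀ {i j} → G i j → d ≤ u i + p j) → d * count n A ≤ sumTo n u + sumTo n p
    matched-labels≥ {n} {G} {A} {B} bounded M d u p cover = ≤-trans
      (≤-reflexive (cong (d *_) (sumTo-cong n (λ i _ → sym (ind-row bounded M i)))))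
      (labels≥ n d u p (ind A)
        (λ i _ → ≤-trans (≤-reflexive (ind-row bounded M i)) (sign≤1 (A i)))
        (λ j _ → ≤-trans (≤-reflexive (ind-column bounded M j)) (sign≤1 (B j)))
        (λ i j _ _ → ind-elim (λ x → x ≢ 0 → d ≤ u i + p j) A i j
          (λ e _ → cover (proj₂ (Matched.to M e))) (λ _ z → ⊥-elim (z refl))))

    count-sides≤ : ∀ {n G A B} → (∀ {i j} → G i j → i < n × j < n) → Matched G A B → count n B ≤ count n A
    count-sides≤ {n} {G} {A} {B} bounded M = ≤-trans
      (≤-trans (≤-reflexive (cong (_+ count n B) (sym (sumTo-ε n))))
        (labels≤ bounded M 1 (λ _ → 0) (λ j → sign (B j)) (λ _ _ _ → refl) (λ j _ e → cong sign e)
          (λ {i} {j} _ → sign≤1 (B j))))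
      (≤-reflexive (+-identityʳ _))

    count-sides : ∀ {n G A B} → (∀ {i j} → G i j → i < n × j < n) → Matched G A B → count n A ≡ count n B
    count-sides bounded M = ≤-antisym
      (count-sides≤ (λ g → let a , b = bounded g in b , a) (transpose M)) (count-sides≤ bounded M)

    suc-∸1 : ∀ {x} → x ≢ 0 → suc (x ∸ 1) ≡ x
    suc-∸1 {zero}  ne = ⊥-elim (ne refl)
    suc-∸1 {suc x} ne = refl

  module Reassign (𝓡 : Reals) where
    open RealRAM 𝓡 using (update)
    open Update 𝓡
    open Matchings
    open ℕ-Sums

    match-free : ∀ {G A B c j} → Matched G A B → G c j → A c ≡ 0 → B j ≡ 0 →
                 Matched G (update c (suc j) A) (update j (suc c) B)
    match-free {G} {A} {B} {c} {j} M g Ac Bj = record { to = to′ ; from = from′ }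
      where
      open Matched M
      to′ : ∀ {i k} → update c (suc j) A i ≡ suc k → update j (suc c) B k ≡ suc i × G i k
      to′ {i} {k} = update-elim (λ x → x ≡ suc k → update j (suc c) B k ≡ suc i × G i k) {f = A}
        (λ { refl refl → update-same j (suc c) B , g })
        (λ i≢c a → let b , g′ = to a in
          trans (update-other {f = B} (λ { refl → 0≢1+n (trans (sym Bj) b) })) b , g′)
      from′ : ∀ {i k} → update j (suc c) B k ≡ suc i → update c (suc j) A i ≡ suc k
      from′ {i} {k} = update-elim (λ x → x ≡ suc i → update c (suc j) A i ≡ suc k) {f = B}
        (λ { refl refl → update-same c (suc j) A })
        (λ k≢j b → let a = from b in
          trans (update-other {f = A} (λ { refl → 0≢1+n (trans (sym Ac) a) })) a)

    match-taken : ∀ {G A B c j} → Matched G A B → G c j → A c ≡ 0 → B j ≢ 0 →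
                  Matched G (update (B j ∸ 1) 0 (update c (suc j) A)) (update j (suc c) B)
    match-taken {G} {A} {B} {c} {j} M g Ac Bj≢0 = record { to = to′ ; from = from′ }
      where
      open Matched M
      o = B j ∸ 1
      Bj : B j ≡ suc o
      Bj = sym (suc-∸1 Bj≢0)
      Ao : A o ≡ suc j
      Ao = from Bj
      c≢o : c ≢ o
      c≢o e = 0≢1+n (trans (sym Ac) (trans (cong A e) Ao))
      to′ : ∀ {i k} → update o 0 (update c (suc j) A) i ≡ suc k → update j (suc c) B k ≡ suc i × G i k
      to′ {i} {k} = update-elim (λ x → x ≡ suc k → update j (suc c) B k ≡ suc i × G i k) {f = update c (suc j) A}
        (λ _ ())
        (λ i≢o → update-elim (λ x → x ≡ suc k → update j (suc c) B k ≡ suc i × G i k) {f = A}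
          (λ { refl refl → update-same j (suc c) B , g })
          (λ i≢c a → let b , g′ = to a in
            trans (update-other {f = B} (λ { refl → i≢o (suc-injective (trans (sym b) Bj)) })) b , g′))
      from′ : ∀ {i k} → update j (suc c) B k ≡ suc i → update o 0 (update c (suc j) A) i ≡ suc k
      from′ {i} {k} = update-elim (λ x → x ≡ suc i → update o 0 (update c (suc j) A) i ≡ suc k) {f = B}
        (λ { refl refl → trans (update-other {f = update c (suc j) A} c≢o) (update-same c (suc j) A) })
        (λ k≢j b → let a = from b in
          trans (update-other {f = update c (suc j) A} (λ { refl → k≢j (suc-injective (trans (sym a) Ao)) }))
                (trans (update-other {f = A} (λ { refl → 0≢1+n (trans (sym Ac) a) })) a))

  module Names where
    nᵛ hᵛ baseᵛ iᵛ jᵛ rowᵛ handᵛ colᵛ otherᵛ endᵛ foundᵛ againᵛ : Name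
    nᵛ = 0 ; hᵛ = 1 ; baseᵛ = 2 ; iᵛ = 3 ; jᵛ = 4 ; rowᵛ = 5 ; handᵛ = 6
    colᵛ = 7 ; otherᵛ = 8 ; endᵛ = 9 ; foundᵛ = 10 ; againᵛ = 11

    edgeᵃ outᵃ curᵃ markᵃ degᵃ adjᵃ leftᵃ rightᵃ priceᵃ levelᵃ ptrᵃ visᵃ parᵃ queueᵃ : Name
    edgeᵃ = 0 ; outᵃ = 1 ; curᵃ = 2 ; markᵃ = 3 ; degᵃ = 4 ; adjᵃ = 5 ; leftᵃ = 6 ; rightᵃ = 7
    priceᵃ = 8 ; levelᵃ = 9 ; ptrᵃ = 10 ; visᵃ = 11 ; parᵃ = 12 ; queueᵃ = 13

    Bᵛ ρᵛ δᵛ marginalᵃ costᵃ planᵃ : Name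
    Bᵛ = 1 ; ρᵛ = 2 ; δᵛ = 3
    marginalᵃ = 0 ; costᵃ = 1 ; planᵃ = 2

  open Names

  infix 8 _⟨_⟩
  infix 5 _⟨_⟩≔_

  -- One-dimensional arrays are stored in row 0.
  _⟨_⟩ : Name → NatExp → NatExp
  a ⟨ e ⟩ = a [ lit 0 , e ]

  _⟨_⟩≔_ : Name → NatExp → NatExp → Program
  a ⟨ i ⟩≔ e = a [ lit 0 , i ]≔ᴺ e

  succ : NatExp → NatExp
  succ e = lit 1 ⊕ e

  pred : NatExp → NatExp
  pred e = e ⊖ lit 1

  positive : NatExp → BoolExp
  positive e = lit 0 <ᴺ e

  _==_ : NatExp → NatExp → BoolExp
  d == e = neg (d <ᴺ e) & neg (e <ᴺ d)

  setup : Program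
  setup =
    ρᵛ ≔ᴿ zeroᴿ ⨾
    for iᵛ (var nᵛ) (ρᵛ ≔ᴿ (var ρᵛ ⊕ oneᴿ)) ⨾
    ρᵛ ≔ᴿ (oneᴿ ⊘ var ρᵛ) ⨾
    for iᵛ (var nᵛ)
      (marginalᵃ [ lit 0 , var iᵛ ]≔ᴿ var ρᵛ ⨾
       for jᵛ (var nᵛ)
         (cond (positive (edgeᵃ [ var iᵛ , var jᵛ ]))
           (costᵃ [ var iᵛ , var jᵛ ]≔ᴿ zeroᴿ)
           (costᵃ [ var iᵛ , var jᵛ ]≔ᴿ var Bᵛ))) ⨾
    transport marginalᵃ marginalᵃ costᵃ planᵃ

  -- The variable base holds h².
  root : Program
  root =
    hᵛ ≔ᴺ lit 0 ⨾
    baseᵛ ≔ᴺ lit 0 ⨾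
    while (var baseᵛ <ᴺ var nᵛ)
      (baseᵛ ≔ᴺ (succ (var hᵛ ⊕ (var hᵛ ⊕ var baseᵛ))) ⨾
       hᵛ ≔ᴺ (succ (var hᵛ)))

  append : Program
  append =
    adjᵃ [ var rowᵛ , degᵃ ⟨ var rowᵛ ⟩ ]≔ᴺ var colᵛ ⨾
    degᵃ ⟨ var rowᵛ ⟩≔ succ (degᵃ ⟨ var rowᵛ ⟩)

  column : NatExp → NatExp
  column o = var baseᵛ ⊕ o

  rotation : Program
  rotation =
    planᵃ [ var rowᵛ , a ]≔ᴿ ((planᵃ [ var rowᵛ , a ]) ⊕ var δᵛ) ⨾
    planᵃ [ u , b ]≔ᴿ ((planᵃ [ u , b ]) ⊕ var δᵛ) ⨾
    planᵃ [ var rowᵛ , b ]≔ᴿ ((planᵃ [ var rowᵛ , b ]) ⊖ var δᵛ) ⨾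
    planᵃ [ u , a ]≔ᴿ ((planᵃ [ u , a ]) ⊖ var δᵛ)
    where
    a = column (pred (var colᵛ))
    b = column (var jᵛ)
    u = pred (var otherᵛ)

  parking : Program
  parking =
    markᵃ [ pred (var colᵛ) , var jᵛ ]≔ᴺ (succ (var rowᵛ)) ⨾
    curᵃ ⟨ var rowᵛ ⟩≔ lit 0

  insertStep : Program
  insertStep =
    colᵛ ≔ᴺ (curᵃ ⟨ var rowᵛ ⟩) ⨾
    otherᵛ ≔ᴺ (markᵃ [ pred (var colᵛ) , var jᵛ ]) ⨾
    cond (positive (var colᵛ))
      (cond (positive (var otherᵛ))
        (cond ((succ (var jᵛ)) == var colᵛ)
          (handᵛ ≔ᴺ lit 0)
          (cond (pred (var otherᵛ) == var rowᵛ)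
            (handᵛ ≔ᴺ lit 0)
            (cond ((planᵃ [ var rowᵛ , column (var jᵛ) ]) ≤ᴿ (planᵃ [ pred (var otherᵛ) , column (pred (var colᵛ)) ]))
              (δᵛ ≔ᴿ (planᵃ [ var rowᵛ , column (var jᵛ) ]) ⨾
               rotation ⨾
               handᵛ ≔ᴺ lit 0)
              (δᵛ ≔ᴿ (planᵃ [ pred (var otherᵛ) , column (pred (var colᵛ)) ]) ⨾
               rotation ⨾
               parking ⨾
               rowᵛ ≔ᴺ (pred (var otherᵛ))))))
        (parking ⨾
         handᵛ ≔ᴺ lit 0))
      (curᵃ ⟨ var rowᵛ ⟩≔ succ (var jᵛ) ⨾
       handᵛ ≔ᴺ lit 0)

  insert : Program
  insert =
    handᵛ ≔ᴺ lit 1 ⨾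
    while (positive (var handᵛ)) insertStep

  clear : Program
  clear =
    for iᵛ (var nᵛ) (curᵃ ⟨ var iᵛ ⟩≔ lit 0) ⨾
    for iᵛ (var hᵛ) (for jᵛ (var hᵛ) (markᵃ [ var iᵛ , var jᵛ ]≔ᴺ lit 0))

  thin : Program
  thin =
    for jᵛ (var hᵛ) (for iᵛ (var nᵛ)
      (cond (positive (edgeᵃ [ var iᵛ , column (var jᵛ) ]))
        (rowᵛ ≔ᴺ (var iᵛ) ⨾ insert)
        skip))

  harvest : Program
  harvest =
    for iᵛ (var nᵛ)
      (cond (positive (curᵃ ⟨ var iᵛ ⟩))
        (rowᵛ ≔ᴺ (var iᵛ) ⨾ colᵛ ≔ᴺ (column (pred (curᵃ ⟨ var iᵛ ⟩))) ⨾ append)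
        skip) ⨾
    for iᵛ (var hᵛ) (for jᵛ (var hᵛ)
      (cond (positive (markᵃ [ var iᵛ , var jᵛ ]))
        (rowᵛ ≔ᴺ (pred (markᵃ [ var iᵛ , var jᵛ ])) ⨾
         colᵛ ≔ᴺ (column (var iᵛ)) ⨾ append ⨾
         colᵛ ≔ᴺ (column (var jᵛ)) ⨾ append)
        skip))

  sparsify : Program
  sparsify =
    baseᵛ ≔ᴺ lit 0 ⨾
    while (var baseᵛ <ᴺ var nᵛ) (clear ⨾ thin ⨾ harvest ⨾ baseᵛ ≔ᴺ (var baseᵛ ⊕ var hᵛ))

  bidStep : Program
  bidStep =
    colᵛ ≔ᴺ (pred (var handᵛ)) ⨾
    cond ((ptrᵃ ⟨ var colᵛ ⟩) <ᴺ (degᵃ ⟨ var colᵛ ⟩))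
      (jᵛ ≔ᴺ (adjᵃ [ var colᵛ , ptrᵃ ⟨ var colᵛ ⟩ ]) ⨾
       ptrᵃ ⟨ var colᵛ ⟩≔ succ (ptrᵃ ⟨ var colᵛ ⟩) ⨾
       cond ((priceᵃ ⟨ var jᵛ ⟩) <ᴺ succ (levelᵃ ⟨ var colᵛ ⟩))
         (priceᵃ ⟨ var jᵛ ⟩≔ succ (levelᵃ ⟨ var colᵛ ⟩) ⨾
          handᵛ ≔ᴺ (rightᵃ ⟨ var jᵛ ⟩) ⨾
          rightᵃ ⟨ var jᵛ ⟩≔ succ (var colᵛ) ⨾
          leftᵃ ⟨ var colᵛ ⟩≔ succ (var jᵛ) ⨾
          cond (positive (var handᵛ)) (leftᵃ ⟨ pred (var handᵛ) ⟩≔ lit 0) skip)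
         skip)
      (cond ((succ (levelᵃ ⟨ var colᵛ ⟩)) <ᴺ var hᵛ) skip (handᵛ ≔ᴺ lit 0) ⨾
       ptrᵃ ⟨ var colᵛ ⟩≔ lit 0 ⨾
       levelᵃ ⟨ var colᵛ ⟩≔ succ (levelᵃ ⟨ var colᵛ ⟩))

  auction : Program
  auction =
    for iᵛ (var nᵛ)
      (handᵛ ≔ᴺ (succ (var iᵛ)) ⨾
       while (positive (var handᵛ)) bidStep)

  -- During a search, base is the front of the queue and end its back.
  prepare : Program
  prepare =
    for iᵛ (var nᵛ) (visᵃ ⟨ var iᵛ ⟩≔ lit 0 ⨾ ptrᵃ ⟨ var iᵛ ⟩≔ lit 0) ⨾
    endᵛ ≔ᴺ lit 0 ⨾
    for iᵛ (var nᵛ)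
      (cond (positive (leftᵃ ⟨ var iᵛ ⟩))
        skip
        (queueᵃ ⟨ var endᵛ ⟩≔ var iᵛ ⨾ endᵛ ≔ᴺ (succ (var endᵛ)))) ⨾
    baseᵛ ≔ᴺ lit 0 ⨾
    foundᵛ ≔ᴺ lit 0

  searchStep : Program
  searchStep =
    rowᵛ ≔ᴺ (queueᵃ ⟨ var baseᵛ ⟩) ⨾
    cond ((ptrᵃ ⟨ var rowᵛ ⟩) <ᴺ (degᵃ ⟨ var rowᵛ ⟩))
      (jᵛ ≔ᴺ (adjᵃ [ var rowᵛ , ptrᵃ ⟨ var rowᵛ ⟩ ]) ⨾
       ptrᵃ ⟨ var rowᵛ ⟩≔ succ (ptrᵃ ⟨ var rowᵛ ⟩) ⨾
       cond (positive (visᵃ ⟨ var jᵛ ⟩))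
         skip
         (visᵃ ⟨ var jᵛ ⟩≔ succ (var endᵛ) ⨾
          parᵃ ⟨ var jᵛ ⟩≔ var rowᵛ ⨾
          cond (positive (rightᵃ ⟨ var jᵛ ⟩))
            (queueᵃ ⟨ var endᵛ ⟩≔ pred (rightᵃ ⟨ var jᵛ ⟩) ⨾
             endᵛ ≔ᴺ (succ (var endᵛ)))
            (foundᵛ ≔ᴺ (succ (var jᵛ)))))
      (baseᵛ ≔ᴺ (succ (var baseᵛ)))

  search : Program
  search = while ((var baseᵛ <ᴺ var endᵛ) & neg (positive (var foundᵛ))) searchStep

  flipStep : Program
  flipStep =
    jᵛ ≔ᴺ (pred (var foundᵛ)) ⨾
    rowᵛ ≔ᴺ (parᵃ ⟨ var jᵛ ⟩) ⨾
    foundᵛ ≔ᴺ (leftᵃ ⟨ var rowᵛ ⟩) ⨾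
    leftᵃ ⟨ var rowᵛ ⟩≔ succ (var jᵛ) ⨾
    rightᵃ ⟨ var jᵛ ⟩≔ succ (var rowᵛ) ⨾
    cond (positive (var foundᵛ)) (rightᵃ ⟨ pred (var foundᵛ) ⟩≔ lit 0) skip

  augment : Program
  augment =
    againᵛ ≔ᴺ lit 1 ⨾
    while (positive (var againᵛ))
      (prepare ⨾
       search ⨾
       againᵛ ≔ᴺ var foundᵛ ⨾
       while (positive (var foundᵛ)) flipStep)

  dense : Program
  dense =
    for iᵛ (var nᵛ)
      (degᵃ ⟨ var iᵛ ⟩≔ lit 0 ⨾
       for jᵛ (var nᵛ)
         (cond (positive (edgeᵃ [ var iᵛ , var jᵛ ]))
           (rowᵛ ≔ᴺ (var iᵛ) ⨾ colᵛ ≔ᴺ (var jᵛ) ⨾ append)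
           skip))

  report : Program
  report =
    for iᵛ (var nᵛ)
      (cond (positive (leftᵃ ⟨ var iᵛ ⟩))
        (outᵃ [ var iᵛ , pred (leftᵃ ⟨ var iᵛ ⟩) ]≔ᴺ lit 1)
        skip)

  maximumMatching : Program
  maximumMatching = setup ⨾ root ⨾ sparsify ⨾ auction ⨾ augment ⨾ dense ⨾ augment ⨾ report

  Adjacent : (deg : ℕ → ℕ) (adj : ℕ → ℕ → ℕ) → Graph
  Adjacent deg adj i j = ∃[ k ] k < deg i × adj i k ≡ j

  module AuctionInvariant (𝓡 : Reals) (n L : ℕ) (deg : ℕ → ℕ) (adj : ℕ → ℕ → ℕ)
    (bounded : ∀ {i j} → Adjacent deg adj i j → i < n × j < n) where
    open RealRAM 𝓡 using (update)
    open Update 𝓡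
    open Matchings
    open Reassign 𝓡
    open ℕ-Sums

    -- Bidders below i₀ have entered; hand is the index plus one of the bidder
    -- to bid next.  Bidder i tries its list in order at level ℓ i and bids on
    -- the first item whose price p does not exceed this level.
    record Auction (i₀ hand : ℕ) (p ℓ ptr A B : ℕ → ℕ) : Set where
      field
        matched   : Matched (Adjacent deg adj) A B
        freePrice : ∀ {j} → B j ≡ 0 → p j ≡ 0
        tight     : ∀ {i j} → A i ≡ suc j → p j ≤ suc (ℓ i) × ℓ i < L
        slack     : ∀ {i k} → k < deg i → ℓ i ≤ p (adj i k)
        tried     : ∀ {i k} → k < deg i → k < ptr i → ℓ i < p (adj i k)
        ptr≤      : ∀ i → ptr i ≤ deg i
        level≤    : ∀ i → ℓ i ≤ L
        left      : ∀ {i} → i < i₀ → A i ≡ 0 → hand ≢ suc i → L ≤ ℓ i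
        bidder    : ∀ {c} → hand ≡ suc c → A c ≡ 0 × ℓ c < L × c < n × c < i₀
        unstarted : ∀ {i} → i₀ ≤ i → A i ≡ 0 × ℓ i ≡ 0

    progress : (ℓ ptr : ℕ → ℕ) → ℕ
    progress ℓ ptr = sumTo n (λ i → ℓ i * suc (deg i) + ptr i)

    goal : ℕ
    goal = sumTo n (λ i → suc L * suc (deg i))

    module _ {i₀ hand p ℓ ptr A B} (a : Auction i₀ hand p ℓ ptr A B) where
      open Auction a
      open Matched matched

      progress+n≤goal : progress ℓ ptr + n ≤ goal
      progress+n≤goal = begin
        progress ℓ ptr + n
          ≡⟨ cong (progress ℓ ptr +_) (trans (sumTo-const n 1) (*-identityʳ n)) ⟨
        progress ℓ ptr + sumTo n (λ _ → 1)
          ≡⟨ sumTo-∙ n _ _ ⟨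
        sumTo n (λ i → ℓ i * suc (deg i) + ptr i + 1)
          ≤⟨ sumTo-mono n (λ i _ → term i) ⟩
        goal ∎
        where
        open ≤-Reasoning
        term : ∀ i → ℓ i * suc (deg i) + ptr i + 1 ≤ suc L * suc (deg i)
        term i = begin
          ℓ i * suc (deg i) + ptr i + 1    ≡⟨ trans (+-assoc (ℓ i * suc (deg i)) (ptr i) 1) (cong (ℓ i * suc (deg i) +_) (+-comm (ptr i) 1)) ⟩
          ℓ i * suc (deg i) + suc (ptr i)  ≤⟨ +-mono-≤ (*-monoˡ-≤ (suc (deg i)) (level≤ i)) (s≤s (ptr≤ i)) ⟩
          L * suc (deg i) + suc (deg i)    ≡⟨ +-comm (L * suc (deg i)) (suc (deg i)) ⟩
          suc L * suc (deg i)              ∎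

      enter : 0 < L → i₀ < n → hand ≡ 0 → Auction (suc i₀) (suc i₀) p ℓ ptr A B
      enter 0<L i₀<n refl = record
        { matched = matched ; freePrice = freePrice ; tight = tight ; slack = slack
        ; tried = tried ; ptr≤ = ptr≤ ; level≤ = level≤
        ; left = λ i<1+i₀ Ai hand≢ →
            left (≤∧≢⇒< (≤-pred i<1+i₀) (λ i≡i₀ → hand≢ (cong suc (sym i≡i₀)))) Ai (λ ())
        ; bidder = λ { refl → let z , e = unstarted ≤-refl in z , subst (_< L) (sym e) 0<L , i₀<n , ≤-refl }
        ; unstarted = λ i₀<i → unstarted (<⇒≤ i₀<i)
        }

      module _ {c} (h : hand ≡ suc c) where
        private
          Ac  = proj₁ (bidder h)
          ℓc<L = proj₁ (proj₂ (bidder h))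
          c<n = proj₁ (proj₂ (proj₂ (bidder h)))
          c<i₀ = proj₂ (proj₂ (proj₂ (bidder h)))
          ptr′ : ℕ → ℕ
          ptr′ = update c (suc (ptr c)) ptr

        progress<goal : progress ℓ ptr < goal
        progress<goal = ≤-trans (≤-reflexive (+-comm 1 _))
          (≤-trans (+-monoʳ-≤ (progress ℓ ptr) (≤-trans (s≤s z≤n) c<n)) progress+n≤goal)

        progress-ptr : progress ℓ ptr′ ≡ suc (progress ℓ ptr)
        progress-ptr = sumTo-suc c<n
          (λ i i≢c → cong (ℓ i * suc (deg i) +_) (update-other {f = ptr} i≢c))
          (trans (cong (ℓ c * suc (deg c) +_) (update-same c _ ptr)) (+-suc _ (ptr c)))

        tried-next : ∀ {p′ : ℕ → ℕ} → (∀ j → p j ≤ p′ j) → ℓ c < p′ (adj c (ptr c)) →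
                     ∀ {i k} → k < deg i → k < ptr′ i → ℓ i < p′ (adj i k)
        tried-next {p′} p≤p′ new {i} {k} k<deg =
          update-elim (λ x → k < x → ℓ i < p′ (adj i k)) {f = ptr}
            (λ { refl k<1+ptr → last k<deg (m≤n⇒m<n∨m≡n (≤-pred k<1+ptr)) })
            (λ _ k<ptr → ≤-trans (tried k<deg k<ptr) (p≤p′ _))
          where
          last : ∀ {k} → k < deg c → k < ptr c ⊎ k ≡ ptr c → ℓ c < p′ (adj c k)
          last k<deg (inj₁ k<ptr) = ≤-trans (tried k<deg k<ptr) (p≤p′ _)
          last k<deg (inj₂ refl)  = new

        ptr≤-next : ptr c < deg c → ∀ i → ptr′ i ≤ deg i
        ptr≤-next lt i = update-elim (_≤ deg i) {f = ptr} (λ { refl → lt }) (λ _ → ptr≤ i)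

        pass : ptr c < deg c → ∀ {j} → adj c (ptr c) ≡ j → ℓ c < p j → Auction i₀ hand p ℓ ptr′ A B
        pass lt refl new = record
          { matched = matched ; freePrice = freePrice ; tight = tight ; slack = slack
          ; tried = tried-next (λ _ → ≤-refl) new ; ptr≤ = ptr≤-next lt ; level≤ = level≤
          ; left = left ; bidder = bidder ; unstarted = unstarted
          }

        bid : ptr c < deg c → ∀ {j} → adj c (ptr c) ≡ j → p j ≤ ℓ c → ∀ {A′} →
              Matched (Adjacent deg adj) A′ (update j (suc c) B) →
              A′ c ≡ suc j → (∀ {i} → B j ≡ suc i → A′ i ≡ 0) →
              (∀ {i} → i ≢ c → B j ≢ suc i → A′ i ≡ A i) →
              Auction i₀ (B j) (update j (suc (ℓ c)) p) ℓ ptr′ A′ (update j (suc c) B)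
        bid lt {j} refl pj≤ {A′} M′ A′c kicked other = record
          { matched = M′
          ; freePrice = λ {j′} → update-elim (λ x → x ≡ 0 → p′ j′ ≡ 0) {j} {j′} {suc c} {f = B}
              (λ _ ()) (λ j′≢j Bj′ → trans (update-other {k = j} {j′} {f = p} j′≢j) (freePrice Bj′))
          ; tight = tight′
          ; slack = λ k<deg → ≤-trans (slack k<deg) (p≤p′ _)
          ; tried = tried-next p≤p′ (≤-reflexive (sym (update-same j _ p)))
          ; ptr≤ = ptr≤-next lt
          ; level≤ = level≤
          ; left = left′
          ; bidder = λ Bj → kicked Bj , proj₂ (tight (from Bj)) , proj₁ (bounded (proj₂ (to (from Bj)))) ,
              ≰⇒> (λ i₀≤ → 0≢1+n (trans (sym (proj₁ (unstarted i₀≤))) (from Bj)))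
          ; unstarted = λ {i} i₀≤i → A′-unstarted i₀≤i , proj₂ (unstarted i₀≤i)
          }
          where
          p′ : ℕ → ℕ
          p′ = update j (suc (ℓ c)) p
          p≤p′ : ∀ j′ → p j′ ≤ p′ j′
          p≤p′ j′ = update-elim (p j′ ≤_) {f = p} (λ { refl → ≤-trans pj≤ (n≤1+n _) }) (λ _ → ≤-refl)
          cases : ∀ i → i ≡ c ⊎ (B j ≡ suc i × A′ i ≡ 0) ⊎ (i ≢ c × B j ≢ suc i × A′ i ≡ A i)
          cases i with i ≟ c | B j ≟ suc i
          ... | yes i≡c | _      = inj₁ i≡c
          ... | no _    | yes Bj = inj₂ (inj₁ (Bj , kicked Bj))
          ... | no i≢c  | no Bj≢ = inj₂ (inj₂ (i≢c , Bj≢ , other i≢c Bj≢))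
          tight′ : ∀ {i j′} → A′ i ≡ suc j′ → p′ j′ ≤ suc (ℓ i) × ℓ i < L
          tight′ {i} {j′} A′i with cases i
          ... | inj₁ refl rewrite suc-injective (trans (sym A′i) A′c) =
            ≤-reflexive (update-same j _ p) , ℓc<L
          ... | inj₂ (inj₁ (_ , z)) = ⊥-elim (0≢1+n (trans (sym z) A′i))
          ... | inj₂ (inj₂ (i≢c , Bj≢ , same)) =
            let Ai = trans (sym same) A′i in
            ≤-trans (≤-reflexive (update-other {f = p} (λ { refl → Bj≢ (proj₁ (to Ai)) }))) (proj₁ (tight Ai)) ,
            proj₂ (tight Ai)
          left′ : ∀ {i} → i < i₀ → A′ i ≡ 0 → B j ≢ suc i → L ≤ ℓ i
          left′ {i} i<i₀ A′i Bj≢ with cases i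
          ... | inj₁ refl = ⊥-elim (0≢1+n (trans (sym A′i) A′c))
          ... | inj₂ (inj₁ (Bj , _)) = ⊥-elim (Bj≢ Bj)
          ... | inj₂ (inj₂ (i≢c , _ , same)) =
            left i<i₀ (trans (sym same) A′i) (λ h′ → i≢c (suc-injective (trans (sym h′) h)))
          A′-unstarted : ∀ {i} → i₀ ≤ i → A′ i ≡ 0
          A′-unstarted {i} i₀≤i with cases i
          ... | inj₁ refl = ⊥-elim (<⇒≱ c<i₀ i₀≤i)
          ... | inj₂ (inj₁ (_ , z)) = z
          ... | inj₂ (inj₂ (_ , _ , same)) = trans same (proj₁ (unstarted i₀≤i))

        bid-free : ptr c < deg c → ∀ {j} → adj c (ptr c) ≡ j → p j ≤ ℓ c → B j ≡ 0 →
          Auction i₀ (B j) (update j (suc (ℓ c)) p) ℓ ptr′ (update c (suc j) A) (update j (suc c) B)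
        bid-free lt refl pj≤ Bj = bid lt refl pj≤ (match-free matched (ptr c , lt , refl) Ac Bj)
          (update-same c _ A) (λ e → ⊥-elim (0≢1+n (trans (sym Bj) e))) (λ i≢c _ → update-other {f = A} i≢c)

        bid-taken : ptr c < deg c → ∀ {j} → adj c (ptr c) ≡ j → p j ≤ ℓ c → B j ≢ 0 →
          Auction i₀ (B j) (update j (suc (ℓ c)) p) ℓ ptr′
            (update (B j ∸ 1) 0 (update c (suc j) A)) (update j (suc c) B)
        bid-taken lt {j} refl pj≤ Bj≢0 = bid lt refl pj≤ (match-taken matched (ptr c , lt , refl) Ac Bj≢0)
          (trans (update-other {f = update c _ A} c≢o) (update-same c _ A))
          (λ {i} e → subst (λ x → update x 0 (update c (suc j) A) i ≡ 0) (sym (cong (_∸ 1) e))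
            (update-same i 0 (update c (suc j) A)))
          (λ {i} i≢c Bj≢ → trans (update-other {k = B j ∸ 1} {i} {f = update c _ A}
                                   (λ { refl → Bj≢ (sym (suc-∸1 Bj≢0)) }))
                                 (update-other {k = c} {i} {f = A} i≢c))
          where
          c≢o : c ≢ B j ∸ 1
          c≢o e = 0≢1+n (trans (sym Ac) (from (trans (sym (suc-∸1 Bj≢0)) (cong suc (sym e)))))

        raise : deg c ≤ ptr c → ∀ {hand′} →
                (hand′ ≡ suc c × suc (ℓ c) < L) ⊎ (hand′ ≡ 0 × L ≤ suc (ℓ c)) →
                Auction i₀ hand′ p (update c (suc (ℓ c)) ℓ) (update c 0 ptr) A B
        raise ge {hand′} next = record
          { matched = matched
          ; freePrice = freePrice
          ; tight = λ {i} {j} Ai → subst (λ x → p j ≤ suc x × x < L)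
              (sym (update-other {f = ℓ} (λ { refl → 0≢1+n (trans (sym Ac) Ai) }))) (tight Ai)
          ; slack = λ {i} {k} → update-elim (λ x → k < deg i → x ≤ p (adj i k)) {f = ℓ}
              (λ { refl k<deg → tried k<deg (≤-trans k<deg ge) }) (λ _ → slack)
          ; tried = λ {i} {k} k<deg k<ptr → update-elim (λ x → k < x → update c (suc (ℓ c)) ℓ i < p (adj i k)) {f = ptr}
              (λ _ ()) (λ i≢c k<ptr → subst (_< p (adj i k)) (sym (update-other {f = ℓ} i≢c)) (tried k<deg k<ptr)) k<ptr
          ; ptr≤ = λ i → update-elim (_≤ deg i) {f = ptr} (λ _ → z≤n) (λ _ → ptr≤ i)
          ; level≤ = λ i → update-elim (_≤ L) {f = ℓ} (λ _ → ℓc<L) (λ _ → level≤ i)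
          ; left = λ {i} i<i₀ Ai h≢ → update-elim (L ≤_) {f = ℓ}
              (λ { refl → retired next h≢ })
              (λ i≢c → left i<i₀ Ai (λ h′ → i≢c (suc-injective (trans (sym h′) h))))
          ; bidder = λ h′ → bidder′ next h′
          ; unstarted = λ {i} i₀≤i → proj₁ (unstarted i₀≤i) ,
              trans (update-other {f = ℓ} (λ { refl → <⇒≱ c<i₀ i₀≤i })) (proj₂ (unstarted i₀≤i))
          }
          where
          retired : (hand′ ≡ suc c × suc (ℓ c) < L) ⊎ (hand′ ≡ 0 × L ≤ suc (ℓ c)) →
                    hand′ ≢ suc c → L ≤ suc (ℓ c)
          retired (inj₁ (e , _)) ne = ⊥-elim (ne e)
          retired (inj₂ (_ , ge′)) _ = ge′
          bidder′ : (hand′ ≡ suc c × suc (ℓ c) < L) ⊎ (hand′ ≡ 0 × L ≤ suc (ℓ c)) → ∀ {c′} →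
                    hand′ ≡ suc c′ → A c′ ≡ 0 × update c (suc (ℓ c)) ℓ c′ < L × c′ < n × c′ < i₀
          bidder′ (inj₁ (refl , lt)) refl = Ac , subst (_< L) (sym (update-same c _ ℓ)) lt , c<n , c<i₀
          bidder′ (inj₂ (refl , _)) ()

        progress-raise : deg c ≤ ptr c →
                         progress (update c (suc (ℓ c)) ℓ) (update c 0 ptr) ≡ suc (progress ℓ ptr)
        progress-raise ge = sumTo-suc c<n
          (λ i i≢c → cong₂ (λ x y → x * suc (deg i) + y) (update-other {f = ℓ} i≢c) (update-other {f = ptr} i≢c))
          (begin
            update c (suc (ℓ c)) ℓ c * suc (deg c) + update c 0 ptr c
              ≡⟨ cong₂ (λ x y → x * suc (deg c) + y) (update-same c _ ℓ) (update-same c 0 ptr) ⟩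
            suc (deg c) + ℓ c * suc (deg c) + 0       ≡⟨ +-identityʳ _ ⟩
            suc (deg c) + ℓ c * suc (deg c)           ≡⟨ cong suc (+-comm (deg c) _) ⟩
            suc (ℓ c * suc (deg c) + deg c)           ≡⟨ cong (λ x → suc (ℓ c * suc (deg c) + x)) (≤-antisym ge (ptr≤ c)) ⟩
            suc (ℓ c * suc (deg c) + ptr c)           ∎)
          where open ≡-Reasoning

    nearly-maximum : ∀ {p ℓ ptr A B} → Auction n 0 p ℓ ptr A B → ∀ {A₁ B₁} → Matched (Adjacent deg adj) A₁ B₁ →
                     L * count n A₁ ≤ suc L * count n A
    nearly-maximum {p} {ℓ} {A = A} a M₁ = ≤-trans
      (matched-labels≥ bounded M₁ L (λ i → L ∸ ℓ i) p
        (λ { {i} (k , k<deg , refl) → ≤-trans (m≤n+m∸n L (ℓ i))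
               (≤-trans (≤-reflexive (+-comm (ℓ i) _)) (+-monoʳ-≤ (L ∸ ℓ i) (slack k<deg))) }))
      (labels≤ bounded matched (suc L) (λ i → L ∸ ℓ i) p
        (λ i i<n Ai → m≤n⇒m∸n≡0 (left i<n Ai (λ ())))
        (λ j _ → freePrice)
        (λ {i} {j} Ai → ≤-trans (+-monoʳ-≤ (L ∸ ℓ i) (proj₁ (tight Ai)))
          (≤-reflexive (trans (+-suc (L ∸ ℓ i) (ℓ i)) (cong suc (m∸n+n≡m (level≤ i)))))))
      where open Auction a

  module SearchInvariant (𝓡 : Reals) (n : ℕ) (deg : ℕ → ℕ) (adj : ℕ → ℕ → ℕ)
    (bounded : ∀ {i j} → Adjacent deg adj i j → i < n × j < n) where
    open RealRAM 𝓡 using (update)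
    open Update 𝓡
    open Matchings
    open Reassign 𝓡
    open ℕ-Sums

    -- The vertex par j precedes j on an alternating path whose earlier vertices
    -- on the side of j were visited before j.
    Parent : (A vis par : ℕ → ℕ) → ℕ → Set
    Parent A vis par j = Adjacent deg adj (par j) j ×
      (A (par j) ≡ 0 ⊎ ∃[ o ] A (par j) ≡ suc o × vis o ≢ 0 × vis o < vis j)

    record Search (A B : ℕ → ℕ) (q qe : ℕ) (ptr vis par Q : ℕ → ℕ) : Set where
      field
        queued  : ∀ {k} → k < qe → A (Q k) ≡ 0 ⊎ ∃[ o ] A (Q k) ≡ suc o × vis o ≢ 0
        mate    : ∀ {j} → j < n → vis j ≢ 0 → ∃[ i ] B j ≡ suc i × ∃[ k ] k < qe × Q k ≡ i
        exposed : ∀ {i} → i < n → A i ≡ 0 → ∃[ k ] k < qe × Q k ≡ i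
        seen    : ∀ {i k} → k < deg i → k < ptr i → vis (adj i k) ≢ 0
        ptr≤    : ∀ {i} → i < n → ptr i ≤ deg i
        popped  : ∀ {k} → k < q → deg (Q k) ≤ ptr (Q k)
        vis≤    : ∀ {j} → j < n → vis j ≤ qe
        q≤qe    : q ≤ qe
        qe≤     : qe ≤ n + count n vis
        parent  : ∀ {j} → j < n → vis j ≢ 0 → Parent A vis par j

    progress : ℕ → (ℕ → ℕ) → ℕ
    progress q ptr = q + sumTo n ptr

    goal : ℕ
    goal = n + n + sumTo n deg

    record Augmenting (j : ℕ) (vis par A B : ℕ → ℕ) : Set where
      field
        matched : Matched (Adjacent deg adj) A B
        free    : B j ≡ 0
        visited : vis j ≢ 0
        chain   : ∀ {j′} → j′ < n → vis j′ ≢ 0 → vis j′ ≤ vis j → Parent A vis par j′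
        j<n     : j < n

    start : ∀ {A B qe ptr vis par Q} →
            (∀ {k} → k < qe → A (Q k) ≡ 0) → (∀ {i} → i < n → A i ≡ 0 → ∃[ k ] k < qe × Q k ≡ i) →
            qe ≤ n → (∀ {j} → j < n → vis j ≡ 0) → (∀ {i} → i < n → ptr i ≡ 0) →
            Search A B 0 qe ptr vis par Q
    start {qe = qe} {ptr} free all qe≤n vis0 ptr0 = record
      { queued = λ lt → inj₁ (free lt)
      ; mate = λ j<n ne → ⊥-elim (ne (vis0 j<n))
      ; exposed = all
      ; seen = λ {i} {k} k<deg k<ptr → ⊥-elim (n≮0 (subst (k <_) (ptr0 (proj₁ (bounded (k , k<deg , refl)))) k<ptr))
      ; ptr≤ = λ {i} i<n → subst (_≤ deg i) (sym (ptr0 i<n)) z≤n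
      ; popped = λ ()
      ; vis≤ = λ j<n → subst (_≤ qe) (sym (vis0 j<n)) z≤n
      ; q≤qe = z≤n
      ; qe≤ = ≤-trans qe≤n (m≤m+n n _)
      ; parent = λ j<n ne → ⊥-elim (ne (vis0 j<n))
      }

    module _ {A B q qe ptr vis par Q} (M : Matched (Adjacent deg adj) A B) (S : Search A B q qe ptr vis par Q) where
      open Search S
      open Matched M

      progress≤goal : progress q ptr ≤ goal
      progress≤goal = +-mono-≤ (≤-trans q≤qe (≤-trans qe≤ (+-monoʳ-≤ n (count≤ n vis))))
        (sumTo-mono n (λ i i<n → ptr≤ i<n))

      progress<goal : q < qe → progress q ptr < goal
      progress<goal q<qe = +-mono-≤ (≤-trans q<qe (≤-trans qe≤ (+-monoʳ-≤ n (count≤ n vis))))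
        (sumTo-mono n (λ i i<n → ptr≤ i<n))

      pop : q < qe → deg (Q q) ≤ ptr (Q q) → Search A B (suc q) qe ptr vis par Q
      pop q<qe ge = record
        { queued = queued ; mate = mate ; exposed = exposed ; seen = seen ; ptr≤ = ptr≤
        ; popped = λ k<1+q → popped′ (m≤n⇒m<n∨m≡n (≤-pred k<1+q))
        ; vis≤ = vis≤ ; q≤qe = q<qe ; qe≤ = qe≤ ; parent = parent
        }
        where
        popped′ : ∀ {k} → k < q ⊎ k ≡ q → deg (Q k) ≤ ptr (Q k)
        popped′ (inj₁ k<q)  = popped k<q
        popped′ (inj₂ refl) = ge

      module _ {i j} (lt : ptr i < deg i) (next : adj i (ptr i) ≡ j) where
        private
          i<n = proj₁ (bounded (ptr i , lt , next))
          j<n = proj₂ (bounded (ptr i , lt , next))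
          ptr′ : ℕ → ℕ
          ptr′ = update i (suc (ptr i)) ptr
          vis′ : ℕ → ℕ
          vis′ = update j (suc qe) vis
          par′ : ℕ → ℕ
          par′ = update j i par

          ptr≤ptr′ : ∀ k → ptr k ≤ ptr′ k
          ptr≤ptr′ k = update-elim (ptr k ≤_) {f = ptr} (λ { refl → n≤1+n _ }) (λ _ → ≤-refl)

          ptr′≤ : ∀ {k} → k < n → ptr′ k ≤ deg k
          ptr′≤ {k} k<n = update-elim (_≤ deg k) {f = ptr} (λ { refl → lt }) (λ _ → ptr≤ k<n)

          seen′ : ∀ {v : ℕ → ℕ} → (∀ {k} → vis k ≢ 0 → v k ≢ 0) → v j ≢ 0 →
                  ∀ {i′ k} → k < deg i′ → k < ptr′ i′ → v (adj i′ k) ≢ 0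
          seen′ {v} mono new {i′} {k} k<deg = update-elim (λ x → k < x → v (adj i′ k) ≢ 0) {f = ptr}
            (λ { refl k<1+ptr → last k<deg (m≤n⇒m<n∨m≡n (≤-pred k<1+ptr)) })
            (λ _ k<ptr → mono (seen k<deg k<ptr))
            where
            last : ∀ {k} → k < deg i → k < ptr i ⊎ k ≡ ptr i → v (adj i k) ≢ 0
            last k<deg (inj₁ k<ptr) = mono (seen k<deg k<ptr)
            last k<deg (inj₂ refl)  = subst (λ x → v x ≢ 0) (sym next) new

          vis-mono : ∀ {k} → vis k ≢ 0 → vis′ k ≢ 0
          vis-mono {k} ne = update-elim (_≢ 0) {j} {k} {f = vis} (λ _ ()) (λ _ → ne)

          vis′j : vis′ j ≡ suc qe
          vis′j = update-same j _ vis

          parent′ : vis j ≡ 0 → (A i ≡ 0 ⊎ ∃[ o ] A i ≡ suc o × vis o ≢ 0) →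
                    ∀ {j′} → j′ < n → vis′ j′ ≢ 0 → Parent A vis′ par′ j′
          parent′ unseen reached {j′} j′<n with j′ ≟ j
          ... | yes refl rewrite update-same j i par | vis′j = λ _ → (ptr i , lt , next) , earlier reached
            where
            earlier : (A i ≡ 0 ⊎ ∃[ o ] A i ≡ suc o × vis o ≢ 0) →
                      A i ≡ 0 ⊎ ∃[ o ] A i ≡ suc o × vis′ o ≢ 0 × vis′ o < suc qe
            earlier (inj₁ z) = inj₁ z
            earlier (inj₂ (o , Ai , ne)) = inj₂ (o , Ai , vis-mono ne ,
              s≤s (≤-trans (≤-reflexive (update-other {k = j} {o} {f = vis} (λ { refl → ne unseen })))
                           (vis≤ (proj₂ (bounded (proj₂ (to Ai)))))))
          ... | no j′≢j rewrite update-other {k = j} {j′} {i} {par} j′≢j | update-other {k = j} {j′} {suc qe} {vis} j′≢j =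
            λ ne → let adjacent , rest = parent j′<n ne in adjacent , earlier rest
            where
            earlier : (A (par j′) ≡ 0 ⊎ ∃[ o ] A (par j′) ≡ suc o × vis o ≢ 0 × vis o < vis j′) →
                      A (par j′) ≡ 0 ⊎ ∃[ o ] A (par j′) ≡ suc o × vis′ o ≢ 0 × vis′ o < vis j′
            earlier (inj₁ z) = inj₁ z
            earlier (inj₂ (o , Ai , ne , o<)) = inj₂ (o , Ai , vis-mono ne ,
              subst (_< vis j′) (sym (update-other {k = j} {o} {f = vis} (λ { refl → ne unseen }))) o<)

        progress-advance : progress q ptr′ ≡ suc (progress q ptr)
        progress-advance = trans (cong (q +_) (sumTo-suc i<n (λ _ ne → update-other {f = ptr} ne) (update-same i _ ptr)))
          (+-suc q _)

        advance : vis j ≢ 0 → Search A B q qe ptr′ vis par Q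
        advance ne = record
          { queued = queued ; mate = mate ; exposed = exposed ; seen = seen′ (λ x → x) ne ; ptr≤ = ptr′≤
          ; popped = λ {k} k<q → ≤-trans (popped k<q) (ptr≤ptr′ (Q k))
          ; vis≤ = vis≤ ; q≤qe = q≤qe ; qe≤ = qe≤ ; parent = parent
          }

        push : q < qe → Q q ≡ i → vis j ≡ 0 → B j ≢ 0 →
               Search A B q (suc qe) ptr′ vis′ par′ (update qe (B j ∸ 1) Q)
        push q<qe Qq unseen Bj≢0 = record
          { queued = λ k<1+qe → queued′ (m≤n⇒m<n∨m≡n (≤-pred k<1+qe))
          ; mate = mate′
          ; exposed = λ i<n Ai → let k , k<qe , e = exposed i<n Ai in
              k , ≤-trans k<qe (n≤1+n qe) , trans (Q′-old k<qe) e
          ; seen = seen′ vis-mono (λ e → 0≢1+n (trans (sym e) vis′j))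
          ; ptr≤ = ptr′≤
          ; popped = λ {k} k<q → subst (λ x → deg x ≤ ptr′ x) (sym (Q′-old (≤-trans k<q q≤qe)))
              (≤-trans (popped k<q) (ptr≤ptr′ (Q k)))
          ; vis≤ = λ {j′} j′<n → update-elim (_≤ suc qe) {j} {j′} {f = vis}
              (λ _ → ≤-refl) (λ _ → ≤-trans (vis≤ j′<n) (n≤1+n qe))
          ; q≤qe = ≤-trans q≤qe (n≤1+n qe)
          ; qe≤ = ≤-trans (s≤s qe≤) (≤-reflexive (sym (trans (cong (n +_) count′) (+-suc n _))))
          ; parent = parent′ unseen (subst (λ x → A x ≡ 0 ⊎ ∃[ o ] A x ≡ suc o × vis o ≢ 0) Qq (queued q<qe))
          }
          where
          o = B j ∸ 1
          Bj : B j ≡ suc o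
          Bj = sym (suc-∸1 Bj≢0)
          Q′ : ℕ → ℕ
          Q′ = update qe o Q
          Q′-old : ∀ {k} → k < qe → Q′ k ≡ Q k
          Q′-old k<qe = update-other {f = Q} (<⇒≢ k<qe)
          queued′ : ∀ {k} → k < qe ⊎ k ≡ qe → A (Q′ k) ≡ 0 ⊎ ∃[ o ] A (Q′ k) ≡ suc o × vis′ o ≢ 0
          queued′ (inj₁ k<qe) rewrite Q′-old k<qe with queued k<qe
          ... | inj₁ z = inj₁ z
          ... | inj₂ (o , e , ne) = inj₂ (o , e , vis-mono ne)
          queued′ (inj₂ refl) rewrite update-same qe o Q =
            inj₂ (j , from Bj , λ e → 0≢1+n (trans (sym e) vis′j))
          mate′ : ∀ {j′} → j′ < n → vis′ j′ ≢ 0 → ∃[ i ] B j′ ≡ suc i × ∃[ k ] k < suc qe × Q′ k ≡ i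
          mate′ {j′} j′<n = update-elim (λ x → x ≢ 0 → ∃[ i ] B j′ ≡ suc i × ∃[ k ] k < suc qe × Q′ k ≡ i)
            {j} {j′} {f = vis}
            (λ { refl _ → o , Bj , qe , ≤-refl , update-same qe o Q })
            (λ _ ne → let i , Bj′ , k , k<qe , e = mate j′<n ne in
              i , Bj′ , k , ≤-trans k<qe (n≤1+n qe) , trans (Q′-old k<qe) e)
          count′ : count n vis′ ≡ suc (count n vis)
          count′ = sumTo-suc j<n (λ k ne → cong sign (update-other {k = j} {k} {f = vis} ne))
            (trans (cong sign vis′j) (cong (suc ∘ sign) (sym unseen)))

        find : q < qe → Q q ≡ i → vis j ≡ 0 → B j ≡ 0 → Augmenting j vis′ par′ A B × vis′ j ≤ suc (n + n)
        find q<qe Qq unseen Bj = record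
          { matched = M
          ; free = Bj
          ; visited = λ e → 0≢1+n (trans (sym e) vis′j)
          ; chain = λ j′<n ne _ →
              parent′ unseen (subst (λ x → A x ≡ 0 ⊎ ∃[ o ] A x ≡ suc o × vis o ≢ 0) Qq (queued q<qe)) j′<n ne
          ; j<n = j<n
          } , subst (_≤ suc (n + n)) (sym vis′j) (s≤s (≤-trans qe≤ (+-monoʳ-≤ n (count≤ n vis))))

      -- König: the unfinished left and the visited right vertices cover.
      cover : qe ≤ q → ∃[ u ] ∃[ p ] (sumTo n u + sumTo n p ≤ count n A) ×
                       (∀ {i j} → Adjacent deg adj i j → 1 ≤ u i + p j)
      cover qe≤q = u , p ,
        ≤-trans (labels≤ bounded M 1 u p
          (λ i i<n Ai → let k , k<qe , e = exposed i<n Ai in done k<qe e)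
          (λ j j<n Bj → unvisited j<n Bj)
          slack)
          (≤-reflexive (*-identityˡ _)) ,
        edge
        where
        u p : ℕ → ℕ
        u i = if ptr i <ᵇ deg i then 1 else 0
        p j = sign (vis j)
        u≤1 : ∀ i → u i ≤ 1
        u≤1 i with ptr i <ᵇ deg i
        ... | true  = ≤-refl
        ... | false = z≤n
        done : ∀ {i k} → k < qe → Q k ≡ i → u i ≡ 0
        done {k = k} k<qe refl with ptr (Q k) <ᵇ deg (Q k) in eq
        ... | false = refl
        ... | true  = ⊥-elim (<⇒≱ (<ᵇ⇒< _ _ (subst T (sym eq) _)) (popped (≤-trans k<qe qe≤q)))
        unvisited : ∀ {j} → j < n → B j ≡ 0 → p j ≡ 0
        unvisited {j} j<n Bj with vis j in eq
        ... | zero  = refl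
        ... | suc v = ⊥-elim (0≢1+n (trans (sym Bj) (proj₁ (proj₂ (mate j<n (λ e → 0≢1+n (trans (sym e) eq)))))))
        slack : ∀ {i j} → A i ≡ suc j → u i + p j ≤ 1
        slack {i} {j} Ai with vis j in eq
        ... | zero  = ≤-trans (≤-reflexive (+-identityʳ _)) (u≤1 i)
        ... | suc v with mate (proj₂ (bounded (proj₂ (to Ai)))) (λ e → 0≢1+n (trans (sym e) eq))
        ...   | i′ , Bj , k , k<qe , e =
          ≤-reflexive (cong (_+ 1) (done k<qe (trans e (suc-injective (trans (sym Bj) (proj₁ (to Ai)))))))
        edge : ∀ {i j} → Adjacent deg adj i j → 1 ≤ u i + p j
        edge {i} (k , k<deg , refl) with ptr i <ᵇ deg i in eq
        ... | true  = s≤s z≤n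
        ... | false with vis (adj i k) in eq′
        ...   | suc _ = s≤s z≤n
        ...   | zero  = ⊥-elim (seen k<deg
          (≤-trans k<deg (≮⇒≥ (λ lt → subst T eq (<⇒<ᵇ lt)))) eq′)

    module _ {j vis par A B} (P : Augmenting j vis par A B) where
      open Augmenting P
      private
        i = par j
        edge = proj₁ (chain j<n visited ≤-refl)
        i<n = proj₁ (bounded edge)

      flip-last : A i ≡ 0 → Matched (Adjacent deg adj) (update i (suc j) A) (update j (suc i) B) ×
                            count n (update i (suc j) A) ≡ suc (count n A)
      flip-last Ai = match-free matched edge Ai free ,
        sumTo-suc i<n (λ k ne → cong sign (update-other {k = i} {k} {f = A} ne))
          (trans (cong sign (update-same i _ A)) (cong (suc ∘ sign) (sym Ai)))

      flip-next : A i ≢ 0 → let o = A i ∸ 1 in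
                  Augmenting o vis par (update i (suc j) A) (update o 0 (update j (suc i) B)) ×
                  count n (update i (suc j) A) ≡ count n A × vis o < vis j
      flip-next Ai≢0 with chain j<n visited ≤-refl
      ... | _ , inj₁ Ai = ⊥-elim (Ai≢0 Ai)
      ... | _ , inj₂ (o , Ai , ne , o<j) rewrite Ai = record
        { matched = transpose (subst (λ x → Matched (flip (Adjacent deg adj)) (update (x ∸ 1) 0 (update j (suc i) B)) (update i (suc j) A)) Ai
                      (match-taken (transpose matched) edge free Ai≢0′))
        ; free = update-same o 0 (update j (suc i) B)
        ; visited = ne
        ; chain = chain′
        ; j<n = proj₂ (bounded (proj₂ (Matched.to matched Ai)))
        } ,
        sumTo-same i<n (λ k ne → cong sign (update-other {k = i} {k} {f = A} ne))
          (trans (cong sign (update-same i _ A)) (cong sign (sym Ai))) ,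
        o<j
        where
        Ai≢0′ : A i ≢ 0
        Ai≢0′ e = 0≢1+n (trans (sym e) Ai)
        chain′ : ∀ {j′} → j′ < n → vis j′ ≢ 0 → vis j′ ≤ vis o → Parent (update i (suc j) A) vis par j′
        chain′ {j′} j′<n ne′ le with chain j′<n ne′ (≤-trans le (<⇒≤ o<j))
        ... | adjacent , rest = adjacent ,
          subst (λ x → x ≡ 0 ⊎ ∃[ o ] x ≡ suc o × vis o ≢ 0 × vis o < vis j′)
            (sym (update-other {k = i} {par j′} {f = A} (differs rest))) rest
          where
          differs : (A (par j′) ≡ 0 ⊎ ∃[ o ] A (par j′) ≡ suc o × vis o ≢ 0 × vis o < vis j′) → par j′ ≢ i
          differs (inj₁ z) e = Ai≢0′ (trans (cong A (sym e)) z)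
          differs (inj₂ (o′ , Ao′ , _ , o′<)) e
            rewrite suc-injective (trans (sym Ao′) (trans (cong A e) Ai)) = <⇒≱ o′< le

  module Tests where
    <-true : ∀ {a b} → (a <ᵇ b) ≡ true → a < b
    <-true {a} {b} e = <ᵇ⇒< a b (subst T (sym e) _)

    <-false : ∀ {a b} → (a <ᵇ b) ≡ false → b ≤ a
    <-false e = ≮⇒≥ (λ lt → subst T e (<⇒<ᵇ lt))

    0<-true : ∀ {a} → (0 <ᵇ a) ≡ true → a ≢ 0
    0<-true {suc a} e ()

    0<-false : ∀ {a} → (0 <ᵇ a) ≡ false → a ≡ 0
    0<-false {zero} e = refl

    ==-true : ∀ {a b} → (not (a <ᵇ b) ∧ not (b <ᵇ a)) ≡ true → a ≡ b
    ==-true {a} {b} e with a <ᵇ b in a<b | b <ᵇ a in b<a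
    ... | false | false = ≤-antisym (<-false b<a) (<-false a<b)

    ==-false : ∀ {a b} → (not (a <ᵇ b) ∧ not (b <ᵇ a)) ≡ false → a ≢ b
    ==-false {a} e refl with a <ᵇ a in a<a
    ... | true = <-irrefl refl (<-true {a} {a} a<a)

    does-true : ∀ {P : Set} (d : Dec P) → ⌊ d ⌋ ≡ true → P
    does-true (yes p) e = p

    does-false : ∀ {P : Set} (d : Dec P) → ⌊ d ⌋ ≡ false → ¬ P
    does-false (no ¬p) e = ¬p

    drop≤ : ∀ j {x} → x ≤ j + x
    drop≤ j {x} = m≤n+m x j

  module AuctionRun (𝓡 : Reals) {size : ℕ} (O : OptimalTransport.Oracle 𝓡 size) (τ : ℕ)
    (n L : ℕ) (0<L : 0 < L) (deg : ℕ → ℕ) (adj : ℕ → ℕ → ℕ)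
    (bounded : ∀ {i j} → Adjacent deg adj i j → i < n × j < n) where
    open RealRAM 𝓡
    open Logic 𝓡 O τ
    open AuctionInvariant 𝓡 n L deg adj bounded
    open Matchings
    open ℕ-Sums using (count; sumTo; sumTo-cong; sumTo-ε)
    open Tests

    AuctionAt : ℕ → Store → Set
    AuctionAt i₀ s = Auction i₀ (natVar s handᵛ) (natArray s priceᵃ 0) (natArray s levelᵃ 0) (natArray s ptrᵃ 0)
                             (natArray s leftᵃ 0) (natArray s rightᵃ 0)

    record Context (s : Store) : Set where
      constructor context
      field
        n≡   : natVar s nᵛ ≡ n
        h≡   : natVar s hᵛ ≡ L
        deg≡ : natArray s degᵃ 0 ≡ deg
        adj≡ : natArray s adjᵃ ≡ adj

    progressAt : Store → ℕ
    progressAt s = progress (natArray s levelᵃ 0) (natArray s ptrᵃ 0)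

    Loop : ℕ → ℕ → Assertion
    Loop i r k s = ∃[ m ] m + progressAt s ≡ goal × suc (m * 12 + r) ≡ k ×
                          AuctionAt (suc i) s × Context s × natVar s iᵛ ≡ i

    bidStep-ok : ∀ i r k s → Loop i r k s → (0 <ᵇ natVar s handᵛ) ≡ true →
                 spend (λ k → Ends bidStep k s (↓ (Loop i r))) k
    bidStep-ok i r k s (zero , total , refl , a , _) go =
      ⊥-elim (<-irrefl total (progress<goal a (sym (suc-∸1 (0<-true go)))))
    bidStep-ok i r k s (suc m , total , refl , a , context n≡ h≡ deg≡ adj≡ , i≡) go = sound bidStep
      (c , refl ,
      (λ lt → let ptr<deg = subst (λ f → ptr c < f c) deg≡ (<-true lt) in
        j , refl , 0 , c , suc (ptr c) , refl ,
        (λ cheap → let price≤ = ≤-pred (<-true cheap) in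
          0 , j , suc (level c) , refl , right j , refl , 0 , j , suc c , refl , 0 , c , suc j , refl ,
          (λ taken → 0 , right j ∸ 1 , 0 , refl , _ , drop≤ 0 , m , advanced , refl ,
             bid-taken a c≡ ptr<deg next price≤ (0<-true taken) , context n≡ h≡ deg≡ adj≡ , i≡) ,
          (λ free → _ , drop≤ 0 , m , advanced , refl ,
             bid-free a c≡ ptr<deg next price≤ (0<-false free) , context n≡ h≡ deg≡ adj≡ , i≡)) ,
        (λ dear → _ , drop≤ 5 , m , advanced , refl ,
           pass a c≡ ptr<deg next (<-false dear) , context n≡ h≡ deg≡ adj≡ , i≡)) ,
      (λ ge → let deg≤ptr = subst (λ f → f c ≤ ptr c) deg≡ (<-false ge) in
        (λ lt → 0 , c , 0 , refl , 0 , c , suc (level c) , refl , _ , drop≤ 5 , m , raised deg≤ptr , refl ,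
           raise a c≡ deg≤ptr (inj₁ (c≡ , subst (suc (level c) <_) h≡ (<-true lt))) ,
           context n≡ h≡ deg≡ adj≡ , i≡) ,
        (λ ge′ → 0 , refl , 0 , c , 0 , refl , 0 , c , suc (level c) , refl , _ , drop≤ 5 , m , raised deg≤ptr , refl ,
           raise a c≡ deg≤ptr (inj₂ (refl , subst (_≤ suc (level c)) h≡ (<-false ge′))) ,
           context n≡ h≡ deg≡ adj≡ , i≡)))
      where
      c = natVar s handᵛ ∸ 1
      c≡ : natVar s handᵛ ≡ suc c
      c≡ = sym (suc-∸1 (0<-true go))
      ptr level right : ℕ → ℕ
      ptr = natArray s ptrᵃ 0
      level = natArray s levelᵃ 0
      right = natArray s rightᵃ 0
      j = natArray s adjᵃ c (ptr c)
      next : adj c (ptr c) ≡ j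
      next = cong (λ f → f c (ptr c)) (sym adj≡)
      advanced : m + progress level (update c (suc (ptr c)) ptr) ≡ goal
      advanced = trans (cong (m +_) (progress-ptr a c≡)) (trans (+-suc m _) total)
      raised : deg c ≤ ptr c → m + progress (update c (suc (level c)) level) (update c 0 ptr) ≡ goal
      raised deg≤ptr = trans (cong (m +_) (progress-raise a c≡ deg≤ptr)) (trans (+-suc m _) total)

    Outer : ℕ → ℕ → Store → Set
    Outer i y s = ∃[ m ] m + progressAt s ≡ goal × m * 12 ≡ y ×
                         Auction i 0 (natArray s priceᵃ 0) (natArray s levelᵃ 0) (natArray s ptrᵃ 0)
                                 (natArray s leftᵃ 0) (natArray s rightᵃ 0) × Context s

    auctionCost : ℕ
    auctionCost = forCost n 2 + goal * 12

    auction-ok : ∀ s → natVar s nᵛ ≡ n → natVar s hᵛ ≡ L → natArray s degᵃ 0 ≡ deg → natArray s adjᵃ ≡ adj →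
                 (∀ i → natArray s priceᵃ 0 i ≡ 0) → (∀ i → natArray s levelᵃ 0 i ≡ 0) →
                 (∀ i → natArray s ptrᵃ 0 i ≡ 0) → (∀ i → natArray s leftᵃ 0 i ≡ 0) →
                 (∀ i → natArray s rightᵃ 0 i ≡ 0) →
                 Ends auction auctionCost s
                   (λ _ s′ → Auction n 0 (natArray s′ priceᵃ 0) (natArray s′ levelᵃ 0) (natArray s′ ptrᵃ 0)
                                         (natArray s′ leftᵃ 0) (natArray s′ rightᵃ 0))
    auction-ok s n≡ h≡ deg≡ adj≡ price level ptr left right = weaken (λ { (_ , _ , _ , _ , _ , a , _) → a }) (sound auction
      (forRule iᵛ (var nᵛ) _ n 2 Outer (λ { i y s (_ , _ , _ , _ , context n≡ _ _ _) → n≡ }) body {0}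
        (goal , start , refl , initially , context n≡ h≡ deg≡ adj≡)))
      where
      initially : Auction 0 0 (natArray s priceᵃ 0) (natArray s levelᵃ 0) (natArray s ptrᵃ 0)
                              (natArray s leftᵃ 0) (natArray s rightᵃ 0)
      initially = record
        { matched = record { to = λ {i} e → ⊥-elim (0≢1+n (trans (sym (left i)) e))
                           ; from = λ {i} {j} e → ⊥-elim (0≢1+n (trans (sym (right j)) e)) }
        ; freePrice = λ {j} _ → price j
        ; tight = λ {i} e → ⊥-elim (0≢1+n (trans (sym (left i)) e))
        ; slack = λ {i} _ → ≤-trans (≤-reflexive (level i)) z≤n
        ; tried = λ {i} {k} _ lt → ⊥-elim (n≮0 (subst (k <_) (ptr i) lt))
        ; ptr≤ = λ i → ≤-trans (≤-reflexive (ptr i)) z≤n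
        ; level≤ = λ i → ≤-trans (≤-reflexive (level i)) z≤n
        ; left = λ ()
        ; bidder = λ ()
        ; unstarted = λ {i} _ → left i , level i
        }
      start : goal + progressAt s ≡ goal
      start = trans (cong (goal +_) (trans
        (sumTo-cong n (λ i _ → cong₂ (λ x y → x * suc (deg i) + y) (level i) (ptr i))) (sumTo-ε n))) (+-identityʳ goal)
      body : ∀ i r y s → i < n → natVar s iᵛ ≡ i → Outer i y s →
             Ends (handᵛ ≔ᴺ succ (var iᵛ) ⨾ while (positive (var handᵛ)) bidStep) (2 + (r + y)) s (Advanced iᵛ i r (Outer (suc i)))
      body i r y s i<n refl (m , total , refl , a , context n≡ h≡ deg≡ adj≡) =
        sound (handᵛ ≔ᴺ succ (var iᵛ) ⨾ while (positive (var handᵛ)) bidStep)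
          (suc (natVar s iᵛ) , refl , loop (positive (var handᵛ)) bidStep (Loop i r) (bidStep-ok i r) stop
            (m , total , cong suc (+-comm (m * 12) r) , enter a 0<L i<n refl , context n≡ h≡ deg≡ adj≡ , refl))
        where
        stop : ∀ k s → Loop i r k s → (0 <ᵇ natVar s handᵛ) ≡ false →
               spend (λ k → ∃[ y′ ] r + y′ ≤ k × natVar s iᵛ ≡ i × Outer (suc i) y′ (assignN iᵛ (suc i) s)) k
        stop _ s (m , total , refl , a , context n≡ h≡ deg≡ adj≡ , i≡) go =
          m * 12 , ≤-reflexive (+-comm r _) , i≡ , m , total , refl ,
          subst (λ h → Auction (suc i) h _ _ _ _ _) (0<-false go) a , context n≡ h≡ deg≡ adj≡

  module AugmentRun (𝓡 : Reals) {size : ℕ} (O : OptimalTransport.Oracle 𝓡 size) (τ : ℕ)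
    (n : ℕ) (deg : ℕ → ℕ) (adj : ℕ → ℕ → ℕ)
    (bounded : ∀ {i j} → Adjacent deg adj i j → i < n × j < n) where
    open RealRAM 𝓡
    open Update 𝓡
    open Logic 𝓡 O τ
    open SearchInvariant 𝓡 n deg adj bounded
    open Matchings
    open ℕ-Sums using (count; count≤)
    open Tests

    record Base (z n′ : ℕ) (deg′ : ℕ → ℕ) (adj′ : ℕ → ℕ → ℕ) (left right : ℕ → ℕ) : Set where
      constructor base
      field
        n≡      : n′ ≡ n
        deg≡    : deg′ ≡ deg
        adj≡    : adj′ ≡ adj
        matched : Matched (Adjacent deg adj) left right
        size≡   : count n left ≡ z

    BaseAt : ℕ → Store → Set
    BaseAt z s = Base z (natVar s nᵛ) (natArray s degᵃ 0) (natArray s adjᵃ) (natArray s leftᵃ 0) (natArray s rightᵃ 0)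

    SearchAt : Store → Set
    SearchAt s = Search (natArray s leftᵃ 0) (natArray s rightᵃ 0) (natVar s baseᵛ) (natVar s endᵛ)
                        (natArray s ptrᵃ 0) (natArray s visᵃ 0) (natArray s parᵃ 0) (natArray s queueᵃ 0)

    AugmentingAt : ℕ → Store → Set
    AugmentingAt j s = Augmenting j (natArray s visᵃ 0) (natArray s parᵃ 0) (natArray s leftᵃ 0) (natArray s rightᵃ 0)

    module _ {z : ℕ} where

      Cleared : ℕ → Store → Set
      Cleared i s = (∀ {k} → k < i → natArray s visᵃ 0 k ≡ 0) × (∀ {k} → k < i → natArray s ptrᵃ 0 k ≡ 0) × BaseAt z s

      Queued : ℕ → Store → Set
      Queued i s = (∀ {k} → k < natVar s endᵛ → natArray s leftᵃ 0 (natArray s queueᵃ 0 k) ≡ 0) ×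
        (∀ {k} → k < i → natArray s leftᵃ 0 k ≡ 0 → ∃[ l ] l < natVar s endᵛ × natArray s queueᵃ 0 l ≡ k) ×
        natVar s endᵛ ≤ i × Cleared n s

      prepare-ok : ∀ {r s} → BaseAt z s → Ends prepare (forCost n 2 + (1 + (forCost n 3 + (2 + r)))) s
        (λ k s′ → r ≤ k × natVar s′ foundᵛ ≡ 0 × SearchAt s′ × BaseAt z s′)
      prepare-ok {r} {s} b =
        more (≤-reflexive (cong (forCost n 2 +_) (+-identityʳ _)))
          (sound (for iᵛ (var nᵛ) (visᵃ ⟨ var iᵛ ⟩≔ lit 0 ⨾ ptrᵃ ⟨ var iᵛ ⟩≔ lit 0))
            (forRule iᵛ (var nᵛ) _ n 2 (λ i _ → Cleared i) (λ { _ _ _ (_ , _ , b) → Base.n≡ b }) clearing {y = 0}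
              ((λ ()) , (λ ()) , b)))
        followedBy λ (_ , le , cleared) → more (≤-trans (m≤m+n _ _) le)
          (andThen (endᵛ ≔ᴺ lit 0) (0 , refl ,
            (more (≤-reflexive (cong (forCost n 3 +_) (+-identityʳ _)))
              (sound (for iᵛ (var nᵛ) fill) (forRule iᵛ (var nᵛ) fill n 3 (λ i _ → Queued i)
                (λ { _ _ _ (_ , _ , _ , _ , _ , b) → Base.n≡ b }) filling {y = 0}
                ((λ ()) , (λ ()) , z≤n , cleared)))
            followedBy λ (_ , le , free , all , end≤n , vis0 , ptr0 , b) → more (≤-trans (m≤m+n _ _) le)
              (sound (baseᵛ ≔ᴺ lit 0 ⨾ foundᵛ ≔ᴺ lit 0) (0 , refl , 0 , refl , ≤-refl , refl ,
                start free all end≤n vis0 ptr0 , b)))))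
        where
        fill : Program
        fill = cond (positive (leftᵃ ⟨ var iᵛ ⟩)) skip (queueᵃ ⟨ var endᵛ ⟩≔ var iᵛ ⨾ endᵛ ≔ᴺ (succ (var endᵛ)))

        clearing : ∀ i r y s → i < n → natVar s iᵛ ≡ i → Cleared i s →
          Ends (visᵃ ⟨ var iᵛ ⟩≔ lit 0 ⨾ ptrᵃ ⟨ var iᵛ ⟩≔ lit 0) (2 + (r + y)) s (Advanced iᵛ i r (λ _ → Cleared (suc i)))
        clearing i r y s i<n refl (vis0 , ptr0 , b) =
          sound (visᵃ ⟨ var iᵛ ⟩≔ lit 0 ⨾ ptrᵃ ⟨ var iᵛ ⟩≔ lit 0)
            (0 , natVar s iᵛ , 0 , refl , 0 , natVar s iᵛ , 0 , refl , y , ≤-refl , refl ,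
             update-upTo (λ _ x → x ≡ 0) vis0 refl , update-upTo (λ _ x → x ≡ 0) ptr0 refl , b)

        filling : ∀ i r y s → i < n → natVar s iᵛ ≡ i → Queued i s → Ends fill (3 + (r + y)) s (Advanced iᵛ i r (λ _ → Queued (suc i)))
        filling i r y s i<n refl (free , all , end≤i , vis0 , ptr0 , b) = sound fill
          ((λ taken → y , drop≤ 1 , refl , free ,
             (λ k<1+i k-free → all (≤∧≢⇒< (≤-pred k<1+i) (λ { refl → 0<-true taken k-free })) k-free) ,
             ≤-trans end≤i (n≤1+n _) , vis0 , ptr0 , b) ,
           (λ empty → 0 , end , natVar s iᵛ , refl , suc end , refl , y , ≤-refl , refl ,
             update-upTo (λ _ x → left x ≡ 0) free (0<-false empty) ,
             (λ {k} k<1+i k-free → enqueued (k ≟ natVar s iᵛ) k<1+i k-free) ,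
             s≤s end≤i , vis0 , ptr0 , b))
          where
          end = natVar s endᵛ
          left queue : ℕ → ℕ
          left = natArray s leftᵃ 0
          queue = natArray s queueᵃ 0
          enqueued : ∀ {k} → Dec (k ≡ natVar s iᵛ) → k < suc (natVar s iᵛ) → left k ≡ 0 →
                     ∃[ l ] l < suc end × update end (natVar s iᵛ) queue l ≡ k
          enqueued (yes refl) _ _ = end , ≤-refl , update-same end _ queue
          enqueued (no k≢i) k<1+i k-free with all (≤∧≢⇒< (≤-pred k<1+i) k≢i) k-free
          ... | l , l<end , e = l , ≤-trans l<end (n≤1+n end) , trans (update-other {f = queue} (<⇒≢ l<end)) e

      data Found (s : Store) : Set where
        none : natVar s foundᵛ ≡ 0 → natVar s endᵛ ≤ natVar s baseᵛ → SearchAt s → Found s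
        path : ∀ {j} → natVar s foundᵛ ≡ suc j → AugmentingAt j s → natArray s visᵃ 0 j ≤ suc (n + n) → Found s

      Searching : ℕ → Assertion
      Searching r k s = BaseAt z s ×
        ((natVar s foundᵛ ≡ 0 × SearchAt s × ∃[ m ] m + progress (natVar s baseᵛ) (natArray s ptrᵃ 0) ≡ goal × suc (m * 11 + r) ≡ k) ⊎
         (∃[ j ] natVar s foundᵛ ≡ suc j × AugmentingAt j s × natArray s visᵃ 0 j ≤ suc (n + n) × suc r ≤ k))

      searchTest : BoolExp
      searchTest = (var baseᵛ <ᴺ var endᵛ) & neg (positive (var foundᵛ))

      searchStep-ok : ∀ r k s → Searching r k s → evalᴮ searchTest s ≡ true →
                      spend (λ k → Ends searchStep k s (↓ (Searching r))) k
      searchStep-ok r k s (b , inj₂ (j , found≡ , _)) test rewrite found≡ with natVar s baseᵛ <ᵇ natVar s endᵛ | test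
      ... | true  | ()
      ... | false | ()
      searchStep-ok r k s (b@(base n≡ deg≡ adj≡ m size≡) , inj₁ (found≡ , S , left , total , refl)) test
        with natVar s baseᵛ <ᵇ natVar s endᵛ in lt | left | total
      ... | true | zero   | total = ⊥-elim (<-irrefl total (progress<goal m S (<-true lt)))
      ... | true | suc d  | total = sound searchStep
        ( i , refl
        , (λ ptr<deg′ → let ptr<deg = subst (λ f → ptr i < f i) deg≡ (<-true ptr<deg′) in
            j , refl , 0 , i , suc (ptr i) , refl ,
            (λ seen → _ , drop≤ 4 , b ,
              inj₁ (found≡ , advance m S ptr<deg next (0<-true seen) , d , advanced ptr<deg , refl)) ,
            (λ unseen → 0 , j , suc (natVar s endᵛ) , refl , 0 , j , i , refl ,
              (λ taken → 0 , natVar s endᵛ , right j ∸ 1 , refl , suc (natVar s endᵛ) , refl ,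
                _ , drop≤ 0 , b ,
                inj₁ (found≡ , push m S ptr<deg next (<-true lt) refl (0<-false unseen) (0<-true taken) , d ,
                      advanced ptr<deg , refl)) ,
              (λ free → suc j , refl , suc r , s≤s (≤-trans (m≤n+m r (d * 11)) (drop≤ 1)) , b ,
                inj₂ (j , refl , proj₁ (found (0<-false free) ptr<deg (0<-false unseen)) ,
                      proj₂ (found (0<-false free) ptr<deg (0<-false unseen)) , ≤-refl))))
        , (λ ge → suc (natVar s baseᵛ) , refl , _ , drop≤ 7 , b ,
            inj₁ (found≡ , pop m S (<-true lt) (subst (λ f → f i ≤ ptr i) deg≡ (<-false ge)) , d ,
                  trans (+-suc d _) total , refl))
        )
        where
        i = natArray s queueᵃ 0 (natVar s baseᵛ)
        ptr right : ℕ → ℕ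
        ptr = natArray s ptrᵃ 0
        right = natArray s rightᵃ 0
        j = natArray s adjᵃ i (ptr i)
        next : adj i (ptr i) ≡ j
        next = cong (λ f → f i (ptr i)) (sym adj≡)
        advanced : ptr i < deg i → d + progress (natVar s baseᵛ) (update i (suc (ptr i)) ptr) ≡ goal
        advanced ptr<deg = trans (cong (d +_) (progress-advance m S ptr<deg next)) (trans (+-suc d _) total)
        found = λ free ptr<deg unseen → find m S ptr<deg next (<-true lt) refl unseen free

      search-ok : ∀ {r s} → natVar s foundᵛ ≡ 0 → SearchAt s → BaseAt z s →
                  let progressAt = progress (natVar s baseᵛ) (natArray s ptrᵃ 0) in
                  Ends search (suc ((goal ∸ progressAt) * 11 + r)) s (λ k s′ → r ≤ k × Found s′ × BaseAt z s′)
      search-ok {r} {s} found≡ S b = loop searchTest searchStep (Searching r) (searchStep-ok r) stop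
        (b , inj₁ (found≡ , S , goal ∸ progressAt , m∸n+n≡m below , refl))
        where
        progressAt = progress (natVar s baseᵛ) (natArray s ptrᵃ 0)
        below : progressAt ≤ goal
        below = progress≤goal (Base.matched b) S
        stop : ∀ k s → Searching r k s → evalᴮ searchTest s ≡ false →
               spend (λ k → r ≤ k × Found s × BaseAt z s) k
        stop _ s (b , inj₁ (found≡ , S , m , _ , refl)) test =
          m≤n+m r (m * 11) , none found≡ (exhausted test) S , b
          where
          exhausted : evalᴮ searchTest s ≡ false → natVar s endᵛ ≤ natVar s baseᵛ
          exhausted test rewrite found≡ with natVar s baseᵛ <ᵇ natVar s endᵛ in e
          ... | false = <-false e
        stop (suc k) s (b , inj₂ (j , found≡ , P , vis≤ , s≤s r≤k)) test = r≤k , path found≡ P vis≤ , b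

      Flipping : ℕ → Assertion
      Flipping r k s = natVar s againᵛ ≢ 0 ×
        ((natVar s foundᵛ ≡ 0 × BaseAt (suc z) s × suc r ≤ k) ⊎
         (natVar s foundᵛ ≢ 0 × BaseAt z s × AugmentingAt (natVar s foundᵛ ∸ 1) s ×
          ∃[ v ] natArray s visᵃ 0 (natVar s foundᵛ ∸ 1) ≤ v × suc (v * 8 + r) ≡ k))

      flipStep-ok : ∀ r k s → Flipping r k s → (0 <ᵇ natVar s foundᵛ) ≡ true →
                    spend (λ k → Ends flipStep k s (↓ (Flipping r))) k
      flipStep-ok r k s (_ , inj₁ (found≡ , _)) test = ⊥-elim (0<-true test found≡)
      flipStep-ok r k s (_ , inj₂ (_ , _ , P , zero , v , _)) test = ⊥-elim (Augmenting.visited P (n≤0⇒n≡0 v))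
      flipStep-ok r k s (again , inj₂ (_ , base n≡ deg≡ adj≡ _ size≡ , P , suc v , vis≤ , refl)) test = sound flipStep
        ( j , refl , i , refl , left i , refl , 0 , i , suc j , refl , 0 , j , suc i , refl
        , (λ taken → let P′ , size′ , less = flip-next P (0<-true taken) in
            0 , left i ∸ 1 , 0 , refl , suc (v * 8 + r) , drop≤ 0 , again ,
            inj₂ (0<-true taken , base n≡ deg≡ adj≡ (Augmenting.matched P′) (trans size′ size≡) , P′ ,
                  v , ≤-pred (≤-trans less vis≤) , refl))
        , (λ free → let M′ , size′ = flip-last P (0<-false free) in
            suc r , ≤-trans (s≤s (m≤n+m r (v * 8))) (drop≤ 0) , again ,
            inj₁ (0<-false free , base n≡ deg≡ adj≡ M′ (trans size′ (cong suc size≡)) , ≤-refl))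
        )
        where
        j = natVar s foundᵛ ∸ 1
        i = natArray s parᵃ 0 j
        left : ℕ → ℕ
        left = natArray s leftᵃ 0

      flip-ok : ∀ {r j s} → natVar s againᵛ ≢ 0 → natVar s foundᵛ ≡ suc j → BaseAt z s → AugmentingAt j s →
                natArray s visᵃ 0 j ≤ suc (n + n) →
                Ends (while (positive (var foundᵛ)) flipStep) (1 + (suc (n + n) * 8 + r)) s
                  (λ k s′ → r ≤ k × natVar s′ againᵛ ≢ 0 × BaseAt (suc z) s′)
      flip-ok {r} {j} {s} again found≡ b P vis≤ = loop (positive (var foundᵛ)) flipStep (Flipping r) (flipStep-ok r) stop
        (again , inj₂ ((λ e → 0≢1+n (trans (sym e) found≡)) , b ,
          subst (λ x → AugmentingAt x s) (sym (cong (_∸ 1) found≡)) P ,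
          suc (n + n) , subst (λ x → natArray s visᵃ 0 x ≤ suc (n + n)) (sym (cong (_∸ 1) found≡)) vis≤ , refl))
        where
        stop : ∀ k s → Flipping r k s → (0 <ᵇ natVar s foundᵛ) ≡ false →
               spend (λ k → r ≤ k × natVar s againᵛ ≢ 0 × BaseAt (suc z) s) k
        stop (suc k) s (again , inj₁ (_ , b , s≤s r≤k)) test = r≤k , again , b
        stop k s (_ , inj₂ (found≢0 , _)) test = ⊥-elim (found≢0 (0<-false test))

    roundCost : ℕ → ℕ
    roundCost r = forCost n 2 + (1 + (forCost n 3 + (2 + (1 + (goal * 11 + (1 + (1 + (suc (n + n) * 8 + r))))))))

    roundCost-+ : ∀ r → roundCost r ≡ roundCost 0 + r
    roundCost-+ r = identity (forCost n 2) (forCost n 3) (goal * 11) (suc (n + n) * 8) r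
      where
      identity : ∀ a b c d r → a + (1 + (b + (2 + (1 + (c + (1 + (1 + (d + r)))))))) ≡
                               a + (1 + (b + (2 + (1 + (c + (1 + (1 + (d + 0)))))))) + r
      identity = solve-∀

    augmentCost : ℕ
    augmentCost = suc (roundCost 0)

    Certificate : ℕ → Set
    Certificate z = ∃[ u ] ∃[ p ] (ℕ-Sums.sumTo n u + ℕ-Sums.sumTo n p ≤ z) ×
                    (∀ {i j} → Adjacent deg adj i j → 1 ≤ u i + p j)

    Round : Assertion
    Round k s = ∃[ z ] ∃[ d ] d + z ≡ n × BaseAt z s ×
      ((natVar s againᵛ ≢ 0 × suc (suc d * augmentCost) ≡ k) ⊎
       (natVar s againᵛ ≡ 0 × suc (d * augmentCost) ≤ k × Certificate z))

    round : Program
    round = prepare ⨾ search ⨾ againᵛ ≔ᴺ var foundᵛ ⨾ while (positive (var foundᵛ)) flipStep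

    round-ok : ∀ k s → Round k s → (0 <ᵇ natVar s againᵛ) ≡ true → spend (λ k → Ends round k s (↓ Round)) k
    round-ok k s (_ , _ , _ , _ , inj₂ (again≡ , _)) test = ⊥-elim (0<-true test again≡)
    round-ok k s (z , d , total , b , inj₁ (_ , refl)) test = more enough
      (prepare-ok b followedBy λ { {k} {s} (le , found≡ , S , b) → more (≤-trans (faster s) le)
        (search-ok found≡ S b followedBy λ { {k} {s} (le , found , b) → more le (finish s found b) }) })
      where
      rest : ℕ
      rest = suc (d * augmentCost)
      enough : roundCost rest ≤ suc d * augmentCost
      enough = ≤-reflexive (trans (roundCost-+ rest) (+-suc (roundCost 0) _))
      faster : ∀ s → suc ((goal ∸ progress (natVar s baseᵛ) (natArray s ptrᵃ 0)) * 11 + (2 + (suc (n + n) * 8 + rest))) ≤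
                     suc (goal * 11 + (2 + (suc (n + n) * 8 + rest)))
      faster s = s≤s (+-monoˡ-≤ _ (*-monoˡ-≤ 11 (m∸n≤m goal (progress (natVar s baseᵛ) (natArray s ptrᵃ 0)))))
      finish : ∀ s → Found s → BaseAt z s →
               Ends (againᵛ ≔ᴺ var foundᵛ ⨾ while (positive (var foundᵛ)) flipStep)
                    (2 + (suc (n + n) * 8 + rest)) s (↓ Round)
      finish s (none found≡ end≤base S) b = andThen (againᵛ ≔ᴺ var foundᵛ) (natVar s foundᵛ , refl ,
        ends (while-false (cong (0 <ᵇ_) found≡)) ≤-refl (_ , ≤-refl , z , d , total , b ,
          inj₂ (found≡ , m≤n+m rest (suc (n + n) * 8) , u , p , ≤-trans sum≤ (≤-reflexive (Base.size≡ b)) , covers)))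
        where
        certificate = cover (Base.matched b) S end≤base
        u = proj₁ certificate
        p = proj₁ (proj₂ certificate)
        sum≤ = proj₁ (proj₂ (proj₂ certificate))
        covers = proj₂ (proj₂ (proj₂ certificate))
      finish s (path {j} found≡ P vis≤) b = andThen (againᵛ ≔ᴺ var foundᵛ) (natVar s foundᵛ , refl ,
        weaken (λ {k} {s} → succeed {k} {s}) (flip-ok (λ e → 0≢1+n (trans (sym e) found≡)) found≡ b P vis≤))
        where
        succeed : ∀ {k s} → rest ≤ k × natVar s againᵛ ≢ 0 × BaseAt (suc z) s → ↓ Round k s
        succeed {k} {s} (rest≤k , again , b) = next d refl
          where
          next : ∀ d′ → d′ ≡ d → ↓ Round k s
          next zero    refl = ⊥-elim (<⇒≱ (≤-refl {suc n}) (≤-trans (≤-reflexive (trans (cong suc (sym total)) (sym (Base.size≡ b)))) (count≤ n _)))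
          next (suc d′) refl = rest , rest≤k , suc z , d′ , trans (+-suc d′ z) total , b , inj₁ (again , refl)

    augment-ok : ∀ {s z d} → d + z ≡ n → BaseAt z s →
      Ends augment (2 + suc d * augmentCost) s (λ k s′ → ∃[ z′ ] ∃[ d′ ] d′ + z′ ≡ n ×
        d′ * augmentCost ≤ k × BaseAt z′ s′ × Certificate z′)
    augment-ok {s} {z} {d} total b = sound augment (1 , refl ,
      loop (positive (var againᵛ)) round Round round-ok stop (z , d , total , b , inj₁ ((λ ()) , refl)))
      where
      stop : ∀ k s → Round k s → (0 <ᵇ natVar s againᵛ) ≡ false →
             spend (λ k → ∃[ z′ ] ∃[ d′ ] d′ + z′ ≡ n × d′ * augmentCost ≤ k × BaseAt z′ s × Certificate z′) k
      stop k s (_ , _ , _ , _ , inj₁ (again , _)) test = ⊥-elim (again (0<-false test))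
      stop (suc k) s (z , d , total , b , inj₂ (_ , s≤s le , certificate)) test = z , d , total , le , b , certificate

  module Append (𝓡 : Reals) (deg : ℕ → ℕ) (adj : ℕ → ℕ → ℕ) (i j : ℕ) where
    open RealRAM 𝓡
    open Update 𝓡
    open ℕ-Sums using (sumTo; sumTo-suc)

    deg⁺ : ℕ → ℕ
    deg⁺ = update i (suc (deg i)) deg

    adj⁺ : ℕ → ℕ → ℕ
    adj⁺ = update₂ i (deg i) j adj

    append-old : ∀ {i′ j′} → Adjacent deg adj i′ j′ → Adjacent deg⁺ adj⁺ i′ j′
    append-old {i′} (k , k<deg , e) = k ,
      update-elim (k <_) {i} {i′} {f = deg} (λ { refl → ≤-trans k<deg (n≤1+n _) }) (λ _ → k<deg) ,
      trans (update₂-other {k = i} {deg i} {i′} {k} {f = adj} (λ { (refl , k≡) → <⇒≢ k<deg k≡ })) e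

    append-new : Adjacent deg⁺ adj⁺ i j
    append-new = deg i , ≤-reflexive (sym (update-same i _ deg)) , update₂-same i (deg i) j adj

    append-only : ∀ {i′ j′} → Adjacent deg⁺ adj⁺ i′ j′ → (i′ ≡ i × j′ ≡ j) ⊎ Adjacent deg adj i′ j′
    append-only {i′} {j′} (k , k<deg , e) = update-elim (λ x → k < x → (i′ ≡ i × j′ ≡ j) ⊎ Adjacent deg adj i′ j′) {i} {i′} {f = deg} at-i off-i k<deg
      where
      Goal = (i′ ≡ i × j′ ≡ j) ⊎ Adjacent deg adj i′ j′
      old : ¬ (i′ ≡ i × k ≡ deg i) → k < deg i′ → Goal
      old ne k<deg = inj₂ (k , k<deg , trans (sym (update₂-other {k = i} {deg i} {i′} {k} {f = adj} ne)) e)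
      last : i′ ≡ i → k < deg i ⊎ k ≡ deg i → Goal
      last refl (inj₁ k<deg) = old (λ (_ , k≡) → <⇒≢ k<deg k≡) k<deg
      last refl (inj₂ refl)  = inj₁ (refl , trans (sym e) (update₂-same i (deg i) j adj))
      at-i : i′ ≡ i → k < suc (deg i) → Goal
      at-i i′≡i k<1+deg = last i′≡i (m≤n⇒m<n∨m≡n (≤-pred k<1+deg))
      off-i : i′ ≢ i → k < deg i′ → Goal
      off-i i′≢i = old (λ (i′≡i , _) → i′≢i i′≡i)

    append-size : ∀ {n} → i < n → sumTo n deg⁺ ≡ suc (sumTo n deg)
    append-size i<n = sumTo-suc i<n (λ k ne → update-other {k = i} {k} {f = deg} ne) (update-same i _ deg)

  module SmallRun (𝓡 : Reals) {size : ℕ} (O : OptimalTransport.Oracle 𝓡 size) (τ : ℕ) (n : ℕ) where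
    open RealRAM 𝓡
    open Update 𝓡
    open Logic 𝓡 O τ
    open Matchings
    open Tests

    NearRoot : ℕ → Set
    NearRoot h = h ≡ 0 ⊎ ∃[ l ] h ≡ suc l × l * l < n

    Rooting : Assertion
    Rooting k s = ∃[ d ] natVar s nᵛ ≡ n × natVar s hᵛ + d ≡ n × natVar s baseᵛ ≡ natVar s hᵛ * natVar s hᵛ ×
      NearRoot (natVar s hᵛ) × suc (d * 3) ≡ k

    h≤h*h : ∀ h → h ≤ h * h
    h≤h*h zero    = z≤n
    h≤h*h (suc h) = m≤m*n (suc h) (suc h)

    rootStep : Program
    rootStep = baseᵛ ≔ᴺ (succ (var hᵛ ⊕ (var hᵛ ⊕ var baseᵛ))) ⨾ hᵛ ≔ᴺ (succ (var hᵛ))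

    rootStep-ok : ∀ k s → Rooting k s → (natVar s baseᵛ <ᵇ natVar s nᵛ) ≡ true →
                  spend (λ k → Ends rootStep k s (↓ Rooting)) k
    rootStep-ok k s (d , n≡ , sum , base≡ , near , refl) test = go d sum
      where
      h = natVar s hᵛ
      h*h<n : h * h < n
      h*h<n = subst₂ _<_ base≡ n≡ (<-true test)
      square : ∀ h → suc (h + (h + h * h)) ≡ suc h * suc h
      square = solve-∀
      go : ∀ d → h + d ≡ n → spend (λ k → Ends rootStep k s (↓ Rooting)) (suc (d * 3))
      go zero    sum = ⊥-elim (<⇒≱ (≤-<-trans (h≤h*h h) h*h<n) (≤-reflexive (trans (sym sum) (+-identityʳ h))))
      go (suc d) sum = sound rootStep (suc (h + (h + natVar s baseᵛ)) , refl , suc h , refl , _ , drop≤ 0 ,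
        d , n≡ , trans (sym (+-suc h d)) sum ,
        trans (cong (λ x → suc (h + (h + x))) base≡) (square h) , inj₂ (h , refl , h*h<n) , refl)

    rootCost : ℕ
    rootCost = 3 + n * 3

    root-ok : ∀ {s} → 0 < n → natVar s nᵛ ≡ n → Ends root rootCost s
      (λ _ s′ → let h = natVar s′ hᵛ in 0 < h × n ≤ h * h × h * h ≤ 4 * n)
    root-ok {s} 0<n n≡ = sound root (0 , refl , 0 , refl ,
      loop (var baseᵛ <ᴺ var nᵛ) rootStep Rooting rootStep-ok stop (n , n≡ , refl , refl , inj₁ refl , refl))
      where
      bound : ∀ l → l * l < n → suc l * suc l ≤ 4 * n
      bound zero    l²<n = ≤-trans 0<n (m≤n*m n 4)
      bound (suc l) l²<n = ≤-trans (≤-trans (m≤m+n _ _) (≤-reflexive (square l))) (*-monoʳ-≤ 4 (<⇒≤ l²<n))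
        where
        square : ∀ l → suc (suc l) * suc (suc l) + (3 * l * l + 4 * l) ≡ 4 * (suc l * suc l)
        square = solve-∀
      stop : ∀ k s → Rooting k s → (natVar s baseᵛ <ᵇ natVar s nᵛ) ≡ false →
             spend (λ k → let h = natVar s hᵛ in 0 < h × n ≤ h * h × h * h ≤ 4 * n) k
      stop k s (d , n≡ , sum , base≡ , near , refl) test = go near
        where
        h = natVar s hᵛ
        n≤h*h : n ≤ h * h
        n≤h*h = subst₂ _≤_ n≡ base≡ (<-false test)
        go : NearRoot h → 0 < h × n ≤ h * h × h * h ≤ 4 * n
        go (inj₁ h≡0) = ⊥-elim (<⇒≱ 0<n (subst (λ x → n ≤ x * x) h≡0 n≤h*h))
        go (inj₂ (l , h≡ , l²<n)) = subst (0 <_) (sym h≡) (s≤s z≤n) , n≤h*h ,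
          subst (λ x → x * x ≤ 4 * n) (sym h≡) (bound l l²<n)

    Reported : (left : ℕ → ℕ) → ℕ → ℕ → (ℕ → ℕ → ℕ) → Set
    Reported left n′ i out = n′ ≡ n × (∀ {r} → r < i → ∀ c → out r c ≡ ind left r c) ×
                             (∀ {r} → i ≤ r → ∀ c → out r c ≡ 0)

    reportCost : ℕ
    reportCost = forCost n 2

    report-ok : ∀ {s} → natVar s nᵛ ≡ n → (∀ i j → natArray s outᵃ i j ≡ 0) →
      Ends report reportCost s
        (λ _ s′ → ∀ {i} → i < n → ∀ j → natArray s′ outᵃ i j ≡ ind (natArray s leftᵃ 0) i j)
    report-ok {s₀} n≡ blank = more (≤-reflexive (cong (λ x → suc (suc x)) (+-identityʳ _)))
      (weaken (λ { (_ , _ , (_ , below , _) , _) → below }) (sound report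
        (forRule iᵛ (var nᵛ) write n 2
          (λ i _ s → Reported left (natVar s nᵛ) i (natArray s outᵃ) × natArray s leftᵃ 0 ≡ left)
          (λ { _ _ _ ((n≡ , _) , _) → n≡ }) body {0} {0}
          ((n≡ , (λ ()) , (λ _ c → blank _ c)) , refl))))
      where
      left = natArray s₀ leftᵃ 0
      write : Program
      write = cond (positive (leftᵃ ⟨ var iᵛ ⟩)) (outᵃ [ var iᵛ , pred (leftᵃ ⟨ var iᵛ ⟩) ]≔ᴺ lit 1) skip
      row : ∀ i → left i ≡ 0 → ∀ c → 0 ≡ ind left i c
      row i e c = ind-elim (0 ≡_) left i c (λ e′ → ⊥-elim (0≢1+n (trans (sym e) e′))) (λ _ → refl)
      body : ∀ i r y s → i < n → natVar s iᵛ ≡ i →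
        Reported left (natVar s nᵛ) i (natArray s outᵃ) × natArray s leftᵃ 0 ≡ left →
        Ends write (2 + (r + y)) s (λ k s′ → ∃[ y′ ] r + y′ ≤ k × natVar s′ iᵛ ≡ i ×
          Reported left (natVar s′ nᵛ) (suc i) (natArray s′ outᵃ) × natArray s′ leftᵃ 0 ≡ left)
      body i r y s i<n refl ((n≡ , below , above) , left≡) = sound write
        ((λ matched → i₀ , l , 1 , refl , y , ≤-refl , refl ,
           (n≡ ,
            (λ {r} r≤i c → update₂-elim (_≡ ind left r c) {i₀} {l} {r} {c} {f = out}
              (λ { refl refl → ind-elim (1 ≡_) left r c (λ _ → refl) (λ ne → ⊥-elim (ne (partner matched))) })
              (λ ne → old matched r≤i c ne)) ,
            (λ {r} i<r c → trans (update₂-other {k = i₀} {l} {r} {c} {f = out} (λ { (refl , _) → <-irrefl refl i<r }))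
                                 (above (<⇒≤ i<r) c))) , left≡) ,
         (λ free → y , ≤-refl , refl ,
           (n≡ ,
            (λ {r} r≤i c → unmatched free r≤i c (m≤n⇒m<n∨m≡n (≤-pred r≤i))) ,
            (λ i<r c → above (<⇒≤ i<r) c)) , left≡))
        where
        i₀ = natVar s iᵛ
        l = natArray s leftᵃ 0 i₀ ∸ 1
        out = natArray s outᵃ
        partner : (0 <ᵇ natArray s leftᵃ 0 i₀) ≡ true → left i₀ ≡ suc l
        partner matched = trans (sym (cong (λ f → f i₀) left≡)) (sym (suc-∸1 (0<-true matched)))
        old : (0 <ᵇ natArray s leftᵃ 0 i₀) ≡ true → ∀ {r} → r < suc i₀ → ∀ c → ¬ (r ≡ i₀ × c ≡ l) → out r c ≡ ind left r c
        old matched r≤i c ne with m≤n⇒m<n∨m≡n (≤-pred r≤i)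
        ... | inj₁ r<i  = below r<i c
        ... | inj₂ refl = trans (above ≤-refl c) (ind-elim (0 ≡_) left i₀ c
          (λ e → ⊥-elim (ne (refl , suc-injective (trans (sym e) (partner matched))))) (λ _ → refl))
        unmatched : (0 <ᵇ natArray s leftᵃ 0 i₀) ≡ false → ∀ {r} → r < suc i₀ → ∀ c → r < i₀ ⊎ r ≡ i₀ →
                    out r c ≡ ind left r c
        unmatched free r≤i c (inj₁ r<i)  = below r<i c
        unmatched free r≤i c (inj₂ refl) = trans (above ≤-refl c)
          (row i₀ (trans (sym (cong (λ f → f i₀) left≡)) (0<-false free)) c)

  module DenseRun (𝓡 : Reals) {size : ℕ} (O : OptimalTransport.Oracle 𝓡 size) (τ : ℕ) (n : ℕ)
    (edge : ℕ → ℕ → ℕ) (bounded : ∀ {i j} → edge i j ≢ 0 → i < n × j < n) where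
    open RealRAM 𝓡
    open Update 𝓡
    open Logic 𝓡 O τ
    open Tests
    open ℕ-Sums using (sumTo; sumTo-mono; sumTo-const)

    record Lists (r c : ℕ) (n′ : ℕ) (edge′ : ℕ → ℕ → ℕ) (deg : ℕ → ℕ) (adj : ℕ → ℕ → ℕ) : Set where
      constructor lists
      field
        n≡       : n′ ≡ n
        edge≡    : edge′ ≡ edge
        correct  : ∀ {i j} → i < r → Adjacent deg adj i j → edge i j ≢ 0
        complete : ∀ {i j} → i < r → edge i j ≢ 0 → Adjacent deg adj i j
        short    : ∀ {i} → i < r → deg i ≤ n
        outside  : ∀ {i} → n ≤ i → deg i ≡ 0
        -- c is one more than the number of columns of row r scanned so far, and
        -- zero before row r is started.
        correct-row  : ∀ {j} → c ≢ 0 → Adjacent deg adj r j → edge r j ≢ 0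
        complete-row : ∀ {j} → suc j < c → edge r j ≢ 0 → Adjacent deg adj r j
        short-row    : c ≢ 0 → suc (deg r) ≤ c

    ListsAt : ℕ → ℕ → Store → Set
    ListsAt r c s = Lists r c (natVar s nᵛ) (natArray s edgeᵃ) (natArray s degᵃ 0) (natArray s adjᵃ)

    scan : Program
    scan = cond (positive (edgeᵃ [ var iᵛ , var jᵛ ])) (rowᵛ ≔ᴺ (var iᵛ) ⨾ colᵛ ≔ᴺ (var jᵛ) ⨾ append) skip

    denseCost : ℕ
    denseCost = forCost n (1 + forCost n 5)

    dense-ok : ∀ {s} → natVar s nᵛ ≡ n → natArray s edgeᵃ ≡ edge → (∀ {i} → n ≤ i → natArray s degᵃ 0 i ≡ 0) →
      Ends dense denseCost s
        (λ _ s′ → let deg = natArray s′ degᵃ 0 ; adj = natArray s′ adjᵃ in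
          (∀ {i j} → Adjacent deg adj i j → edge i j ≢ 0) ×
          (∀ {i j} → edge i j ≢ 0 → Adjacent deg adj i j) × sumTo n deg ≤ n * n)
    dense-ok {s} n≡ edge≡ outside = more (≤-reflexive (cong (λ x → suc (suc x)) (+-identityʳ _)))
      (weaken (λ { {s = s} (_ , _ , L) → finish {s} L }) (sound dense
        (forRule iᵛ (var nᵛ) line n (1 + forCost n 5) (λ i _ → ListsAt i 0) (λ _ _ _ L → Lists.n≡ L) lines {0} {0}
          (lists n≡ edge≡ (λ ()) (λ ()) (λ ()) outside (λ ne → ⊥-elim (ne refl)) (λ ()) (λ ne → ⊥-elim (ne refl))))))
      where
      line : Program
      line = degᵃ ⟨ var iᵛ ⟩≔ lit 0 ⨾ for jᵛ (var nᵛ) scan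
      finish : ∀ {s} → ListsAt n 0 s → let deg = natArray s degᵃ 0 ; adj = natArray s adjᵃ in
          (∀ {i j} → Adjacent deg adj i j → edge i j ≢ 0) ×
          (∀ {i j} → edge i j ≢ 0 → Adjacent deg adj i j) × sumTo n deg ≤ n * n
      finish {s} L =
        (λ { {i} (k , k<deg , e) → correct (≰⇒> (λ n≤i → n≮0 (subst (k <_) (Lists.outside L n≤i) k<deg))) (k , k<deg , e) }) ,
        (λ e → complete (proj₁ (bounded e)) e) ,
        ≤-trans (sumTo-mono n (λ i i<n → short i<n)) (≤-reflexive (sumTo-const n n))
        where open Lists L
      scanning : ∀ i → i < n → ∀ j r y s → j < n → natVar s jᵛ ≡ j → natVar s iᵛ ≡ i × ListsAt i (suc j) s →
        Ends scan (5 + (r + y)) s (Advanced jᵛ j r (λ _ s′ → natVar s′ iᵛ ≡ i × ListsAt i (suc (suc j)) s′))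
      scanning i i<n j r y s j<n refl (refl , L@(lists n≡ edge≡ correct complete short outside correct-row complete-row short-row)) =
        sound scan
          ((λ present → let present′ = subst (λ f → f i j ≢ 0) edge≡ (0<-true present) in
              i , refl , j , refl , i , deg i , j , refl , 0 , i , suc (deg i) , refl , y , ≤-refl , refl , refl ,
              record
                { n≡ = n≡ ; edge≡ = edge≡
                ; correct = λ i′<i a → old (append-only a) (λ e → <⇒≢ i′<i e) (correct i′<i)
                ; complete = λ i′<i e → append-old (complete i′<i e)
                ; short = λ {i′} i′<i → subst (_≤ n) (sym (update-other {k = i} {i′} {f = deg} (<⇒≢ i′<i))) (short i′<i)
                ; outside = λ {i′} n≤i′ → trans (update-other {k = i} {i′} {f = deg} (λ { refl → <⇒≱ i<n n≤i′ })) (outside n≤i′)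
                ; correct-row = λ _ a → here present′ (append-only a)
                ; complete-row = λ j′< e → complete′ j′< e
                ; short-row = λ _ → subst (λ x → suc x ≤ suc (suc j)) (sym (update-same i _ deg)) (s≤s (short-row (λ ())))
                }) ,
           (λ absent → y , drop≤ 3 , refl , refl ,
              record { Lists L ; correct-row = λ _ → correct-row (λ ())
                     ; complete-row = λ {j′} j′< e → complete″ absent j′< e
                     ; short-row = λ _ → ≤-trans (short-row (λ ())) (n≤1+n _) }))
        where
        deg = natArray s degᵃ 0
        adj = natArray s adjᵃ
        open Append 𝓡 deg adj i j
        old : ∀ {i′ j′} → (i′ ≡ i × j′ ≡ j) ⊎ Adjacent deg adj i′ j′ → i′ ≢ i →
              (Adjacent deg adj i′ j′ → edge i′ j′ ≢ 0) → edge i′ j′ ≢ 0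
        old (inj₁ (e , _)) ne _ = ⊥-elim (ne e)
        old (inj₂ a) _ f = f a
        here : ∀ {j′} → edge i j ≢ 0 → (i ≡ i × j′ ≡ j) ⊎ Adjacent deg adj i j′ → edge i j′ ≢ 0
        here present (inj₁ (_ , refl)) = present
        here present (inj₂ a) = correct-row (λ ()) a
        complete′ : ∀ {j′} → suc j′ < suc (suc j) → edge i j′ ≢ 0 → Adjacent deg⁺ adj⁺ i j′
        complete′ j′< e with m≤n⇒m<n∨m≡n (≤-pred (≤-pred j′<))
        ... | inj₁ j′<j = append-old (complete-row (s≤s j′<j) e)
        ... | inj₂ refl = append-new
        complete″ : (0 <ᵇ natArray s edgeᵃ i j) ≡ false → ∀ {j′} → suc j′ < suc (suc j) → edge i j′ ≢ 0 → Adjacent deg adj i j′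
        complete″ absent j′< e with m≤n⇒m<n∨m≡n (≤-pred (≤-pred j′<))
        ... | inj₁ j′<j = complete-row (s≤s j′<j) e
        ... | inj₂ refl = ⊥-elim (e (trans (sym (cong (λ f → f i j) edge≡)) (0<-false absent)))
      lines : ∀ i r y s → i < n → natVar s iᵛ ≡ i → ListsAt i 0 s →
        Ends line (1 + forCost n 5 + (r + y)) s (Advanced iᵛ i r (λ _ → ListsAt (suc i) 0))
      lines i r y s i<n refl (lists n≡ edge≡ correct complete short outside _ _ _) =
        andThen (degᵃ ⟨ var iᵛ ⟩≔ lit 0) (0 , i , 0 , refl ,
          weaken (λ { (y′ , le , i≡ , L) → y′ , le , i≡ , close L })
            (sound (for jᵛ (var nᵛ) scan) (forRule jᵛ (var nᵛ) scan n 5 (λ j _ s → natVar s iᵛ ≡ i × ListsAt i (suc j) s)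
              (λ { _ _ _ (_ , L) → Lists.n≡ L }) (scanning i i<n)
              (refl , record
                { n≡ = n≡ ; edge≡ = edge≡
                ; correct = λ i′<i a → correct i′<i (recount {update i 0 deg} {deg} (kept i′<i) a)
                ; complete = λ i′<i e → recount {deg} {update i 0 deg} (sym (kept i′<i)) (complete i′<i e)
                ; short = λ i′<i → subst (_≤ n) (sym (kept i′<i)) (short i′<i)
                ; outside = λ {i′} n≤i′ → trans (update-other {k = i} {i′} {f = deg} (λ { refl → <⇒≱ i<n n≤i′ })) (outside n≤i′)
                ; correct-row = λ { _ (k , k<0 , _) → ⊥-elim (n≮0 (subst (k <_) (update-same i 0 deg) k<0)) }
                ; complete-row = λ { (s≤s ()) }
                ; short-row = λ _ → ≤-reflexive (cong suc (update-same i 0 deg))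
                }))))
        where
        deg = natArray s degᵃ 0
        recount : ∀ {d d′ : ℕ → ℕ} {i j : ℕ} → d i ≡ d′ i → Adjacent d (natArray s adjᵃ) i j → Adjacent d′ (natArray s adjᵃ) i j
        recount e (k , k<d , e′) = k , subst (k <_) e k<d , e′
        kept : ∀ {i′} → i′ < i → update i 0 deg i′ ≡ deg i′
        kept {i′} i′<i = update-other {k = i} {i′} {f = deg} (<⇒≢ i′<i)
        close : ∀ {n′ edge′ deg adj} → Lists i (suc n) n′ edge′ deg adj → Lists (suc i) 0 n′ edge′ deg adj
        close {deg = deg} {adj} L = record
          { n≡ = Lists.n≡ L ; edge≡ = Lists.edge≡ L
          ; correct = λ i′≤i → correct′ (m≤n⇒m<n∨m≡n (≤-pred i′≤i))
          ; complete = λ i′≤i → complete′ (m≤n⇒m<n∨m≡n (≤-pred i′≤i))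
          ; short = λ i′≤i → short′ (m≤n⇒m<n∨m≡n (≤-pred i′≤i))
          ; outside = Lists.outside L
          ; correct-row = λ ne → ⊥-elim (ne refl) ; complete-row = λ () ; short-row = λ ne → ⊥-elim (ne refl)
          }
          where
          correct′ : ∀ {i′ j} → i′ < i ⊎ i′ ≡ i → Adjacent deg adj i′ j → edge i′ j ≢ 0
          correct′ (inj₁ i′<i) = Lists.correct L i′<i
          correct′ (inj₂ refl) = Lists.correct-row L (λ ())
          complete′ : ∀ {i′ j} → i′ < i ⊎ i′ ≡ i → edge i′ j ≢ 0 → Adjacent deg adj i′ j
          complete′ (inj₁ i′<i) = Lists.complete L i′<i
          complete′ (inj₂ refl) e = Lists.complete-row L (s≤s (proj₂ (bounded e))) e
          short′ : ∀ {i′} → i′ < i ⊎ i′ ≡ i → deg i′ ≤ n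
          short′ (inj₁ i′<i) = Lists.short L i′<i
          short′ (inj₂ refl) = ≤-pred (Lists.short-row L (λ ()))

  module Multiples (Q : ℕ) (1≤Q : 1 ≤ Q) where

    infix 4 _≲_

    record _≲_ (a c : ℕ) : Set where
      constructor mk
      field bound : a ≤ c * Q

    open _≲_ public

    zero≲ : 0 ≲ 0
    zero≲ = mk z≤n

    unit : ∀ {a} → a ≤ Q → a ≲ 1
    unit le = mk (≤-trans le (≤-reflexive (sym (*-identityˡ Q))))

    suc≲ : ∀ {a c} → a ≲ c → suc a ≲ suc c
    suc≲ (mk le) = mk (+-mono-≤ 1≤Q le)

    +≲ : ∀ {a b c d} → a ≲ c → b ≲ d → a + b ≲ c + d
    +≲ {c = c} {d} (mk le) (mk le′) = mk (≤-trans (+-mono-≤ le le′) (≤-reflexive (sym (*-distribʳ-+ Q c d))))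

    *≲ : ∀ k {a c} → a ≲ c → a * k ≲ c * k
    *≲ k {a} {c} (mk le) = mk (≤-trans (*-monoˡ-≤ k le) (≤-reflexive (swap c Q k)))
      where
      swap : ∀ c Q k → c * Q * k ≡ c * k * Q
      swap = solve-∀

    product≲ : ∀ x {y u c d} → y ≤ c * u → x * u ≤ d * Q → x * y ≲ c * d
    product≲ x {y} {u} {c} {d} le le′ = mk (≤-trans (*-monoʳ-≤ x le)
      (≤-trans (≤-reflexive (swap x c u)) (≤-trans (*-monoʳ-≤ c le′) (≤-reflexive (sym (*-assoc c d Q))))))
      where
      swap : ∀ x c u → x * (c * u) ≡ c * (x * u)
      swap = solve-∀

    with-factor : ∀ {a c} d → a ≲ c → c ≡ d → a ≤ d * Q
    with-factor d (mk le) refl = le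

  -- The factors of n² summed over the eight phases of the program, and the
  -- factor of n² for each augmentation in the given graph.
  abstract
    factor gainFactor : ℕ
    factor = 2510
    gainFactor = 77

  module Bounds (n h : ℕ) (0<n : 0 < n) (0<h : 0 < h) (h*h≤4n : h * h ≤ 4 * n) where

    S : ℕ
    S = n * n

    1≤S : 1 ≤ S
    1≤S = *-mono-≤ 0<n 0<n

    1≤nh : 1 ≤ n * h
    1≤nh = *-mono-≤ 0<n 0<h

    n≤S : n ≤ S
    n≤S = ≤-trans (≤-reflexive (sym (*-identityʳ n))) (*-monoʳ-≤ n 0<n)

    n≤nh : n ≤ n * h
    n≤nh = ≤-trans (≤-reflexive (sym (*-identityʳ n))) (*-monoʳ-≤ n 0<h)

    module N = Multiples n 0<n
    module H = Multiples h 0<h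
    module NH = Multiples (n * h) 1≤nh
    module NN = Multiples S 1≤S

    hh≤nh : h * h ≤ 4 * (n * h)
    hh≤nh = ≤-trans h*h≤4n (*-monoʳ-≤ 4 n≤nh)

    nh≤S : n * h ≤ 4 * S
    nh≤S = ≤-trans (*-monoʳ-≤ n (≤-trans (≤-trans (≤-reflexive (sym (*-identityʳ h))) (*-monoʳ-≤ h 0<h)) h*h≤4n))
      (≤-reflexive (swap n))
      where
      swap : ∀ n → n * (4 * n) ≡ 4 * (n * n)
      swap = solve-∀

    h*nh≤S : h * (n * h) ≤ 4 * S
    h*nh≤S = ≤-trans (≤-reflexive (swap n h)) (≤-trans (*-monoʳ-≤ n h*h≤4n) (≤-reflexive (swap′ n)))
      where
      swap : ∀ n h → h * (n * h) ≡ n * (h * h)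
      swap = solve-∀
      swap′ : ∀ n → n * (4 * n) ≡ 4 * (n * n)
      swap′ = solve-∀

    n≲S : n NN.≲ 1
    n≲S = NN.unit n≤S

    n≲nh : n NH.≲ 1
    n≲nh = NH.unit n≤nh

    hn≤nh : h * n ≤ 1 * (n * h)
    hn≤nh = NH.bound (NH.unit (≤-reflexive (*-comm h n)))

    nn≤S : n * n ≤ 1 * S
    nn≤S = NN.bound (NN.unit ≤-refl)

    setup≲ : ∀ τ → 1 + (forCost n 1 + (1 + (forCost n (1 + forCost n 2) + τ))) ≤ τ + 18 * S
    setup≲ τ = ≤-trans (≤-reflexive (swap (forCost n 1) (forCost n (1 + forCost n 2)) τ)) (+-monoʳ-≤ τ
      (NN.with-factor 18 (NN.suc≲ (NN.+≲ (NN.suc≲ (NN.suc≲ (NN.*≲ 3 n≲S))) (NN.suc≲ (NN.suc≲ (NN.suc≲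
        (NN.product≲ n {u = n} {9} {1} line nn≤S)))))) refl))
      where
      line : 3 + forCost n 2 ≤ 9 * n
      line = N.with-factor 9 (N.suc≲ (N.suc≲ (N.suc≲ (N.suc≲ (N.suc≲ (N.*≲ 4 (N.unit ≤-refl))))))) refl
      swap : ∀ a b τ → 1 + (a + (1 + (b + τ))) ≡ τ + (1 + (a + (1 + b)))
      swap = solve-∀

    root≲ : 3 + n * 3 ≤ 6 * S
    root≲ = NN.with-factor 6 (NN.suc≲ (NN.suc≲ (NN.suc≲ (NN.*≲ 3 n≲S)))) refl

    block≲ : suc (forCost n 1 + (forCost h (forCost h 1) + (forCost h (forCost n 36) +
      (forCost n 5 + (forCost h (forCost h 8) + 1))))) ≤ 148 * (n * h)
    block≲ = NH.with-factor 148 (NH.suc≲ (NH.+≲ (NH.suc≲ (NH.suc≲ (NH.*≲ 3 n≲nh)))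
      (NH.+≲ (NH.suc≲ (NH.suc≲ (NH.product≲ h {u = h} {7} {4} (marks 3) hh≤nh)))
      (NH.+≲ (NH.suc≲ (NH.suc≲ (NH.product≲ h {u = n} {42} {1} entries hn≤nh)))
      (NH.+≲ (NH.suc≲ (NH.suc≲ (NH.*≲ 7 n≲nh)))
      (NH.+≲ (NH.suc≲ (NH.suc≲ (NH.product≲ h {u = h} {14} {4} (marks 10) hh≤nh)))
             (NH.suc≲ NH.zero≲))))))) refl
      where
      marks : ∀ k → 4 + h * k ≤ (4 + 1 * k) * h
      marks k = H.bound (H.suc≲ (H.suc≲ (H.suc≲ (H.suc≲ (H.*≲ k (H.unit ≤-refl))))))
      entries : 2 + forCost n 36 ≤ 42 * n
      entries = N.with-factor 42 (N.suc≲ (N.suc≲ (N.suc≲ (N.suc≲ (N.*≲ 38 (N.unit ≤-refl)))))) refl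

    sparsify≲ : ∀ {c} → c ≤ 148 * (n * h) → 2 + h * c ≤ 594 * S
    sparsify≲ le = NN.with-factor 594 (NN.suc≲ (NN.suc≲ (NN.product≲ h {u = n * h} {148} {4} le h*nh≤S))) refl

    edges≲ : h * (n + h * (h * 2)) ≤ 9 * (n * h)
    edges≲ = NH.with-factor 9 (NH.product≲ h {u = n} {9} {1}
      (N.with-factor 9 (N.+≲ (N.unit ≤-refl) (N.product≲ h {u = h} {2} {4} (H.with-factor 2 (H.*≲ 2 (H.unit ≤-refl)) refl) h*h≤4n)) refl)
      hn≤nh) refl

    auction≲ : ∀ {m} → m ≤ 9 * (n * h) → forCost n 2 + suc h * (n + m) * 12 ≤ 966 * S
    auction≲ le = NN.with-factor 966 (NN.+≲ (NN.suc≲ (NN.suc≲ (NN.*≲ 4 n≲S)))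
      (NN.*≲ 12 (NN.product≲ (suc h) {u = n * h} {10} {8}
        (NH.with-factor 10 (NH.+≲ n≲nh (NH.mk {c = 9} le)) refl)
        (NN.with-factor 8 (NN.+≲ (NN.mk {c = 4} nh≤S) (NN.mk {c = 4} h*nh≤S)) refl)))) refl

    module Augment (Q : ℕ) (1≤Q : 1 ≤ Q) (n≤Q : n ≤ Q) where
      open Multiples Q 1≤Q

      augmentCost≲ : ∀ {m c} → m ≤ c * Q →
        1 + (forCost n 2 + (1 + (forCost n 3 + (2 + (1 + ((n + n + m) * 11 + (1 + (1 + (suc (n + n) * 8 + 0))))))))) ≤
        suc (6 + (8 + (3 + ((2 + c) * 11 + 26)))) * Q
      augmentCost≲ {m} {c} le = with-factor (suc (6 + (8 + (3 + ((2 + c) * 11 + 26)))))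
        (suc≲ (+≲ (suc≲ (suc≲ (*≲ 4 n≲))) (suc≲ (+≲ (suc≲ (suc≲ (*≲ 5 n≲))) (suc≲ (suc≲ (suc≲
        (+≲ (*≲ 11 (+≲ (+≲ n≲ n≲) (mk {c = c} le))) (suc≲ (suc≲ (+≲ (*≲ 8 (suc≲ (+≲ n≲ n≲))) zero≲)))))))))))
        refl
        where
        n≲ : n ≲ 1
        n≲ = unit n≤Q

    module SparseAugment = Augment (n * h) 1≤nh n≤nh
    module DenseAugment = Augment S 1≤S n≤S

    sparseAugment≲ : ∀ {k a} → a ≤ 165 * (n * h) → h * k ≤ n → 2 + suc k * a ≤ 827 * S
    sparseAugment≲ {k} le hk≤n = NN.with-factor 827 (NN.suc≲ (NN.suc≲ (NN.product≲ (suc k) {u = n * h} {165} {5} le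
      (NN.with-factor 5 (NN.+≲ (NN.mk {c = 4} nh≤S) (NN.unit (≤-trans (≤-reflexive (swap k n h)) (*-monoʳ-≤ n hk≤n)))) refl)))) refl
      where
      swap : ∀ k n h → k * (n * h) ≡ n * (h * k)
      swap = solve-∀

    denseAugment≲ : ∀ {k a} → a ≤ 77 * S → 2 + suc k * a ≤ 79 * S + 77 * (S * k)
    denseAugment≲ {k} {a} le = ≤-trans (+-mono-≤ (NN.with-factor 79 (NN.suc≲ (NN.suc≲ (NN.mk {c = 77} le))) refl) (*-monoʳ-≤ k le))
      (≤-reflexive (cong (79 * S +_) (swap k S)))
      where
      swap : ∀ k S → k * (77 * S) ≡ 77 * (S * k)
      swap = solve-∀

    dense≲ : forCost n (1 + forCost n 5) ≤ 14 * S
    dense≲ = NN.with-factor 14 (NN.suc≲ (NN.suc≲ (NN.product≲ n {u = n} {12} {1} line nn≤S))) refl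
      where
      line : 3 + forCost n 5 ≤ 12 * n
      line = N.with-factor 12 (N.suc≲ (N.suc≲ (N.suc≲ (N.suc≲ (N.suc≲ (N.*≲ 7 (N.unit ≤-refl))))))) refl

    report≲ : forCost n 2 ≤ 6 * S
    report≲ = NN.with-factor 6 (NN.suc≲ (NN.suc≲ (NN.*≲ 4 n≲S))) refl

    abstract
      total≲ : ∀ {t₁ t₂ t₃ t₄ t₅ t₆ t₇ t₈ τ k} → t₁ ≤ τ + 18 * S → t₂ ≤ 6 * S → t₃ ≤ 594 * S → t₄ ≤ 966 * S → t₅ ≤ 827 * S →
        t₆ ≤ 14 * S → t₇ ≤ 79 * S + 77 * (S * k) → t₈ ≤ 6 * S →
        t₁ + (t₂ + (t₃ + (t₄ + (t₅ + (t₆ + (t₇ + t₈)))))) ≤ τ + (factor * S + gainFactor * (S * k))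
      total≲ {τ = τ} {k} b₁ b₂ b₃ b₄ b₅ b₆ b₇ b₈ = ≤-trans
        (+-mono-≤ b₁ (+-mono-≤ b₂ (+-mono-≤ b₃ (+-mono-≤ b₄ (+-mono-≤ b₅ (+-mono-≤ b₆ (+-mono-≤ b₇ b₈)))))))
        (≤-reflexive (add τ S (S * k)))
        where
        add : ∀ τ S x → τ + 18 * S + (6 * S + (594 * S + (966 * S + (827 * S + (14 * S + (79 * S + 77 * x + 6 * S)))))) ≡
              τ + (2510 * S + 77 * x)
        add = solve-∀

  gain≲ : ∀ {n t r c d z d′ z′} → d + z ≡ n → d′ + z′ ≡ n → t + r ≤ 2 + suc d * c → d′ * c ≤ r →
          t ≤ 2 + suc (z′ ∸ z) * c
  gain≲ {n} {t} {r} {c} {d} {z} {d′} {z′} total total′ paid left = +-cancelʳ-≤ (d′ * c) t _ (begin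
    t + d′ * c                               ≤⟨ +-monoʳ-≤ t left ⟩
    t + r                                    ≤⟨ paid ⟩
    2 + suc d * c                            ≤⟨ s≤s (s≤s (*-monoˡ-≤ c (s≤s d≤))) ⟩
    2 + suc (z′ ∸ z + d′) * c                ≡⟨ cong (2 +_) (*-distribʳ-+ c (suc (z′ ∸ z)) d′) ⟩
    2 + suc (z′ ∸ z) * c + d′ * c            ∎)
    where
    open ≤-Reasoning
    swap : ∀ a z d → z + a + d ≡ a + d + z
    swap = solve-∀
    d≤ : d ≤ z′ ∸ z + d′
    d≤ = +-cancelʳ-≤ z d _ (≤-trans (≤-reflexive (trans total (trans (sym total′) (+-comm d′ z′))))
      (≤-trans (+-monoˡ-≤ d′ (m≤n+m∸n z′ z)) (≤-reflexive (swap (z′ ∸ z) z d′))))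

  module Sizes where
    open import Data.Fin using (zero; suc)
    open ℕ-Sums
    private
      module S = Algebra.Properties.CommutativeMonoid.Sum +-0-commutativeMonoid

    bit : Bool → ℕ
    bit b = if b then 1 else 0

    sum-tabulate : ∀ {n} (f : Fin n → ℕ) → Vec.sum (Vec.tabulate f) ≡ S.sum f
    sum-tabulate {zero}  f = refl
    sum-tabulate {suc n} f = cong (f zero +_) (sum-tabulate (f ∘ suc))

    card-tabulate : ∀ {n} (f : Fin n → Bool) → ∣ Vec.tabulate f ∣ ≡ S.sum (λ i → bit (f i))
    card-tabulate {zero}  f = refl
    card-tabulate {suc n} f with f zero
    ... | true  = cong suc (card-tabulate (f ∘ suc))
    ... | false = card-tabulate (f ∘ suc)

    module _ {n : ℕ} (F : EdgeSet n) (w : ℕ → ℕ → ℕ) (w≡ : ∀ i j → w (toℕ i) (toℕ j) ≡ bit (F i j)) where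

      degree-left : ∀ i → ∣ neighbours F (inj₁ i) ∣ ≡ sumTo n (w (toℕ i))
      degree-left i = trans (card-tabulate (F i)) (trans (S.sum-cong-≗ {n} (λ j → sym (w≡ i j))) (sym (sumTo-def n (w (toℕ i)))))

      degree-right : ∀ j → ∣ neighbours F (inj₂ j) ∣ ≡ sumTo n (λ i → w i (toℕ j))
      degree-right j = trans (card-tabulate (λ i → F i j))
        (trans (S.sum-cong-≗ {n} (λ i → sym (w≡ i j))) (sym (sumTo-def n (λ i → w i (toℕ j)))))

      size-sum : size F ≡ sumTo n (λ i → sumTo n (w i))
      size-sum = trans (sum-tabulate (λ i → ∣ neighbours F (inj₁ i) ∣))
        (trans (S.sum-cong-≗ {n} degree-left) (sym (sumTo-def n (λ i → sumTo n (w i)))))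

    below : ∀ {n} {P : ℕ → Set} → (∀ (i : Fin n) → P (toℕ i)) → ∀ i → i < n → P i
    below {P = P} f i i<n = subst P (toℕ-fromℕ< i<n) (f (fromℕ< i<n))

  module InitialStore (𝓡 : Reals) {n : ℕ} (E : EdgeSet n) (ε B : Reals.ℝ 𝓡) where
    open RealRAM 𝓡
    open Tests
    open Sizes

    edge : ℕ → ℕ → ℕ
    edge = natArray (initial E ε B) edgeᵃ

    edge-toℕ : ∀ i j → edge (toℕ i) (toℕ j) ≡ bit (E i j)
    edge-toℕ i j with toℕ i <? n | toℕ j <? n
    ... | yes p | yes q = cong₂ (λ i j → bit (E i j)) (fromℕ<-toℕ i p) (fromℕ<-toℕ j q)
    ... | no ¬p | _     = ⊥-elim (¬p (toℕ<n i))
    ... | yes _ | no ¬q = ⊥-elim (¬q (toℕ<n j))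

    bounded : ∀ {i j} → edge i j ≢ 0 → i < n × j < n
    bounded {i} {j} ne with i <? n | j <? n
    ... | yes p | yes q = p , q
    ... | yes _ | no _  = ⊥-elim (ne refl)
    ... | no _  | yes _ = ⊥-elim (ne refl)
    ... | no _  | no _  = ⊥-elim (ne refl)

  module Outcome (𝓡 : Reals) {n : ℕ} (E : EdgeSet n) (ε B : Reals.ℝ 𝓡) where
    open RealRAM 𝓡
    open InitialStore 𝓡 E ε B
    open Sizes
    open Matchings
    open ℕ-Sums

    Edge : Graph
    Edge i j = edge i j ≢ 0

    present : ∀ i j → Edge (toℕ i) (toℕ j) → E i j ≡ true
    present i j ne with E i j | edge-toℕ i j
    ... | true  | _ = refl
    ... | false | e = ⊥-elim (ne e)

    edge-present : ∀ i j → E i j ≡ true → Edge (toℕ i) (toℕ j)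
    edge-present i j e z = 0≢1+n (trans (sym z) (trans (edge-toℕ i j) (cong bit e)))

    module _ {s : Store} {left right : ℕ → ℕ} (M : Matched Edge left right)
      (out≡ : ∀ {i} → i < n → ∀ j → natArray s outᵃ i j ≡ ind left i j)
      {u p : ℕ → ℕ} (weight : sumTo n u + sumTo n p ≤ count n left) (cover : ∀ {i j} → Edge i j → 1 ≤ u i + p j) where
      private
        F : EdgeSet n
        F = output n s

        F≡ : ∀ i j → ind left (toℕ i) (toℕ j) ≡ bit (F i j)
        F≡ i j = subst (λ x → ind left (toℕ i) (toℕ j) ≡ bit (x ≡ᵇ 1)) (sym (out≡ (toℕ<n i) (toℕ j)))
          (ind-elim (λ x → x ≡ bit (x ≡ᵇ 1)) left (toℕ i) (toℕ j) (λ _ → refl) (λ _ → refl))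

        matching : IsMatching E F
        matching = record
          { isSubset = λ i j e → present i j (matched-edge i j (trans (F≡ i j) (cong bit e)))
          ; degree≤1 = degree
          }
          where
          matched-edge : ∀ i j → ind left (toℕ i) (toℕ j) ≡ 1 → Edge (toℕ i) (toℕ j)
          matched-edge i j = ind-elim (λ x → x ≡ 1 → Edge (toℕ i) (toℕ j)) left (toℕ i) (toℕ j)
            (λ l _ → proj₂ (Matched.to M l)) (λ _ ())
          degree : ∀ v → ∣ neighbours F v ∣ ≤ 1
          degree (inj₁ i) = ≤-trans (≤-reflexive (trans (degree-left F (ind left) F≡ i) (ind-row bounded M (toℕ i)))) (sign≤1 _)
          degree (inj₂ j) = ≤-trans (≤-reflexive (trans (degree-right F (ind left) F≡ j) (ind-column bounded M (toℕ j)))) (sign≤1 _)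

        size-F : size F ≡ count n left
        size-F = trans (size-sum F (ind left) F≡) (sumTo-cong n (λ i _ → ind-row bounded M i))

        largest : ∀ F′ → IsMatching E F′ → size F′ ≤ size F
        largest F′ M′ = begin
          size F′                                ≡⟨ size-sum F′ w w≡ ⟩
          sumTo n (λ i → sumTo n (w i))          ≡⟨ *-identityˡ _ ⟨
          1 * sumTo n (λ i → sumTo n (w i))      ≤⟨ labels≥ n 1 u p w rows columns covered ⟩
          sumTo n u + sumTo n p                  ≤⟨ weight ⟩
          count n left                           ≡⟨ size-F ⟨
          size F                                 ∎
          where
          open ≤-Reasoning
          module F′ = InitialStore 𝓡 F′ ε B
          w : ℕ → ℕ → ℕ
          w = F′.edge
          w≡ : ∀ i j → w (toℕ i) (toℕ j) ≡ bit (F′ i j)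
          w≡ = F′.edge-toℕ
          rows : ∀ i → i < n → sumTo n (w i) ≤ 1
          rows = below (λ i → subst (_≤ 1) (degree-left F′ w w≡ i) (IsMatching.degree≤1 M′ (inj₁ i)))
          columns : ∀ j → j < n → sumTo n (λ i → w i j) ≤ 1
          columns = below (λ j → subst (_≤ 1) (degree-right F′ w w≡ j) (IsMatching.degree≤1 M′ (inj₂ j)))
          covered : ∀ i j → i < n → j < n → w i j ≢ 0 → 1 ≤ u i + p j
          covered i j i<n j<n = below {P = λ i → w i j ≢ 0 → 1 ≤ u i + p j}
            (λ i → below {P = λ j → w (toℕ i) j ≢ 0 → 1 ≤ u (toℕ i) + p j}
              (λ j ne → cover (edge-present i j (IsMatching.isSubset M′ i j (chosen i j ne)))) j j<n) i i<n
            where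
            chosen : ∀ i j → w (toℕ i) (toℕ j) ≢ 0 → F′ i j ≡ true
            chosen i j ne with F′ i j | w≡ i j
            ... | true  | _ = refl
            ... | false | e = ⊥-elim (ne e)

      isMaximum : IsMaximumMatching E (output n s)
      isMaximum = record { isMatching = matching ; maximum = largest }

module Continuous where
  open Combinatorial
  open Names

  module RealFacts (𝓡 : Reals) where
    open Reals 𝓡 public
    open IsDecTotalOrder isDecTotalOrder public using (antisym; total) renaming (refl to ≤-refl; trans to ≤-trans; reflexive to ≤-reflexive)
    open CommutativeRing commutativeRing public
      using (+-comm; +-assoc; +-identityˡ; +-identityʳ; *-comm; *-assoc; *-identityˡ; *-identityʳ; distribˡ; distribʳ
            ; zeroˡ; zeroʳ; -‿inverseʳ; -‿inverseˡ; +-commutativeMonoid; semiring; commutativeSemiring; ring)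
    open Algebra.Properties.Ring ring public using (-‿distribʳ-*; -‿distribˡ-*; -‿involutive)
    open import Algebra.Solver.Ring.NaturalCoefficients.Default commutativeSemiring public
      using (solve; _:=_; _:+_; _:*_)

    +-mono-≤ : ∀ {a b c d} → a ≤ b → c ≤ d → a + c ≤ b + d
    +-mono-≤ {a} {b} {c} {d} p q = ≤-trans (+-monoˡ-≤ c p)
      (subst₂ _≤_ (+-comm c b) (+-comm d b) (+-monoˡ-≤ b q))

    x≤y⇒0≤y-x : ∀ {x y} → x ≤ y → 0# ≤ y - x
    x≤y⇒0≤y-x {x} {y} p = subst (_≤ y - x) (-‿inverseʳ x) (+-monoˡ-≤ (- x) p)

    [y-x]+x≡y : ∀ x y → y - x + x ≡ y
    [y-x]+x≡y x y = trans (+-assoc y (- x) x) (trans (cong (y +_) (-‿inverseˡ x)) (+-identityʳ y))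

    0≤y-x⇒x≤y : ∀ {x y} → 0# ≤ y - x → x ≤ y
    0≤y-x⇒x≤y {x} {y} p = subst₂ _≤_ (+-identityˡ x) ([y-x]+x≡y x y) (+-monoˡ-≤ x p)

    *-monoˡ-≤ : ∀ {c a b} → 0# ≤ c → a ≤ b → c * a ≤ c * b
    *-monoˡ-≤ {c} {a} {b} 0≤c a≤b = 0≤y-x⇒x≤y
      (subst (0# ≤_) (trans (distribˡ c b (- a)) (cong (c * b +_) (sym (-‿distribʳ-* c a))))
        (*-nonNegative 0≤c (x≤y⇒0≤y-x a≤b)))

    *-monoʳ-≤ : ∀ {c a b} → 0# ≤ c → a ≤ b → a * c ≤ b * c
    *-monoʳ-≤ {c} {a} {b} 0≤c a≤b = subst₂ _≤_ (*-comm c a) (*-comm c b) (*-monoˡ-≤ 0≤c a≤b)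

    +-cancelʳ : ∀ z {x y} → x + z ≡ y + z → x ≡ y
    +-cancelʳ z {x} {y} e = trans (sym (undo x)) (trans (cong (_- z) e) (undo y))
      where
      undo : ∀ x → x + z - z ≡ x
      undo x = trans (+-assoc x z (- z)) (trans (cong (x +_) (-‿inverseʳ z)) (+-identityʳ x))

    +-cancelʳ-≤ : ∀ z {x y} → x + z ≤ y + z → x ≤ y
    +-cancelʳ-≤ z {x} {y} e = subst₂ _≤_ (undo x) (undo y) (+-monoˡ-≤ (- z) e)
      where
      undo : ∀ x → x + z - z ≡ x
      undo x = trans (+-assoc x z (- z)) (trans (cong (x +_) (-‿inverseʳ z)) (+-identityʳ x))

    0≤1 : 0# ≤ 1#
    0≤1 with total 0# 1#
    ... | inj₁ p = p
    ... | inj₂ 1≤0 = subst (0# ≤_) [-1][-1] (*-nonNegative 0≤-1 0≤-1)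
      where
      0≤-1 : 0# ≤ - 1#
      0≤-1 = subst (0# ≤_) (+-identityˡ (- 1#)) (x≤y⇒0≤y-x 1≤0)
      [-1][-1] : - 1# * - 1# ≡ 1#
      [-1][-1] = trans (sym (-‿distribˡ-* 1# (- 1#))) (trans (cong -_ (*-identityˡ (- 1#))) (-‿involutive 1#))

    1≰0 : ¬ (1# ≤ 0#)
    1≰0 p = 0≢1 (antisym 0≤1 p)

    ⁻¹-nonNegative : ∀ {x} → 0# ≤ x → x ≢ 0# → 0# ≤ x ⁻¹
    ⁻¹-nonNegative {x} 0≤x x≢0 with total 0# (x ⁻¹)
    ... | inj₁ p = p
    ... | inj₂ p = ⊥-elim (1≰0 (subst₂ _≤_ (*-inverseʳ x x≢0) (zeroʳ x) (*-monoˡ-≤ 0≤x p)))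

    x≤x+y : ∀ {x y} → 0# ≤ y → x ≤ x + y
    x≤x+y {x} {y} p = subst (_≤ x + y) (+-identityʳ x) (+-mono-≤ ≤-refl p)

    +-nonNegative : ∀ {x y} → 0# ≤ x → 0# ≤ y → 0# ≤ x + y
    +-nonNegative p q = ≤-trans p (x≤x+y q)

    private
      module M = Algebra.Properties.Semiring.Mult semiring

    fromℕ-+ : ∀ a b → fromℕ (a ℕ.+ b) ≡ fromℕ a + fromℕ b
    fromℕ-+ a b = M.×-homo-+ 1# a b

    fromℕ-* : ∀ a b → fromℕ (a ℕ.* b) ≡ fromℕ a * fromℕ b
    fromℕ-* a b = M.×1-homo-* a b

    fromℕ-1 : fromℕ 1 ≡ 1#
    fromℕ-1 = +-identityʳ 1#

    fromℕ-nonNegative : ∀ a → 0# ≤ fromℕ a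
    fromℕ-nonNegative zero    = ≤-refl
    fromℕ-nonNegative (suc a) = +-nonNegative 0≤1 (fromℕ-nonNegative a)

    fromℕ-mono : ∀ {a b} → a ℕ.≤ b → fromℕ a ≤ fromℕ b
    fromℕ-mono {b = b} z≤n = fromℕ-nonNegative b
    fromℕ-mono (s≤s p) = +-mono-≤ ≤-refl (fromℕ-mono p)

    fromℕ≢0 : ∀ {a} → a ≢ 0 → fromℕ a ≢ 0#
    fromℕ≢0 {zero}  ne = ⊥-elim (ne refl)
    fromℕ≢0 {suc a} ne e = 1≰0 (≤-trans (x≤x+y (fromℕ-nonNegative a)) (≤-reflexive e))

    module ∑ℝ = SumTo +-commutativeMonoid
    open ∑ℝ using (sumTo; sumTo-cong; sumTo-∙; sumTo-comm; sumTo-ε; sumTo-change; sumTo-single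
                  ; sumTo-zero; sumTo-step; sumTo-def) public
    private
      module S = Algebra.Properties.Semiring.Sum semiring
      module ℕS = ℕ-Sums

    sumTo-*ˡ : ∀ n c f → c * sumTo n f ≡ sumTo n (λ i → c * f i)
    sumTo-*ˡ n c f rewrite sumTo-def n f | sumTo-def n (λ i → c * f i) =
      S.*-distribˡ-sum {n} c (λ i → f (toℕ i))

    sumTo-mono : ∀ n {f g} → (∀ i → i ℕ.< n → f i ≤ g i) → sumTo n f ≤ sumTo n g
    sumTo-mono zero    {f} {g} _  rewrite sumTo-zero f | sumTo-zero g = ≤-refl
    sumTo-mono (suc n) {f} {g} le rewrite sumTo-step n f | sumTo-step n g =
      +-mono-≤ (le 0 (s≤s z≤n)) (sumTo-mono n (λ i i<n → le (suc i) (s≤s i<n)))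

    sumTo-fromℕ : ∀ n f → sumTo n (λ i → fromℕ (f i)) ≡ fromℕ (ℕS.sumTo n f)
    sumTo-fromℕ zero    f = trans (sumTo-zero _) (cong fromℕ (sym (ℕS.sumTo-zero f)))
    sumTo-fromℕ (suc n) f = begin
      sumTo (suc n) (λ i → fromℕ (f i))                ≡⟨ sumTo-step n _ ⟩
      fromℕ (f 0) + sumTo n (λ i → fromℕ (f (suc i)))  ≡⟨ cong (fromℕ (f 0) +_) (sumTo-fromℕ n (λ i → f (suc i))) ⟩
      fromℕ (f 0) + fromℕ (ℕS.sumTo n (λ i → f (suc i))) ≡⟨ fromℕ-+ (f 0) _ ⟨
      fromℕ (f 0 ℕ.+ ℕS.sumTo n (λ i → f (suc i)))     ≡⟨ cong fromℕ (ℕS.sumTo-step n f) ⟨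
      fromℕ (ℕS.sumTo (suc n) f)                       ∎
      where open ≡-Reasoning

    sumTo-const : ∀ n c → sumTo n (λ _ → c) ≡ fromℕ n * c
    sumTo-const n c = begin
      sumTo n (λ _ → c)                  ≡⟨ sumTo-cong n (λ _ _ → sym (trans (cong (c *_) fromℕ-1) (*-identityʳ c))) ⟩
      sumTo n (λ _ → c * fromℕ 1)        ≡⟨ sumTo-*ˡ n c (λ _ → fromℕ 1) ⟨
      c * sumTo n (λ _ → fromℕ 1)        ≡⟨ cong (c *_) (sumTo-fromℕ n (λ _ → 1)) ⟩
      c * fromℕ (ℕS.sumTo n (λ _ → 1))   ≡⟨ cong (λ x → c * fromℕ x) (trans (ℕS.sumTo-const n 1) (ℕ.*-identityʳ n)) ⟩
      c * fromℕ n                        ≡⟨ *-comm c _ ⟩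
      fromℕ n * c                        ∎
      where open ≡-Reasoning

    -- ⟨ w , X ⟩ for matrices indexed by natural numbers below n.
    pairing : ℕ → (ℕ → ℕ → ℝ) → (ℕ → ℕ → ℝ) → ℝ
    pairing n w X = sumTo n (λ i → sumTo n (λ j → w i j * X i j))

    open RealRAM 𝓡 using (update; update₂)
    open Update 𝓡

    shift : ℕ → ℕ → ℝ → (ℕ → ℕ → ℝ) → ℕ → ℕ → ℝ
    shift i j d X = update₂ i j (X i j + d) X

    pairing-shift : ∀ {n i j} → i ℕ.< n → j ℕ.< n → ∀ w d X →
                    pairing n w (shift i j d X) ≡ pairing n w X + w i j * d
    pairing-shift {n} {i} {j} i<n j<n w d X = +-cancelʳ (row i + w i j * X i j) (begin
      pairing n w X′ + (row i + w i j * X i j)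
        ≡⟨ +-assoc _ _ _ ⟨
      pairing n w X′ + row i + w i j * X i j
        ≡⟨ cong (_+ w i j * X i j) (sumTo-change i<n λ r r≢i → sumTo-cong n λ c _ →
             cong (w r c *_) (update₂-other {k = i} {j} {r} {c} {f = X} (λ (e , _) → r≢i e))) ⟩
      pairing n w X + row′ i + w i j * X i j
        ≡⟨ +-assoc _ _ _ ⟩
      pairing n w X + (row′ i + w i j * X i j)
        ≡⟨ cong (pairing n w X +_) (sumTo-change j<n λ c c≢j →
             cong (w i c *_) (update₂-other {k = i} {j} {i} {c} {f = X} (λ (_ , e) → c≢j e))) ⟩
      pairing n w X + (row i + w i j * X′ i j)
        ≡⟨ cong (λ x → pairing n w X + (row i + w i j * x)) (update₂-same i j _ X) ⟩
      pairing n w X + (row i + w i j * (X i j + d))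
        ≡⟨ solve 5 (λ p r w x d → p :+ (r :+ w :* (x :+ d)) := p :+ w :* d :+ (r :+ w :* x)) refl
             (pairing n w X) (row i) (w i j) (X i j) d ⟩
      pairing n w X + w i j * d + (row i + w i j * X i j) ∎)
      where
      open ≡-Reasoning
      X′ = shift i j d X
      row row′ : ℕ → ℝ
      row r = sumTo n (λ c → w r c * X r c)
      row′ r = sumTo n (λ c → w r c * X′ r c)

    shift≥ : ∀ {d} → 0# ≤ d → ∀ i j X r c → X r c ≤ shift i j d X r c
    shift≥ {d} 0≤d i j X r c = update₂-elim (X r c ≤_) {i} {j} {r} {c} {f = X}
      (λ { refl refl → x≤x+y 0≤d }) (λ _ → ≤-refl)

    -- δ is moved from the entries (w, b) and (u, a) to (w, a) and (u, b).
    rotate : (w b u a : ℕ) → ℝ → (ℕ → ℕ → ℝ) → ℕ → ℕ → ℝ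
    rotate w b u a δ X = shift u a (- δ) (shift w b (- δ) (shift u b δ (shift w a δ X)))

    module Rotation {w b u a : ℕ} (w≢u : w ≢ u) (a≢b : a ≢ b) {X : ℕ → ℕ → ℝ} where

      pairing-rotate : ∀ {n} → w ℕ.< n → b ℕ.< n → u ℕ.< n → a ℕ.< n → ∀ v δ →
                       v w a + v u b ≡ v w b + v u a → pairing n v (rotate w b u a δ X) ≡ pairing n v X
      pairing-rotate {n} w<n b<n u<n a<n v δ balanced = begin
        pairing n v (rotate w b u a δ X)
          ≡⟨ pairing-shift u<n a<n v (- δ) _ ⟩
        pairing n v (shift w b (- δ) (shift u b δ (shift w a δ X))) + v u a * - δ
          ≡⟨ cong (_+ v u a * - δ) (pairing-shift w<n b<n v (- δ) _) ⟩
        pairing n v (shift u b δ (shift w a δ X)) + v w b * - δ + v u a * - δ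
          ≡⟨ cong (λ x → x + v w b * - δ + v u a * - δ) (trans (pairing-shift u<n b<n v δ _)
               (cong (_+ v u b * δ) (pairing-shift w<n a<n v δ _))) ⟩
        P + v w a * δ + v u b * δ + v w b * - δ + v u a * - δ
          ≡⟨ solve 7 (λ p x y z t d m → p :+ x :* d :+ y :* d :+ z :* m :+ t :* m :=
               p :+ (x :+ y) :* d :+ (z :+ t) :* m) refl P (v w a) (v u b) (v w b) (v u a) δ (- δ) ⟩
        P + (v w a + v u b) * δ + (v w b + v u a) * - δ
          ≡⟨ cong (λ x → P + x * δ + (v w b + v u a) * - δ) balanced ⟩
        P + z * δ + z * - δ
          ≡⟨ solve 4 (λ p z d m → p :+ z :* d :+ z :* m := p :+ z :* (d :+ m)) refl P z δ (- δ) ⟩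
        P + z * (δ + - δ)  ≡⟨ cong (λ x → P + z * x) (-‿inverseʳ δ) ⟩
        P + z * 0#         ≡⟨ cong (P +_) (zeroʳ z) ⟩
        P + 0#             ≡⟨ +-identityʳ P ⟩
        P                  ∎
        where
        open ≡-Reasoning
        P = pairing n v X
        z = v w b + v u a

      private
        raised : ℝ → ℕ → ℕ → ℝ
        raised δ = shift u b δ (shift w a δ X)

        raised-wb : ∀ δ → raised δ w b ≡ X w b
        raised-wb δ = trans
          (update₂-other {k = u} {b} {w} {b} {f = shift w a δ X} (λ (e , _) → w≢u e))
          (update₂-other {k = w} {a} {w} {b} {f = X} (λ (_ , e) → a≢b (sym e)))

        raised-ua : ∀ δ → raised δ u a ≡ X u a
        raised-ua δ = trans
          (update₂-other {k = u} {b} {u} {a} {f = shift w a δ X} (λ (_ , e) → a≢b e))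
          (update₂-other {k = w} {a} {u} {a} {f = X} (λ (e , _) → w≢u (sym e)))

      rotate-wb : ∀ δ → rotate w b u a δ X w b ≡ X w b - δ
      rotate-wb δ = trans
        (update₂-other {k = u} {a} {w} {b} {f = shift w b (- δ) (raised δ)} (λ (e , _) → w≢u e))
        (trans (update₂-same w b _ (raised δ)) (cong (_- δ) (raised-wb δ)))

      rotate-ua : ∀ δ → rotate w b u a δ X u a ≡ X u a - δ
      rotate-ua δ = trans (update₂-same u a _ (shift w b (- δ) (raised δ)))
        (cong (_- δ) (trans (update₂-other {k = w} {b} {u} {a} {f = raised δ} (λ (e , _) → w≢u (sym e))) (raised-ua δ)))

      rotate-other : ∀ δ {i j} → ¬ (i ≡ w × j ≡ b) → ¬ (i ≡ u × j ≡ a) → ¬ (i ≡ w × j ≡ a) → ¬ (i ≡ u × j ≡ b) →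
                     rotate w b u a δ X i j ≡ X i j
      rotate-other δ {i} {j} wb ua wa ub =
        trans (update₂-other {k = u} {a} {i} {j} {f = shift w b (- δ) (raised δ)} ua)
        (trans (update₂-other {k = w} {b} {i} {j} {f = raised δ} wb)
        (trans (update₂-other {k = u} {b} {i} {j} {f = shift w a δ X} ub)
               (update₂-other {k = w} {a} {i} {j} {f = X} wa)))

      rotate-nonNegative : ∀ {δ} → 0# ≤ δ → δ ≤ X w b → δ ≤ X u a → (∀ i j → 0# ≤ X i j) →
                           ∀ i j → 0# ≤ rotate w b u a δ X i j
      rotate-nonNegative {δ} 0≤δ δ≤wb δ≤ua 0≤X i j =
        update₂-elim (0# ≤_) {u} {a} {i} {j} {f = lowered}
          (λ _ _ → subst (λ x → 0# ≤ x - δ)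
            (sym (trans (update₂-other {k = w} {b} {u} {a} {f = raised δ} (λ (e , _) → w≢u (sym e))) (raised-ua δ)))
            (x≤y⇒0≤y-x δ≤ua))
          (λ _ → update₂-elim (0# ≤_) {w} {b} {i} {j} {f = raised δ}
            (λ _ _ → subst (λ x → 0# ≤ x - δ) (sym (raised-wb δ)) (x≤y⇒0≤y-x δ≤wb))
            (λ _ → ≤-trans (0≤X i j) (≤-trans (shift≥ 0≤δ w a X i j) (shift≥ 0≤δ u b (shift w a δ X) i j))))
        where lowered = shift w b (- δ) (raised δ)

  Balanced : (𝓡 : Reals) → Graph → (ℕ → ℕ → Reals.ℝ 𝓡) → Set
  Balanced 𝓡 Edge v = ∀ {i i′ j j′} → Edge i j → Edge i′ j′ → Edge i j′ → Edge i′ j →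
                      v i j + v i′ j′ ≡ v i j′ + v i′ j
    where open Reals 𝓡

  module SparsifyInvariant (𝓡 : Reals) (n : ℕ) (Edge : Graph) (bounded : ∀ {i j} → Edge i j → i ℕ.< n × j ℕ.< n)
    (h base : ℕ) (X₀ : ℕ → ℕ → Reals.ℝ 𝓡) (Old : Graph) where
    open RealRAM 𝓡 using (update; update₂)
    open Update 𝓡
    open RealFacts 𝓡
    open Matchings
    open ℕ-Sums using (count; sign; sumTo-suc)

    -- Columns of the current block are numbered relative to base.
    col : ℕ → ℕ
    col o = base ℕ.+ o

    -- cur i is the index plus one of the only loose entry of row i; a value
    -- suc u of mark a b means that row u has its entries a and b parked there.
    Covered : (cur : ℕ → ℕ) (mark : ℕ → ℕ → ℕ) → Graph
    Covered cur mark i o = cur i ≡ suc o ⊎ ∃[ a ] ∃[ b ] mark a b ≡ suc i × (o ≡ a ⊎ o ≡ b)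

    record Kept (Seen Hand : Graph) (cur : ℕ → ℕ) (mark : ℕ → ℕ → ℕ) (X : ℕ → ℕ → ℝ) : Set where
      field
        cur-edge    : ∀ {i o} → cur i ≡ suc o → o ℕ.< h × Edge i (col o)
        mark-edge   : ∀ {a b u} → mark a b ≡ suc u → a ℕ.< h × b ℕ.< h × Edge u (col a) × Edge u (col b)
        nonNegative : ∀ i j → 0# ≤ X i j
        conserved   : ∀ v → Balanced 𝓡 Edge v → pairing n v X ≡ pairing n v X₀
        covered     : ∀ {i o} → Edge i (col o) → Seen i o → X i (col o) ≢ 0# → Covered cur mark i o ⊎ Hand i o
        old         : ∀ {i j} → Edge i j → j ℕ.< base → X i j ≢ 0# → Old i j

    At : ℕ → ℕ → Graph
    At w b i o = i ≡ w × o ≡ b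

    Nowhere : Graph
    Nowhere _ _ = ⊥

    take : ∀ {Seen Seen′ w b cur mark X} → (∀ {i o} → Seen′ i o → Seen i o ⊎ At w b i o) →
           Kept Seen Nowhere cur mark X → Kept Seen′ (At w b) cur mark X
    take split K = record
      { cur-edge = cur-edge ; mark-edge = mark-edge ; nonNegative = nonNegative ; conserved = conserved
      ; covered = λ e s x → go e (split s) x ; old = old }
      where
      open Kept K
      go : ∀ {i o} → Edge i (col o) → _ → _ → _
      go e (inj₁ s) x with covered e s x
      ... | inj₁ c = inj₁ c
      go e (inj₂ at) x = inj₂ at

    reSeen : ∀ {Seen Seen′ Hand cur mark X} → (∀ {i o} → Edge i (col o) → Seen′ i o → Seen i o) →
             Kept Seen Hand cur mark X → Kept Seen′ Hand cur mark X
    reSeen sub K = record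
      { cur-edge = cur-edge ; mark-edge = mark-edge ; nonNegative = nonNegative ; conserved = conserved
      ; covered = λ e s x → covered e (sub e s) x ; old = old }
      where open Kept K

    module _ {Seen w b cur mark X} (K : Kept Seen (At w b) cur mark X) where
      open Kept K

      drop : Covered cur mark w b → Kept Seen Nowhere cur mark X
      drop c = record
        { cur-edge = cur-edge ; mark-edge = mark-edge ; nonNegative = nonNegative ; conserved = conserved
        ; covered = λ e s x → go (covered e s x) ; old = old }
        where
        go : ∀ {i o} → Covered cur mark i o ⊎ At w b i o → Covered cur mark i o ⊎ ⊥
        go (inj₁ c) = inj₁ c
        go (inj₂ (refl , refl)) = inj₁ c

      module _ (b<h : b ℕ.< h) (edge : Edge w (col b)) where
        private
          w<n = proj₁ (bounded edge)

        place : cur w ≡ 0 → Kept Seen Nowhere (update w (suc b) cur) mark X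
        place cw = record
          { cur-edge = λ {i} {o} → update-elim (λ x → x ≡ suc o → o ℕ.< h × Edge i (col o)) {w} {i} {f = cur}
              (λ { refl refl → b<h , edge }) (λ _ → cur-edge)
          ; mark-edge = mark-edge ; nonNegative = nonNegative ; conserved = conserved
          ; covered = λ e s x → go (covered e s x) ; old = old }
          where
          go : ∀ {i o} → Covered cur mark i o ⊎ At w b i o → Covered (update w (suc b) cur) mark i o ⊎ ⊥
          go {i} (inj₁ (inj₁ c)) = inj₁ (inj₁ (trans
            (update-other {k = w} {i} {f = cur} (λ { refl → ℕ.0≢1+n (trans (sym cw) c) })) c))
          go (inj₁ (inj₂ m)) = inj₁ (inj₂ m)
          go (inj₂ (refl , refl)) = inj₁ (inj₁ (update-same w _ cur))

        count-place : cur w ≡ 0 → count n (update w (suc b) cur) ≡ suc (count n cur)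
        count-place cw = sumTo-suc w<n (λ k ne → cong sign (update-other {k = w} {k} {f = cur} ne))
          (trans (cong sign (update-same w _ cur)) (cong (λ x → suc (sign x)) (sym cw)))

        module _ (cw≢0 : cur w ≢ 0) where
          private
            a = cur w ∸ 1
            cw : cur w ≡ suc a
            cw = sym (suc-∸1 cw≢0)
            cur′ : ℕ → ℕ
            cur′ = update w 0 cur
            mark′ : ℕ → ℕ → ℕ
            mark′ = update₂ a b (suc w) mark
            a<h = proj₁ (cur-edge cw)
            edge-wa : Edge w (col a)
            edge-wa = proj₂ (cur-edge cw)

            cur′-edge : ∀ {i o} → cur′ i ≡ suc o → o ℕ.< h × Edge i (col o)
            cur′-edge {i} {o} = update-elim (λ x → x ≡ suc o → o ℕ.< h × Edge i (col o)) {w} {i} {f = cur}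
              (λ _ ()) (λ _ → cur-edge)

            mark′-edge : ∀ {a′ b′ u} → mark′ a′ b′ ≡ suc u → a′ ℕ.< h × b′ ℕ.< h × Edge u (col a′) × Edge u (col b′)
            mark′-edge {a′} {b′} {u} = update₂-elim
              (λ x → x ≡ suc u → a′ ℕ.< h × b′ ℕ.< h × Edge u (col a′) × Edge u (col b′)) {a} {b} {a′} {b′} {f = mark}
              (λ { refl refl refl → a<h , b<h , edge-wa , edge }) (λ _ → mark-edge)

            mark′-old : ∀ {a′ b′} → ¬ (a′ ≡ a × b′ ≡ b) → mark′ a′ b′ ≡ mark a′ b′
            mark′-old {a′} {b′} = update₂-other {k = a} {b} {a′} {b′} {f = mark}

            parked : ∀ {o} → o ≡ a ⊎ o ≡ b → Covered cur′ mark′ w o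
            parked e = inj₂ (a , b , update₂-same a b (suc w) mark , e)

          count-park : count n cur ≡ suc (count n cur′)
          count-park = sumTo-suc w<n (λ k ne → cong sign (sym (update-other {k = w} {k} {f = cur} ne)))
            (trans (cong sign cw) (cong (λ x → suc (sign x)) (sym (update-same w 0 cur))))

          park : mark a b ≡ 0 → Kept Seen Nowhere cur′ mark′ X
          park free = record
            { cur-edge = cur′-edge ; mark-edge = mark′-edge ; nonNegative = nonNegative ; conserved = conserved
            ; covered = λ e s x → go (covered e s x) ; old = old }
            where
            go : ∀ {i o} → Covered cur mark i o ⊎ At w b i o → Covered cur′ mark′ i o ⊎ ⊥
            go {i} (inj₁ (inj₁ c)) with i ℕ.≟ w
            ... | yes refl = inj₁ (parked (inj₁ (ℕ.suc-injective (trans (sym c) cw))))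
            ... | no i≢w   = inj₁ (inj₁ (trans (update-other {k = w} {i} {f = cur} i≢w) c))
            go (inj₁ (inj₂ (a′ , b′ , m , e))) = inj₁ (inj₂ (a′ , b′ ,
              trans (mark′-old (λ { (refl , refl) → ℕ.0≢1+n (trans (sym free) m) })) m , e))
            go (inj₂ (refl , refl)) = inj₁ (parked (inj₂ refl))

          module _ (taken : mark a b ≢ 0) where
            private
              u = mark a b ∸ 1
              mu : mark a b ≡ suc u
              mu = sym (suc-∸1 taken)
              edge-ua : Edge u (col a)
              edge-ua = proj₁ (proj₂ (proj₂ (mark-edge mu)))

            edge-ub : Edge u (col b)
            edge-ub = proj₂ (proj₂ (proj₂ (mark-edge mu)))

            drop-same-column : suc b ≡ cur w → Kept Seen Nowhere cur mark X
            drop-same-column e = drop (inj₁ (sym e))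

            drop-same-row : u ≡ w → Kept Seen Nowhere cur mark X
            drop-same-row e = drop (inj₂ (a , b , trans mu (cong suc e) , inj₂ refl))

            module _ (b≢cw : suc b ≢ cur w) (u≢w : u ≢ w) where
              private
                a≢b : col a ≢ col b
                a≢b e = b≢cw (trans (cong suc (sym (ℕ.+-cancelˡ-≡ base a b e))) (sym cw))
                module R = Rotation {w} {col b} {u} {col a} (λ e → u≢w (sym e)) a≢b {X}
                col≮ : ∀ {j o} → j ℕ.< base → j ≢ col o
                col≮ {j} {o} j<base refl = ℕ.<⇒≱ j<base (ℕ.m≤m+n base o)
                X′ : ℝ → ℕ → ℕ → ℝ
                X′ δ = rotate w (col b) u (col a) δ X
                same-old : ∀ δ {i j} → j ℕ.< base → X′ δ i j ≡ X i j
                same-old δ j<base = R.rotate-other δ (λ (_ , e) → col≮ {o = b} j<base e) (λ (_ , e) → col≮ {o = a} j<base e)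
                  (λ (_ , e) → col≮ {o = a} j<base e) (λ (_ , e) → col≮ {o = b} j<base e)
                old′ : ∀ δ {i j} → Edge i j → j ℕ.< base → X′ δ i j ≢ 0# → Old i j
                old′ δ e j<base x = old e j<base (λ z → x (trans (same-old δ j<base) z))
                conserved′ : ∀ δ v → Balanced 𝓡 Edge v → pairing n v (X′ δ) ≡ pairing n v X₀
                conserved′ δ v bal = trans
                  (R.pairing-rotate w<n (proj₂ (bounded edge)) (proj₁ (bounded edge-ua)) (proj₂ (bounded edge-ua)) v δ
                    (bal edge-wa edge-ub edge edge-ua))
                  (conserved v bal)
                cancelled : ∀ {x y : ℝ} → x ≡ y - y → x ≡ 0#
                cancelled {y = y} e = trans e (-‿inverseʳ y)
                data Place (i o : ℕ) : Set where
                  wb : i ≡ w → o ≡ b → Place i o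
                  ua : i ≡ u → o ≡ a → Place i o
                  wa : i ≡ w → o ≡ a → Place i o
                  ub : i ≡ u → o ≡ b → Place i o
                  other : (∀ δ → X′ δ i (col o) ≡ X i (col o)) → ¬ (i ≡ w × o ≡ b) → ¬ (i ≡ u × o ≡ a) →
                          ¬ (i ≡ w × o ≡ a) → ¬ (i ≡ u × o ≡ b) → Place i o
                locate : ∀ i o → Place i o
                locate i o with i ℕ.≟ w | i ℕ.≟ u | o ℕ.≟ a | o ℕ.≟ b
                ... | yes e | _ | yes f | _ = wa e f
                ... | yes e | _ | _ | yes f = wb e f
                ... | _ | yes e | yes f | _ = ua e f
                ... | _ | yes e | _ | yes f = ub e f
                ... | no ¬w | no ¬u | _ | _ = away (λ (e , _) → ¬w e) (λ (e , _) → ¬u e) (λ (e , _) → ¬w e) (λ (e , _) → ¬u e)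
                  where
                  away : ¬ (i ≡ w × o ≡ b) → ¬ (i ≡ u × o ≡ a) → ¬ (i ≡ w × o ≡ a) → ¬ (i ≡ u × o ≡ b) → Place i o
                  away p q r s = other (λ δ → R.rotate-other δ (λ (e , f) → p (e , ℕ.+-cancelˡ-≡ base o b f))
                    (λ (e , f) → q (e , ℕ.+-cancelˡ-≡ base o a f)) (λ (e , f) → r (e , ℕ.+-cancelˡ-≡ base o a f))
                    (λ (e , f) → s (e , ℕ.+-cancelˡ-≡ base o b f))) p q r s
                ... | _ | _ | no ¬a | no ¬b = away (λ (_ , e) → ¬b e) (λ (_ , e) → ¬a e) (λ (_ , e) → ¬a e) (λ (_ , e) → ¬b e)
                  where
                  away : ¬ (i ≡ w × o ≡ b) → ¬ (i ≡ u × o ≡ a) → ¬ (i ≡ w × o ≡ a) → ¬ (i ≡ u × o ≡ b) → Place i o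
                  away p q r s = other (λ δ → R.rotate-other δ (λ (e , f) → p (e , ℕ.+-cancelˡ-≡ base o b f))
                    (λ (e , f) → q (e , ℕ.+-cancelˡ-≡ base o a f)) (λ (e , f) → r (e , ℕ.+-cancelˡ-≡ base o a f))
                    (λ (e , f) → s (e , ℕ.+-cancelˡ-≡ base o b f))) p q r s

              rotate-new : X w (col b) ≤ X u (col a) →
                           Kept Seen Nowhere cur mark (rotate w (col b) u (col a) (X w (col b)) X)
              rotate-new le = record
                { cur-edge = cur-edge ; mark-edge = mark-edge
                ; nonNegative = R.rotate-nonNegative (nonNegative w (col b)) ≤-refl le nonNegative
                ; conserved = conserved′ δ
                ; covered = λ {i} {o} e s x → inj₁ (go (locate i o) e s x)
                ; old = old′ δ }
                where
                δ = X w (col b)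
                go : ∀ {i o} → Place i o → Edge i (col o) → Seen i o → X′ δ i (col o) ≢ 0# → Covered cur mark i o
                go (wb refl refl) e s x = ⊥-elim (x (cancelled (R.rotate-wb δ)))
                go (wa refl refl) e s x = inj₁ cw
                go (ua refl refl) e s x = inj₂ (a , b , mu , inj₁ refl)
                go (ub refl refl) e s x = inj₂ (a , b , mu , inj₂ refl)
                go (other same ¬wb _ _ _) e s x with covered e s (λ z → x (trans (same δ) z))
                ... | inj₁ c  = c
                ... | inj₂ at = ⊥-elim (¬wb at)

              rotate-parked : X u (col a) ≤ X w (col b) →
                              Kept Seen (At u b) cur′ mark′ (rotate w (col b) u (col a) (X u (col a)) X)
              rotate-parked le = record
                { cur-edge = cur′-edge ; mark-edge = mark′-edge
                ; nonNegative = R.rotate-nonNegative (nonNegative u (col a)) le ≤-refl nonNegative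
                ; conserved = conserved′ δ
                ; covered = λ {i} {o} e s x → go (locate i o) e s x
                ; old = old′ δ }
                where
                δ = X u (col a)
                go : ∀ {i o} → Place i o → Edge i (col o) → Seen i o → X′ δ i (col o) ≢ 0# →
                     Covered cur′ mark′ i o ⊎ At u b i o
                go (wb refl refl) e s x = inj₁ (parked (inj₂ refl))
                go (wa refl refl) e s x = inj₁ (parked (inj₁ refl))
                go (ua refl refl) e s x = ⊥-elim (x (cancelled (R.rotate-ua δ)))
                go (ub refl refl) e s x = inj₂ (refl , refl)
                go {i} {o} (other same ¬wb ¬ua ¬wa ¬ub) e s x with covered e s (λ z → x (trans (same δ) z))
                ... | inj₁ (inj₁ c) = inj₁ (inj₁ (trans (update-other {k = w} {i} {f = cur}
                      (λ { refl → ¬wa (refl , ℕ.suc-injective (trans (sym c) cw)) })) c))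
                ... | inj₁ (inj₂ (a′ , b′ , m , e′)) = inj₁ (inj₂ (a′ , b′ ,
                      trans (mark′-old λ { (refl , refl) → at-u (ℕ.suc-injective (trans (sym m) mu)) e′ }) m , e′))
                  where
                  at-u : i ≡ u → o ≡ a ⊎ o ≡ b → ⊥
                  at-u i≡u (inj₁ o≡a) = ¬ua (i≡u , o≡a)
                  at-u i≡u (inj₂ o≡b) = ¬ub (i≡u , o≡b)
                ... | inj₂ at = ⊥-elim (¬wb at)

  module Plans (𝓡 : Reals) (n : ℕ) where
    open RealFacts 𝓡

    record IsPlan (ρ : ℝ) (X : ℕ → ℕ → ℝ) : Set where
      field
        nonNegative : ∀ i j → i ℕ.< n → j ℕ.< n → 0# ≤ X i j
        rows        : ∀ i → i ℕ.< n → sumTo n (X i) ≡ ρ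
        columns     : ∀ j → j ℕ.< n → sumTo n (λ i → X i j) ≡ ρ

    private
      module S = Algebra.Properties.CommutativeMonoid.Sum +-commutativeMonoid

    ∑-sumTo : ∀ f → ∑ {n} (λ i → f (toℕ i)) ≡ sumTo n f
    ∑-sumTo f = sym (sumTo-def n f)

    ∑-cong : ∀ {f g : Fin n → ℝ} → (∀ i → f i ≡ g i) → ∑ f ≡ ∑ g
    ∑-cong = S.sum-cong-≗

    ∑-pairing : ∀ v X → ∑ {n} (λ i → ∑ {n} (λ j → v (toℕ i) (toℕ j) * X (toℕ i) (toℕ j))) ≡ pairing n v X
    ∑-pairing v X = trans (∑-cong (λ i → ∑-sumTo (λ j → v (toℕ i) j * X (toℕ i) j))) (∑-sumTo _)

  module Costs (𝓡 : Reals) (n : ℕ) (0<n : 0 ℕ.< n) (edge : ℕ → ℕ → ℕ)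
    (B : Reals.ℝ 𝓡) (0<B : Reals._<_ 𝓡 (Reals.0# 𝓡) B) where
    open RealFacts 𝓡

    ρ : ℝ
    ρ = fromℕ n ⁻¹

    C : ℕ → ℕ → ℝ
    C i j = if 0 <ᵇ edge i j then 0# else B

    0≤B : 0# ≤ B
    0≤B = proj₁ 0<B

    n≢0 : n ≢ 0
    n≢0 e = ℕ.<⇒≢ 0<n (sym e)

    n*ρ≡1 : fromℕ n * ρ ≡ 1#
    n*ρ≡1 = *-inverseʳ _ (fromℕ≢0 n≢0)

    0≤ρ : 0# ≤ ρ
    0≤ρ = ⁻¹-nonNegative (fromℕ-nonNegative n) (fromℕ≢0 n≢0)

    0≢ρ : 0# ≢ ρ
    0≢ρ e = 0≢1 (trans (sym (zeroʳ _)) (trans (cong (fromℕ n *_) e) n*ρ≡1))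

    C-nonNegative : ∀ i j → 0# ≤ C i j
    C-nonNegative i j with 0 <ᵇ edge i j
    ... | true  = ≤-refl
    ... | false = 0≤B

    C≤B : ∀ i j → C i j ≤ B
    C≤B i j with 0 <ᵇ edge i j
    ... | true  = 0≤B
    ... | false = ≤-refl

    C-edge : ∀ {i j} → edge i j ≢ 0 → C i j ≡ 0#
    C-edge {i} {j} ne with edge i j
    ... | zero  = ⊥-elim (ne refl)
    ... | suc _ = refl

    C-nonEdge : ∀ {i j} → edge i j ≡ 0 → C i j ≡ B
    C-nonEdge e rewrite e = refl

  module SetupRun (𝓡 : Reals) {n : ℕ} (O : OptimalTransport.Oracle 𝓡 n) (τ : ℕ) (0<n : 0 ℕ.< n)
    (edge : ℕ → ℕ → ℕ) (B ε : Reals.ℝ 𝓡) (0<B : Reals._<_ 𝓡 (Reals.0# 𝓡) B)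
    (isOracle : OptimalTransport.IsTransportOracle 𝓡 B ε O) where
    open RealRAM 𝓡
    open OptimalTransport 𝓡
    open Update 𝓡
    open Logic 𝓡 O τ
    open RealFacts 𝓡
    open Plans 𝓡 n
    open Tests hiding (drop≤)
    open Costs 𝓡 n 0<n edge B 0<B

    Answer : (ℕ → ℕ → ℝ) → Set
    Answer X = IsPlan ρ X × (∀ i j → 0# ≤ X i j) × (∀ Y → IsPlan ρ Y → pairing n C X ≤ pairing n C Y + ε)

    writeBlock-toℕ : ∀ {A : Set} (M : Fin n → Fin n → A) f i j → writeBlock M f (toℕ i) (toℕ j) ≡ M i j
    writeBlock-toℕ M f i j with toℕ i ℕ.<? n | toℕ j ℕ.<? n
    ... | yes p | yes q = cong₂ M (fromℕ<-toℕ i p) (fromℕ<-toℕ j q)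
    ... | no ¬p | _     = ⊥-elim (¬p (toℕ<n i))
    ... | yes _ | no ¬q = ⊥-elim (¬q (toℕ<n j))

    writeBlock-elim : ∀ {A : Set} (P : A → Set) (M : Fin n → Fin n → A) f → (∀ i j → P (M i j)) → (∀ i j → P (f i j)) →
                      ∀ i j → P (writeBlock M f i j)
    writeBlock-elim P M f inside outside i j with i ℕ.<? n | j ℕ.<? n
    ... | yes p | yes q = inside _ _
    ... | yes _ | no _  = outside i j
    ... | no _  | yes _ = outside i j
    ... | no _  | no _  = outside i j

    module _ {marginal cost X : ℕ → ℕ → ℝ} (marginal≡ : ∀ {k} → k ℕ.< n → marginal 0 k ≡ ρ)
             (cost≡ : ∀ {k} → k ℕ.< n → ∀ {j} → j ℕ.< n → cost k j ≡ C k j) (X≡0 : ∀ i j → X i j ≡ 0#) where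
      private
        r : Vector n
        r i = marginal 0 (toℕ i)
        C′ : Matrix n
        C′ = readBlock n cost
        r≡ : ∀ i → r i ≡ ρ
        r≡ i = marginal≡ (toℕ<n i)
        C′≡ : ∀ i j → C′ i j ≡ C (toℕ i) (toℕ j)
        C′≡ i j = cost≡ (toℕ<n i) (toℕ<n j)

        r∈Δ : InSimplex r
        r∈Δ = record
          { nonNegative = λ i → subst (0# ≤_) (sym (r≡ i)) 0≤ρ
          ; total = trans (∑-cong r≡) (trans (∑-sumTo (λ _ → ρ)) (trans (sumTo-const n ρ) n*ρ≡1))
          }

        isInstance : IsInstance r r C′
        isInstance = record
          { r∈Δ = r∈Δ ; c∈Δ = r∈Δ
          ; r-positive = λ i → subst (0# ≤_) (sym (r≡ i)) 0≤ρ , (λ e → 0≢ρ (trans e (r≡ i)))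
          ; c-positive = λ i → subst (0# ≤_) (sym (r≡ i)) 0≤ρ , (λ e → 0≢ρ (trans e (r≡ i)))
          ; C-nonNegative = λ i j → subst (0# ≤_) (sym (C′≡ i j)) (C-nonNegative _ _)
          }

        largest : ‖ C′ ‖∞≤ B
        largest with any? {n} (λ i → any? {n} (λ j → edge (toℕ i) (toℕ j) ℕ.≟ 0))
        ... | yes (i , j , e) = B , ((i , j , trans (C′≡ i j) (C-nonEdge e)) ,
                                     (λ i j → ≤-trans (≤-reflexive (C′≡ i j)) (C≤B _ _))) , ≤-refl
        ... | no all = 0# , ((o , o , zero′ o o) , (λ i j → ≤-reflexive (zero′ i j))) , 0≤B
          where
          o : Fin n
          o = fromℕ< 0<n
          zero′ : ∀ i j → C′ i j ≡ 0#
          zero′ i j = trans (C′≡ i j) (C-edge (λ e → all (i , j , e)))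

        X̂ : Matrix n
        X̂ = O r r C′
        solution = isOracle r r C′ isInstance largest
        module X̂ = _∈𝓤[_,_] (proj₁ solution)

        X′ : ℕ → ℕ → ℝ
        X′ = writeBlock X̂ X

        X′≡ : ∀ i j → X′ (toℕ i) (toℕ j) ≡ X̂ i j
        X′≡ = writeBlock-toℕ X̂ X

      answered : Answer (writeBlock X̂ X)
      answered = record
        { nonNegative = λ i j _ _ → 0≤X′ i j
        ; rows = λ i i<n → subst (λ i → sumTo n (X′ i) ≡ ρ) (toℕ-fromℕ< i<n) (row (fromℕ< i<n))
        ; columns = λ j j<n → subst (λ j → sumTo n (λ i → X′ i j) ≡ ρ) (toℕ-fromℕ< j<n) (col (fromℕ< j<n))
        } , 0≤X′ , optimal
        where
        0≤X′ : ∀ i j → 0# ≤ X′ i j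
        0≤X′ = writeBlock-elim (0# ≤_) X̂ X X̂.nonNegative (λ i j → ≤-reflexive (sym (X≡0 i j)))
        row : ∀ i → sumTo n (X′ (toℕ i)) ≡ ρ
        row i = trans (sym (∑-sumTo (X′ (toℕ i)))) (trans (∑-cong (X′≡ i)) (trans (X̂.rowSums i) (r≡ i)))
        col : ∀ j → sumTo n (λ i → X′ i (toℕ j)) ≡ ρ
        col j = trans (sym (∑-sumTo (λ i → X′ i (toℕ j)))) (trans (∑-cong (λ i → X′≡ i j)) (trans (X̂.columnSums j) (r≡ j)))
        optimal : ∀ Y → IsPlan ρ Y → pairing n C X′ ≤ pairing n C Y + ε
        optimal Y plan = subst₂ (λ x y → x ≤ y + ε)
          (trans (∑-cong (λ i → ∑-cong (λ j → cong₂ _*_ (C′≡ i j) (sym (X′≡ i j))))) (∑-pairing C X′))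
          (trans (∑-cong (λ i → ∑-cong (λ j → cong (_* Y (toℕ i) (toℕ j)) (C′≡ i j)))) (∑-pairing C Y))
          (≤-trans (proj₂ (proj₂ (proj₂ solution))) (+-monoˡ-≤ ε (proj₂ (proj₁ (proj₂ (proj₂ solution))) Y′ Y′∈𝓤)))
          where
          module Y = IsPlan plan
          Y′ : Matrix n
          Y′ = readBlock n Y
          Y′∈𝓤 : Y′ ∈𝓤[ r , r ]
          Y′∈𝓤 = record
            { nonNegative = λ i j → Y.nonNegative _ _ (toℕ<n i) (toℕ<n j)
            ; rowSums = λ i → trans (∑-sumTo (Y (toℕ i))) (trans (Y.rows _ (toℕ<n i)) (sym (r≡ i)))
            ; columnSums = λ j → trans (∑-sumTo (λ i → Y i (toℕ j))) (trans (Y.columns _ (toℕ<n j)) (sym (r≡ j)))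
            }

    Ready : Store → Set
    Ready s = natVar s nᵛ ≡ n × realVar s Bᵛ ≡ B × natArray s edgeᵃ ≡ edge × (∀ i j → realArray s planᵃ i j ≡ 0#)

    Counted : ℕ → Store → Set
    Counted i s = Ready s × realVar s ρᵛ ≡ fromℕ i

    Filled : ℕ → ℕ → Store → Set
    Filled m i s = Ready s × realVar s ρᵛ ≡ ρ × (∀ {k} → k ℕ.< m → realArray s marginalᵃ 0 k ≡ ρ) ×
      (∀ {k} → k ℕ.< i → ∀ {j} → j ℕ.< n → realArray s costᵃ k j ≡ C k j)

    Line : ℕ → ℕ → Store → Set
    Line i j s = natVar s iᵛ ≡ i × Filled (suc i) i s × (∀ {j′} → j′ ℕ.< j → realArray s costᵃ i j′ ≡ C i j′)

    setupCost : ℕ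
    setupCost = 1 ℕ.+ (forCost n 1 ℕ.+ (1 ℕ.+ (forCost n (1 ℕ.+ forCost n 2) ℕ.+ τ)))

    setup-ok : ∀ {s} → Ready s → Ends setup setupCost s
        (λ _ s′ → Answer (realArray s′ planᵃ))
    setup-ok {s} ready = andThen (ρᵛ ≔ᴿ zeroᴿ) (0# , refl ,
      (more (ℕ.≤-reflexive (cong (forCost n 1 ℕ.+_) (ℕ.+-identityʳ _)))
        (sound (for iᵛ (var nᵛ) increment) (forRule iᵛ (var nᵛ) increment n 1 (λ i _ → Counted i) (λ { _ _ _ ((n≡ , _) , _) → n≡ })
          (λ { i r y s i<n refl (ready , ρ≡) → sound increment (realVar s ρᵛ + 1# , refl , y , ℕ.≤-refl , refl , ready ,
            trans (cong (_+ 1#) ρ≡) (+-comm _ 1#)) }) {y = 0} (ready , refl)))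
      followedBy λ { {s = s} (y , le , ready , ρ≡) → more (ℕ.≤-trans (ℕ.m≤m+n _ y) le)
        (andThen (ρᵛ ≔ᴿ (oneᴿ ⊘ var ρᵛ)) (1# * realVar s ρᵛ ⁻¹ , refl ,
          (more (ℕ.≤-reflexive (cong (forCost n (1 ℕ.+ forCost n 2) ℕ.+_) (ℕ.+-identityʳ τ)))
            (sound (for iᵛ (var nᵛ) line) (forRule iᵛ (var nᵛ) line n (1 ℕ.+ forCost n 2) (λ i _ → Filled i i)
              (λ { _ _ _ ((n≡ , _) , _) → n≡ }) line-ok {τ} {0}
              (ready , trans (*-identityˡ _) (cong _⁻¹ ρ≡) , (λ ()) , (λ ()))))
          followedBy λ { {s = s} (y , le , (_ , _ , _ , plan≡) , _ , marginal≡ , cost≡) →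
            sound (transport marginalᵃ marginalᵃ costᵃ planᵃ)
              (y , le ,
                answered {realArray s marginalᵃ} {realArray s costᵃ} {realArray s planᵃ} marginal≡ cost≡ plan≡) }))) }))
      where
      increment cell line : Program
      increment = ρᵛ ≔ᴿ (var ρᵛ ⊕ oneᴿ)
      cell = cond (positive (edgeᵃ [ var iᵛ , var jᵛ ]))
           (costᵃ [ var iᵛ , var jᵛ ]≔ᴿ zeroᴿ)
           (costᵃ [ var iᵛ , var jᵛ ]≔ᴿ var Bᵛ)
      line = marginalᵃ [ lit 0 , var iᵛ ]≔ᴿ var ρᵛ ⨾ for jᵛ (var nᵛ) cell
      cell-ok : ∀ i j r y s → j ℕ.< n → natVar s jᵛ ≡ j → Line i j s → Ends cell (2 ℕ.+ (r ℕ.+ y)) s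
        (Advanced jᵛ j r (λ _ → Line i (suc j)))
      cell-ok i j r y s j<n refl (refl , ((n≡ , B≡ , edge≡ , plan≡) , ρ≡ , marginal≡ , above) , left) = sound cell
        ((λ present → i₀ , j₀ , 0# , refl , y , ℕ.≤-refl , refl , refl ,
            ((n≡ , B≡ , edge≡ , plan≡) , ρ≡ , marginal≡ , above′ 0#) ,
            left′ (sym (C-edge (subst (λ f → f i₀ j₀ ≢ 0) edge≡ (0<-true present))))) ,
         (λ absent → i₀ , j₀ , realVar s Bᵛ , refl , y , ℕ.≤-refl , refl , refl ,
            ((n≡ , B≡ , edge≡ , plan≡) , ρ≡ , marginal≡ , above′ (realVar s Bᵛ)) ,
            left′ (trans B≡ (sym (C-nonEdge (subst (λ f → f i₀ j₀ ≡ 0) edge≡ (0<-false absent)))))))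
        where
        i₀ = natVar s iᵛ
        j₀ = natVar s jᵛ
        cost = realArray s costᵃ
        above′ : ∀ x {k} → k ℕ.< i₀ → ∀ {j} → j ℕ.< n → update₂ i₀ j₀ x cost k j ≡ C k j
        above′ x {k} k<i {j} j<n = trans (update₂-other {k = i₀} {j₀} {k} {j} {f = cost} (λ (e , _) → ℕ.<⇒≢ k<i e)) (above k<i j<n)
        left′ : ∀ {x} → x ≡ C i₀ j₀ → ∀ {j} → j ℕ.< suc j₀ → update₂ i₀ j₀ x cost i₀ j ≡ C i₀ j
        left′ {x} e {j} j≤ = update₂-elim (_≡ C i₀ j) {i₀} {j₀} {i₀} {j} {f = cost}
          (λ { _ refl → e }) (λ ne → left (ℕ.≤∧≢⇒< (ℕ.≤-pred j≤) (λ e → ne (refl , e))))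
      line-ok : ∀ i r y s → i ℕ.< n → natVar s iᵛ ≡ i → Filled i i s → Ends line (1 ℕ.+ forCost n 2 ℕ.+ (r ℕ.+ y)) s
        (Advanced iᵛ i r (λ _ → Filled (suc i) (suc i)))
      line-ok i r y s i<n refl (ready , ρ≡ , marginal≡ , cost≡) =
        andThen (marginalᵃ [ lit 0 , var iᵛ ]≔ᴿ var ρᵛ) (0 , natVar s iᵛ , realVar s ρᵛ , refl ,
          weaken (λ { (y′ , le , i≡ , (ready , ρ≡ , marginal≡ , above) , left) → y′ , le , i≡ , ready , ρ≡ , marginal≡ ,
              (λ k≤i → next above left (ℕ.m≤n⇒m<n∨m≡n (ℕ.≤-pred k≤i))) })
            (sound (for jᵛ (var nᵛ) cell) (forRule jᵛ (var nᵛ) cell n 2 (λ j _ → Line (natVar s iᵛ) j)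
              (λ { _ _ _ (_ , ((n≡ , _) , _) , _) → n≡ }) (cell-ok (natVar s iᵛ))
              (refl , (ready , ρ≡ , update-upTo (λ _ x → x ≡ ρ) marginal≡ ρ≡ , cost≡) , (λ ())))))
        where
        next : ∀ {i} {cost : ℕ → ℕ → ℝ} → (∀ {k} → k ℕ.< i → ∀ {j} → j ℕ.< n → cost k j ≡ C k j) →
               (∀ {j} → j ℕ.< n → cost i j ≡ C i j) → ∀ {k} → k ℕ.< i ⊎ k ≡ i → ∀ {j} → j ℕ.< n → cost k j ≡ C k j
        next above left (inj₁ k<i)  = above k<i
        next above left (inj₂ refl) = left

  module Pairings (𝓡 : Reals) (n : ℕ) where
    open RealFacts 𝓡
    open Plans 𝓡 n

    pairing-mono : ∀ {v v′ X X′} → (∀ i j → i ℕ.< n → j ℕ.< n → v i j * X i j ≤ v′ i j * X′ i j) → pairing n v X ≤ pairing n v′ X′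
    pairing-mono le = sumTo-mono n (λ i i<n → sumTo-mono n (λ j j<n → le i j i<n j<n))

    pairing-+ : ∀ v v′ X → pairing n (λ i j → v i j + v′ i j) X ≡ pairing n v X + pairing n v′ X
    pairing-+ v v′ X = trans
      (sumTo-cong n (λ i _ → trans (sumTo-cong n (λ j _ → distribʳ (X i j) (v i j) (v′ i j)))
        (sumTo-∙ n (λ j → v i j * X i j) (λ j → v′ i j * X i j))))
      (sumTo-∙ n _ _)

    sumTo-*ʳ : ∀ c f → sumTo n (λ i → f i * c) ≡ sumTo n f * c
    sumTo-*ʳ c f = trans (sumTo-cong n (λ i _ → *-comm (f i) c)) (trans (sym (sumTo-*ˡ n c f)) (*-comm c _))

    module _ {ρ X} (plan : IsPlan ρ X) where
      open IsPlan plan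

      pairing-rows : ∀ f → pairing n (λ i _ → f i) X ≡ sumTo n f * ρ
      pairing-rows f = trans (sumTo-cong n (λ i i<n → trans (sym (sumTo-*ˡ n (f i) (X i))) (cong (f i *_) (rows i i<n))))
        (sumTo-*ʳ ρ f)

      pairing-columns : ∀ f → pairing n (λ _ j → f j) X ≡ sumTo n f * ρ
      pairing-columns f = trans (sumTo-comm n n (λ i j → f j * X i j))
        (trans (sumTo-cong n (λ j j<n → trans (sym (sumTo-*ˡ n (f j) (λ i → X i j))) (cong (f j *_) (columns j j<n))))
          (sumTo-*ʳ ρ f))

  module Deficit (𝓡 : Reals) (n : ℕ) (0<n : 0 ℕ.< n) (edge : ℕ → ℕ → ℕ)
    (bounded : ∀ {i j} → edge i j ≢ 0 → i ℕ.< n × j ℕ.< n)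
    (B ε : Reals.ℝ 𝓡) (0<B : Reals._<_ 𝓡 (Reals.0# 𝓡) B) where
    open RealFacts 𝓡
    open Plans 𝓡 n
    open Pairings 𝓡 n
    open Matchings
    open Costs 𝓡 n 0<n edge B 0<B
    module ℕS = ℕ-Sums
    open ℕS using (count; sign)
    open IsDecTotalOrder isDecTotalOrder using (_≟_)

    Edge : Graph
    Edge i j = edge i j ≢ 0

    -- A matching is extended to a plan by spreading the mass of its d
    -- unmatched left vertices evenly over its unmatched right vertices.
    module Extension {left right : ℕ → ℕ} (M : Matched Edge left right) where

      free : (ℕ → ℕ) → ℕ → ℕ
      free f i = 1 ∸ sign (f i)

      d : ℕ
      d = n ∸ count n left

      κ : ℝ
      κ = fromℕ d ⁻¹

      free+sign : ∀ f i → free f i ℕ.+ sign (f i) ≡ 1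
      free+sign f i = ℕ.m∸n+n≡m (ℕS.sign≤1 (f i))

      free-total : ∀ f → ℕS.sumTo n (free f) ≡ n ∸ count n f
      free-total f = trans (sym (ℕ.m+n∸n≡m _ (count n f))) (cong (_∸ count n f)
        (trans (sym (ℕS.sumTo-∙ n (free f) (λ i → sign (f i)))) (trans (ℕS.sumTo-cong n (λ i _ → free+sign f i))
          (trans (ℕS.sumTo-const n 1) (ℕ.*-identityʳ n)))))

      free-left : ℕS.sumTo n (free left) ≡ d
      free-left = free-total left

      free-right : ℕS.sumTo n (free right) ≡ d
      free-right = trans (free-total right) (cong (n ∸_) (sym (count-sides bounded M)))

      spread : ℕ → ℕ → ℝ
      spread i j = fromℕ (free left i) * (κ * fromℕ (free right j))

      Y : ℕ → ℕ → ℝ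
      Y i j = ρ * (fromℕ (ind left i j) + spread i j)

      d≢0 : ∀ f → ℕS.sumTo n (free f) ≡ d → ∀ {i} → i ℕ.< n → f i ≡ 0 → d ≢ 0
      d≢0 f total {i} i<n e d≡0 = ℕ.<⇒≱ (s≤s z≤n)
        (subst₂ ℕ._≤_ (cong (λ x → 1 ∸ sign x) e) (trans total d≡0) (ℕS.term≤sumTo i<n))

      0≤spread : ∀ i j → i ℕ.< n → 0# ≤ spread i j
      0≤spread i j i<n with left i in e
      ... | suc _ = ≤-reflexive (sym (zeroˡ _))
      ... | zero  = *-nonNegative (fromℕ-nonNegative 1) (*-nonNegative
        (⁻¹-nonNegative (fromℕ-nonNegative d) (fromℕ≢0 (d≢0 left free-left i<n e))) (fromℕ-nonNegative (free right j)))

      spread-row : ∀ i → i ℕ.< n → sumTo n (spread i) ≡ fromℕ (free left i)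
      spread-row i i<n = trans (sym (sumTo-*ˡ n (fromℕ (free left i)) (λ j → κ * fromℕ (free right j))))
        (trans (cong (fromℕ (free left i) *_) (trans (sym (sumTo-*ˡ n κ (λ j → fromℕ (free right j))))
          (cong (κ *_) (trans (sumTo-fromℕ n (free right)) (cong fromℕ free-right)))))
          (absorb (left i) refl))
        where
        absorb : ∀ x → left i ≡ x → fromℕ (free left i) * (κ * fromℕ d) ≡ fromℕ (free left i)
        absorb (suc _) e rewrite e = zeroˡ _
        absorb zero e = trans (cong (fromℕ (free left i) *_)
          (trans (*-comm κ (fromℕ d)) (*-inverseʳ _ (fromℕ≢0 (d≢0 left free-left i<n e))))) (*-identityʳ _)

      spread-column : ∀ j → j ℕ.< n → sumTo n (λ i → spread i j) ≡ fromℕ (free right j)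
      spread-column j j<n = trans (sumTo-*ʳ (κ * fromℕ (free right j)) (λ i → fromℕ (free left i)))
        (trans (cong (_* (κ * fromℕ (free right j))) (trans (sumTo-fromℕ n (free left)) (cong fromℕ free-left)))
          (absorb (right j) refl))
        where
        absorb : ∀ x → right j ≡ x → fromℕ d * (κ * fromℕ (free right j)) ≡ fromℕ (free right j)
        absorb (suc _) e rewrite e = trans (cong (fromℕ d *_) (zeroʳ κ)) (zeroʳ _)
        absorb zero e = trans (sym (*-assoc (fromℕ d) κ _)) (trans (cong (_* fromℕ (free right j))
          (*-inverseʳ _ (fromℕ≢0 (d≢0 right free-right j<n e)))) (*-identityˡ _))

      total-one : ∀ x → fromℕ (sign x) + fromℕ (1 ∸ sign x) ≡ 1#
      total-one zero    = trans (+-identityˡ _) fromℕ-1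
      total-one (suc _) = trans (+-identityʳ _) fromℕ-1

      isPlan : IsPlan ρ Y
      isPlan = record
        { nonNegative = λ i j i<n _ → *-nonNegative 0≤ρ (+-nonNegative (fromℕ-nonNegative (ind left i j)) (0≤spread i j i<n))
        ; rows = λ i i<n → trans (sym (sumTo-*ˡ n ρ _)) (trans (cong (ρ *_) (trans (sumTo-∙ n _ _)
            (trans (cong₂ _+_ (trans (sumTo-fromℕ n (ind left i)) (cong fromℕ (ind-row bounded M i))) (spread-row i i<n))
              (total-one (left i))))) (*-identityʳ ρ))
        ; columns = λ j j<n → trans (sym (sumTo-*ˡ n ρ _)) (trans (cong (ρ *_) (trans (sumTo-∙ n _ _)
            (trans (cong₂ _+_ (trans (sumTo-fromℕ n (λ i → ind left i j)) (cong fromℕ (ind-column bounded M j))) (spread-column j j<n))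
              (total-one (right j))))) (*-identityʳ ρ))
        }

      cost≤ : pairing n C Y ≤ B * (ρ * fromℕ d)
      cost≤ = ≤-trans (pairing-mono {v′ = λ _ _ → B} {X′ = λ i j → ρ * spread i j} (λ i j i<n _ → entry i j i<n))
        (≤-reflexive (begin
          pairing n (λ _ _ → B) (λ i j → ρ * spread i j)
            ≡⟨ sumTo-cong n (λ i i<n → trans (sym (sumTo-*ˡ n B _)) (cong (B *_) (trans (sym (sumTo-*ˡ n ρ _))
                 (cong (ρ *_) (spread-row i i<n))))) ⟩
          sumTo n (λ i → B * (ρ * fromℕ (free left i)))
            ≡⟨ trans (sym (sumTo-*ˡ n B _)) (cong (B *_) (sym (sumTo-*ˡ n ρ _))) ⟩
          B * (ρ * sumTo n (λ i → fromℕ (free left i)))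
            ≡⟨ cong (λ x → B * (ρ * x)) (trans (sumTo-fromℕ n (free left)) (cong fromℕ free-left)) ⟩
          B * (ρ * fromℕ d) ∎))
        where
        open ≡-Reasoning
        entry : ∀ i j → i ℕ.< n → C i j * Y i j ≤ B * (ρ * spread i j)
        entry i j i<n = ind-elim (λ x → C i j * (ρ * (fromℕ x + spread i j)) ≤ B * (ρ * spread i j)) left i j
          (λ e → subst (λ c → c * (ρ * (fromℕ 1 + spread i j)) ≤ B * (ρ * spread i j))
            (sym (C-edge (proj₂ (Matched.to M e))))
            (subst (_≤ B * (ρ * spread i j)) (sym (zeroˡ _)) (*-nonNegative 0≤B 0≤t)))
          (λ _ → subst (λ x → C i j * (ρ * x) ≤ B * (ρ * spread i j)) (sym (+-identityˡ _)) (*-monoʳ-≤ 0≤t (C≤B i j)))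
          where
          0≤t : 0# ≤ ρ * spread i j
          0≤t = *-nonNegative 0≤ρ (0≤spread i j i<n)

    module _ {X₀ X : ℕ → ℕ → ℝ} (plan : IsPlan ρ X₀)
             (optimal : ∀ Y → IsPlan ρ Y → pairing n C X₀ ≤ pairing n C Y + ε)
             (nonNegative : ∀ i j → 0# ≤ X i j) (conserved : ∀ v → Balanced 𝓡 Edge v → pairing n v X ≡ pairing n v X₀)
             {u p : ℕ → ℕ} (cover : ∀ {i j} → Edge i j → X i j ≢ 0# → 1 ℕ.≤ u i ℕ.+ p j)
             {z₁ z₂ : ℕ} (weight : ℕS.sumTo n u ℕ.+ ℕS.sumTo n p ℕ.≤ z₁)
             {left right : ℕ → ℕ} (M : Matched Edge left right) (size≡ : count n left ≡ z₂) where
      open Extension M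

      private
        w : ℕ → ℕ → ℝ
        w i j = B * fromℕ (u i) + B * fromℕ (p j) + C i j

        balanced : Balanced 𝓡 Edge w
        balanced {i} {i′} {j} {j′} e e′ f f′
          rewrite C-edge e | C-edge e′ | C-edge f | C-edge f′ =
          solve 5 (λ a b c d z → (a :+ c :+ z) :+ (b :+ d :+ z) := (a :+ d :+ z) :+ (b :+ c :+ z)) refl
            (B * fromℕ (u i)) (B * fromℕ (u i′)) (B * fromℕ (p j)) (B * fromℕ (p j′)) 0#

        0≤labels : ∀ i j → 0# ≤ B * fromℕ (u i) + B * fromℕ (p j)
        0≤labels i j = +-nonNegative (*-nonNegative 0≤B (fromℕ-nonNegative (u i))) (*-nonNegative 0≤B (fromℕ-nonNegative (p j)))

        entry : ∀ i j → B * X i j ≤ w i j * X i j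
        entry i j with edge i j ℕ.≟ 0 | X i j ≟ 0#
        ... | _ | yes X≡0 = ≤-reflexive (trans (cong (B *_) X≡0) (trans (zeroʳ B) (sym (trans (cong (w i j *_) X≡0) (zeroʳ _)))))
        ... | yes none | no _ = *-monoʳ-≤ (nonNegative i j) (subst (_≤ w i j) (+-identityˡ B)
          (+-mono-≤ (0≤labels i j) (≤-reflexive (sym (C-nonEdge none)))))
        ... | no e | no X≢0 = *-monoʳ-≤ (nonNegative i j) (≤-trans (≤-trans
          (≤-reflexive (trans (sym (*-identityʳ B)) (cong (B *_) (sym fromℕ-1))))
          (≤-trans (*-monoˡ-≤ 0≤B (fromℕ-mono (cover e X≢0)))
            (≤-reflexive (trans (cong (B *_) (fromℕ-+ (u i) (p j))) (distribˡ B _ _)))))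
          (x≤x+y (C-nonNegative i j)))

        pairing-B : pairing n (λ _ _ → B) X₀ ≡ B
        pairing-B = trans (pairing-rows plan (λ _ → B)) (trans (cong (_* ρ) (sumTo-const n B))
          (trans (solve 3 (λ n b r → n :* b :* r := b :* (n :* r)) refl (fromℕ n) B ρ)
            (trans (cong (B *_) n*ρ≡1) (*-identityʳ B))))

        pairing-labels : ∀ f → sumTo n (λ i → B * fromℕ (f i)) * ρ ≡ B * (ρ * fromℕ (ℕS.sumTo n f))
        pairing-labels f = trans (cong (_* ρ) (trans (sym (sumTo-*ˡ n B _)) (cong (B *_) (sumTo-fromℕ n f))))
          (solve 3 (λ b s r → b :* s :* r := b :* (r :* s)) refl B (fromℕ (ℕS.sumTo n f)) ρ)

        pairing-w : pairing n w X₀ ≡ B * (ρ * fromℕ (ℕS.sumTo n u ℕ.+ ℕS.sumTo n p)) + pairing n C X₀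
        pairing-w = begin
          pairing n w X₀
            ≡⟨ pairing-+ (λ i j → B * fromℕ (u i) + B * fromℕ (p j)) C X₀ ⟩
          pairing n (λ i j → B * fromℕ (u i) + B * fromℕ (p j)) X₀ + pairing n C X₀
            ≡⟨ cong (_+ pairing n C X₀) (trans (pairing-+ (λ i _ → B * fromℕ (u i)) (λ _ j → B * fromℕ (p j)) X₀)
                 (cong₂ _+_ (trans (pairing-rows plan _) (pairing-labels u)) (trans (pairing-columns plan _) (pairing-labels p)))) ⟩
          B * (ρ * fromℕ (ℕS.sumTo n u)) + B * (ρ * fromℕ (ℕS.sumTo n p)) + pairing n C X₀
            ≡⟨ cong (_+ pairing n C X₀) (trans (solve 4 (λ b r x y → b :* (r :* x) :+ b :* (r :* y) := b :* (r :* (x :+ y))) refl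
                 B ρ (fromℕ (ℕS.sumTo n u)) (fromℕ (ℕS.sumTo n p)))
                 (cong (λ x → B * (ρ * x)) (sym (fromℕ-+ (ℕS.sumTo n u) (ℕS.sumTo n p))))) ⟩
          B * (ρ * fromℕ (ℕS.sumTo n u ℕ.+ ℕS.sumTo n p)) + pairing n C X₀ ∎
          where open ≡-Reasoning

        B≤ : B ≤ B * (ρ * fromℕ z₁) + (B * (ρ * fromℕ d) + ε)
        B≤ = ≤-trans (≤-reflexive (sym (trans (conserved (λ _ _ → B) (λ _ _ _ _ → refl)) pairing-B)))
          (≤-trans (pairing-mono {v = λ _ _ → B} {v′ = w} (λ i j _ _ → entry i j))
          (≤-trans (≤-reflexive (trans (conserved w balanced) pairing-w))
          (+-mono-≤ (*-monoˡ-≤ 0≤B (*-monoˡ-≤ 0≤ρ (fromℕ-mono weight)))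
                    (≤-trans (optimal Y isPlan) (+-monoˡ-≤ ε cost≤)))))

      deficit : B * fromℕ z₂ ≤ B * fromℕ z₁ + fromℕ n * ε
      deficit = +-cancelʳ-≤ (B * fromℕ d) (subst₂ _≤_ lhs rhs (*-monoˡ-≤ (fromℕ-nonNegative n) B≤))
        where
        z₂≤n : z₂ ℕ.≤ n
        z₂≤n = subst (ℕ._≤ n) size≡ (ℕS.count≤ n left)
        lhs : fromℕ n * B ≡ B * fromℕ z₂ + B * fromℕ d
        lhs = trans (*-comm (fromℕ n) B) (trans (cong (B *_) (trans
          (cong fromℕ (sym (trans (cong (λ x → z₂ ℕ.+ (n ∸ x)) size≡) (ℕ.m+[n∸m]≡n z₂≤n)))) (fromℕ-+ z₂ d))) (distribˡ B _ _))
        rhs : fromℕ n * (B * (ρ * fromℕ z₁) + (B * (ρ * fromℕ d) + ε)) ≡ B * fromℕ z₁ + fromℕ n * ε + B * fromℕ d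
        rhs = trans (solve 6 (λ n b r z d e → n :* (b :* (r :* z) :+ (b :* (r :* d) :+ e)) :=
                 (n :* r) :* (b :* z) :+ n :* e :+ (n :* r) :* (b :* d)) refl (fromℕ n) B ρ (fromℕ z₁) (fromℕ d) ε)
          (trans (cong (λ x → x * (B * fromℕ z₁) + fromℕ n * ε + x * (B * fromℕ d)) n*ρ≡1)
            (cong₂ (λ x y → x + fromℕ n * ε + y) (*-identityˡ _) (*-identityˡ _)))

module Combined where
  open import Data.Nat using (_+_; _*_; _≤_; _<_)
  open import Data.Nat.Properties
  open Combinatorial
  open Continuous
  open Names

  module InsertRun (𝓡 : Reals) {size : ℕ} (O : OptimalTransport.Oracle 𝓡 size) (τ : ℕ)
    (n h : ℕ) (Edge : Graph) (bounded : ∀ {i j} → Edge i j → i < n × j < n)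
    (X₀ : ℕ → ℕ → Reals.ℝ 𝓡) (Old : Graph) where
    open RealRAM 𝓡
    open Update 𝓡
    open Logic 𝓡 O τ
    open Matchings using (suc-∸1)
    open ℕ-Sums using (count)
    open Tests
    module R = RealFacts 𝓡
    module Inv (bs : ℕ) = SparsifyInvariant 𝓡 n Edge bounded h bs X₀ Old

    KeptAt : (Seen Hand : Graph) → Store → Set
    KeptAt Seen Hand s = Inv.Kept (natVar s baseᵛ) Seen Hand (natArray s curᵃ 0) (natArray s markᵃ) (realArray s planᵃ)

    At : ℕ → ℕ → Graph
    At w b i o = i ≡ w × o ≡ b

    Nowhere : Graph
    Nowhere _ _ = ⊥

    -- A round that does not end the insertion makes a loose entry parked, so the
    -- rounds are paid for by 16 units of time saved on every loose entry.
    Inserting : Graph → ℕ → Assertion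
    Inserting Seen r k s = natVar s jᵛ < h ×
      ((natVar s handᵛ ≢ 0 × Edge (natVar s rowᵛ) (natVar s baseᵛ + natVar s jᵛ) ×
        KeptAt Seen (At (natVar s rowᵛ) (natVar s jᵛ)) s ×
        ∃[ z ] count n (natArray s curᵃ 0) ≡ z × suc (suc z * 16 + (16 + r)) ≡ k) ⊎
       (natVar s handᵛ ≡ 0 × KeptAt Seen Nowhere s × suc (count n (natArray s curᵃ 0) * 16 + r) ≤ k))

    insertStep-ok : ∀ Seen r k s → Inserting Seen r k s → (0 <ᵇ natVar s handᵛ) ≡ true →
                    spend (λ k → Ends insertStep k s (↓ (Inserting Seen r))) k
    insertStep-ok Seen r k s (_ , inj₂ (hand≡0 , _)) test = ⊥-elim (0<-true test hand≡0)
    insertStep-ok Seen r k s (b<h , inj₁ (hand≢0 , edge , K , z , count≡ , refl)) test = sound insertStep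
      ( cur w , refl , mark a b , refl
      , (λ col → let cw≢0 = 0<-true col in
          (λ other → let taken = 0<-true other in
            (λ same → 0 , refl , _ , cheap 10 , b<h ,
               inj₂ (refl , I.drop-same-column K b<h edge cw≢0 taken (==-true same) , counted)) ,
            (λ b≢ →
              (λ same → 0 , refl , _ , cheap 9 , b<h ,
                 inj₂ (refl , I.drop-same-row K b<h edge cw≢0 taken (==-true same) , counted)) ,
              (λ u≢ →
                (λ le → let δ = X w (bs + b) in
                  δ , refl , w , bs + a , X w (bs + a) R.+ δ , refl , u , bs + b , X₁ δ u (bs + b) R.+ δ , refl ,
                  w , bs + b , X₂ δ w (bs + b) R.- δ , refl , u , bs + a , X₃ δ u (bs + a) R.- δ , refl ,
                  0 , refl , _ , cheap 3 , b<h ,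
                  inj₂ (refl , I.rotate-new K b<h edge cw≢0 taken (==-false b≢) (==-false u≢) (does-true (_ R.≤? _) le) ,
                        counted)) ,
                (λ gt → let δ = X u (bs + a) in
                  δ , refl , w , bs + a , X w (bs + a) R.+ δ , refl , u , bs + b , X₁ δ u (bs + b) R.+ δ , refl ,
                  w , bs + b , X₂ δ w (bs + b) R.- δ , refl , u , bs + a , X₃ δ u (bs + a) R.- δ , refl ,
                  a , b , suc w , refl , 0 , w , 0 , refl , u , refl ,
                  _ , drop≤ 0 , b<h , inj₁ (hand≢0 , I.edge-ub K b<h edge cw≢0 taken ,
                    I.rotate-parked K b<h edge cw≢0 taken (==-false b≢) (==-false u≢) (smaller (does-false (_ R.≤? _) gt)) ,
                    _ , refl , continued cw≢0))))) ,
          (λ free → a , b , suc w , refl , 0 , w , 0 , refl , 0 , refl , _ , parkCost cw≢0 , b<h ,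
            inj₂ (refl , I.park K b<h edge cw≢0 (0<-false free) , ≤-refl))) ,
        (λ loose → 0 , w , suc b , refl , 0 , refl , _ , drop≤ 10 , b<h ,
          inj₂ (refl , I.place K b<h edge (0<-false loose) , ≤-reflexive (cong suc (placeCost (0<-false loose)))))
      )
      where
      bs w b : ℕ
      bs = natVar s baseᵛ
      w = natVar s rowᵛ
      b = natVar s jᵛ
      module I = Inv bs
      cur : ℕ → ℕ
      cur = natArray s curᵃ 0
      mark : ℕ → ℕ → ℕ
      mark = natArray s markᵃ
      X : ℕ → ℕ → R.ℝ
      X = realArray s planᵃ
      a u : ℕ
      a = cur w ∸ 1
      u = mark a b ∸ 1
      X₁ X₂ X₃ : R.ℝ → ℕ → ℕ → R.ℝ
      X₁ δ = R.shift w (bs + a) δ X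
      X₂ δ = R.shift u (bs + b) δ (X₁ δ)
      X₃ δ = R.shift w (bs + b) (R.- δ) (X₂ δ)
      cheap : ∀ j → z * 16 + (16 + r) ≤ j + (z * 16 + (16 + r))
      cheap j = drop≤ j
      counted : suc (count n cur * 16 + r) ≤ z * 16 + (16 + r)
      counted rewrite count≡ = ≤-trans (m≤n+m _ 15) (≤-reflexive (sixteen (z * 16) r))
        where
        sixteen : ∀ x r → 16 + (x + r) ≡ x + (16 + r)
        sixteen = solve-∀
      smaller : ¬ (X w (bs + b) R.≤ X u (bs + a)) → X u (bs + a) R.≤ X w (bs + b)
      smaller gt with R.total (X w (bs + b)) (X u (bs + a))
      ... | inj₁ le = ⊥-elim (gt le)
      ... | inj₂ le = le
      placeCost : cur w ≡ 0 → count n (update w (suc b) cur) * 16 + r ≡ z * 16 + (16 + r)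
      placeCost cw rewrite I.count-place K b<h edge cw | count≡ = sixteen (z * 16) r
        where
        sixteen : ∀ x r → 16 + x + r ≡ x + (16 + r)
        sixteen = solve-∀
      parkCost : cur w ≢ 0 → suc (count n (update w 0 cur) * 16 + r) ≤ 9 + (z * 16 + (16 + r))
      parkCost cw = ≤-trans (s≤s (+-monoˡ-≤ r (*-monoˡ-≤ 16 (≤-trans (n≤1+n _) (≤-reflexive (trans (sym (I.count-park K b<h edge cw)) count≡))))))
        (≤-trans (m≤n+m _ 24) (≤-reflexive (sixteen (z * 16) r)))
        where
        sixteen : ∀ x r → 25 + (x + r) ≡ 9 + (x + (16 + r))
        sixteen = solve-∀
      continued : cur w ≢ 0 → suc (suc (count n (update w 0 cur)) * 16 + (16 + r)) ≡ suc (z * 16 + (16 + r))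
      continued cw = cong (λ z → suc (z * 16 + (16 + r))) (trans (sym (I.count-park K b<h edge cw)) count≡)

  module ThinRun (𝓡 : Reals) {size : ℕ} (O : OptimalTransport.Oracle 𝓡 size) (τ : ℕ)
    (n h : ℕ) (edge : ℕ → ℕ → ℕ) (bounded : ∀ {i j} → edge i j ≢ 0 → i < n × j < n)
    (X₀ : ℕ → ℕ → Reals.ℝ 𝓡) (Old : Graph) where
    open RealRAM 𝓡
    open Update 𝓡
    open Logic 𝓡 O τ
    open ℕ-Sums using (count)
    open Tests
    open InsertRun 𝓡 O τ n h (λ i j → edge i j ≢ 0) bounded X₀ Old public

    Context : Store → Set
    Context s = natVar s nᵛ ≡ n × natVar s hᵛ ≡ h × natArray s edgeᵃ ≡ edge

    Before : ℕ → ℕ → Graph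
    Before j i i′ o = o < j ⊎ (o ≡ j × i′ < i)

    Rows : ℕ → ℕ → ℕ → Store → Set
    Rows j i y s = Context s × natVar s jᵛ ≡ j × KeptAt (Before j i) Nowhere s ×
                   y ≡ count n (natArray s curᵃ 0) * 16

    Columns : ℕ → ℕ → Store → Set
    Columns j y s = Context s × KeptAt (λ _ o → o < j) Nowhere s × y ≡ count n (natArray s curᵃ 0) * 16

    entry : Program
    entry = cond (positive (edgeᵃ [ var iᵛ , column (var jᵛ) ])) (rowᵛ ≔ᴺ (var iᵛ) ⨾ insert) skip

    entry-ok : ∀ j → j < h → ∀ i r y s → i < n → natVar s iᵛ ≡ i → Rows j i y s →
      Ends entry (36 + (r + y)) s (Advanced iᵛ i r (Rows j (suc i)))
    entry-ok j j<h i r y s i<n refl ((n≡ , h≡ , edge≡) , refl , K , refl) = sound entry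
      ((λ present → i , refl , 1 , refl , more (≤-reflexive (credit z r))
          (weaken (λ { {k} {s′} ((K′ , le) , frame) →
              count n (natArray s′ curᵃ 0) * 16 , ≤-trans (≤-reflexive (+-comm r _)) le , frame (natVarᴸ iᵛ) refl ,
              (trans (frame (natVarᴸ nᵛ) refl) n≡ , trans (frame (natVarᴸ hᵛ) refl) h≡ ,
               trans (frame (natArrayᴸ edgeᵃ) refl) edge≡) ,
              frame (natVarᴸ jᵛ) refl , K′ , refl })
            (framed (loop (positive (var handᵛ)) insertStep (Inserting (Before j (suc i)) r)
              (insertStep-ok (Before j (suc i)) r) stop
              (j<h , inj₁ ((λ ()) , subst (λ f → f i (bs + j) ≢ 0) edge≡ (0<-true present) ,
                Inv.take bs split K , z , refl , refl)))))) ,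
       (λ absent → z * 16 , drop≤ 34 , refl , (n≡ , h≡ , edge≡) , refl ,
          Inv.reSeen bs (λ e seen → skipped absent e seen) K , refl))
      where
      bs = natVar s baseᵛ
      z = count n (natArray s curᵃ 0)
      credit : ∀ z r → suc (suc z * 16 + (16 + r)) ≡ 33 + (r + z * 16)
      credit = solve-∀
      split : ∀ {i′ o} → Before j (suc i) i′ o → Before j i i′ o ⊎ (i′ ≡ i × o ≡ j)
      split (inj₁ o<j) = inj₁ (inj₁ o<j)
      split (inj₂ (o≡j , i′≤i)) with m≤n⇒m<n∨m≡n (≤-pred i′≤i)
      ... | inj₁ i′<i = inj₁ (inj₂ (o≡j , i′<i))
      ... | inj₂ i′≡i = inj₂ (i′≡i , o≡j)
      skipped : (0 <ᵇ natArray s edgeᵃ i (bs + j)) ≡ false → ∀ {i′ o} → edge i′ (bs + o) ≢ 0 →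
                Before j (suc i) i′ o → Before j i i′ o
      skipped absent e seen with split seen
      ... | inj₁ before        = before
      ... | inj₂ (refl , refl) = ⊥-elim (e (trans (sym (cong (λ f → f i (bs + j)) edge≡)) (0<-false absent)))
      stop : ∀ k s → Inserting (Before j (suc i)) r k s → (0 <ᵇ natVar s handᵛ) ≡ false →
             spend (λ k → KeptAt (Before j (suc i)) Nowhere s × count n (natArray s curᵃ 0) * 16 + r ≤ k) k
      stop k s (_ , inj₁ (hand≢0 , _)) test = ⊥-elim (hand≢0 (0<-false test))
      stop (suc k) s (_ , inj₂ (_ , K , s≤s le)) test = K , le

    columns-ok : ∀ j r y s → j < h → natVar s jᵛ ≡ j → Columns j y s →
      Ends (for iᵛ (var nᵛ) entry) (forCost n 36 + (r + y)) s
        (Advanced jᵛ j r (Columns (suc j)))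
    columns-ok j r y s j<h j≡ (ctx , K , y≡) =
      weaken (λ { {s = s} (y′ , le , ctx , j≡ , K , y≡) → y′ , le , j≡ , ctx ,
          Inv.reSeen (natVar s baseᵛ) (λ e o≤j → finished e (m≤n⇒m<n∨m≡n (≤-pred o≤j))) K , y≡ })
        (sound (for iᵛ (var nᵛ) entry) (forRule iᵛ (var nᵛ) entry n 36 (Rows j) (λ { _ _ _ ((n≡ , _) , _) → n≡ })
          (entry-ok j j<h) (ctx , j≡ , Inv.reSeen (natVar s baseᵛ) (λ { _ (inj₁ o<j) → o<j ; _ (inj₂ (_ , ())) }) K , y≡)))
      where
      finished : ∀ {i o bs} → edge i (bs + o) ≢ 0 → o < j ⊎ o ≡ j → Before j n i o
      finished e (inj₁ o<j) = inj₁ o<j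
      finished e (inj₂ o≡j) = inj₂ (o≡j , proj₁ (bounded e))

    thin-ok : ∀ {r s} → Context s → KeptAt (λ _ _ → ⊥) Nowhere s → count n (natArray s curᵃ 0) ≡ 0 →
      Ends thin (forCost h (forCost n 36) + r) s
        (λ k s′ → r ≤ k × KeptAt (λ _ o → o < h) Nowhere s′)
    thin-ok {r} {s} ctx K empty = more (≤-reflexive (cong (forCost h (forCost n 36) +_) (+-identityʳ r)))
      (weaken (λ { (y , le , _ , K , _) → ≤-trans (m≤m+n r y) le , K })
        (sound thin (forRule jᵛ (var hᵛ) (for iᵛ (var nᵛ) entry) h (forCost n 36) Columns
          (λ { _ _ _ ((_ , h≡ , _) , _) → h≡ }) columns-ok {r} {0}
          (ctx , Inv.reSeen (natVar s baseᵛ) (λ _ ()) K , sym (cong (_* 16) empty)))))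

  module ClearRun (𝓡 : Reals) {size : ℕ} (O : OptimalTransport.Oracle 𝓡 size) (τ n h : ℕ) where
    open RealRAM 𝓡
    open Update 𝓡
    open Logic 𝓡 O τ
    open Tests

    Tidy : (ℕ → ℕ) → (ℕ → ℕ → ℕ) → Set
    Tidy cur mark = (∀ {k} → n ≤ k → cur k ≡ 0) × (∀ {a b} → mark a b ≢ 0 → a < h × b < h)

    TidyAt : Store → Set
    TidyAt s = natVar s nᵛ ≡ n × natVar s hᵛ ≡ h × Tidy (natArray s curᵃ 0) (natArray s markᵃ)

    Rows : ℕ → Store → Set
    Rows i s = TidyAt s × (∀ {k} → k < i → natArray s curᵃ 0 k ≡ 0)

    Marks : ℕ → Store → Set
    Marks a s = TidyAt s × (∀ {k} → k < n → natArray s curᵃ 0 k ≡ 0) × (∀ {a′} → a′ < a → ∀ b → natArray s markᵃ a′ b ≡ 0)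

    MarkRow : ℕ → ℕ → Store → Set
    MarkRow a b s = natVar s iᵛ ≡ a × Marks a s × (∀ {b′} → b′ < b → natArray s markᵃ a b′ ≡ 0)

    clear-ok : ∀ {r s} → TidyAt s →
      Ends clear (forCost n 1 + (forCost h (forCost h 1) + r)) s
        (λ k s′ → r ≤ k × (∀ i → natArray s′ curᵃ 0 i ≡ 0) × (∀ a b → natArray s′ markᵃ a b ≡ 0))
    clear-ok {r} {s} tidy =
      more (≤-reflexive (cong (forCost n 1 +_) (+-identityʳ _)))
        (sound (for iᵛ (var nᵛ) (curᵃ ⟨ var iᵛ ⟩≔ lit 0))
          (forRule iᵛ (var nᵛ) (curᵃ ⟨ var iᵛ ⟩≔ lit 0) n 1 (λ i _ → Rows i) (λ { _ _ _ ((n≡ , _) , _) → n≡ }) row {y = 0}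
            (tidy , (λ ()))))
      followedBy λ (y , le , tidy , rows) → more (≤-trans (≤-reflexive (cong (forCost h (forCost h 1) +_) (+-identityʳ r)))
          (≤-trans (m≤m+n _ y) le))
        (weaken (λ { {s = s} (y , le , final) → ≤-trans (m≤m+n r y) le , finish {s} final })
          (sound (for iᵛ (var hᵛ) (for jᵛ (var hᵛ) mark)) (forRule iᵛ (var hᵛ) (for jᵛ (var hᵛ) mark) h (forCost h 1)
            (λ a _ → Marks a) (λ { _ _ _ ((_ , h≡ , _) , _) → h≡ }) markRow {r} {0} (tidy , rows , (λ ())))))
      where
      mark : Program
      mark = markᵃ [ var iᵛ , var jᵛ ]≔ᴺ lit 0
      row : ∀ i r y s → i < n → natVar s iᵛ ≡ i → Rows i s → Ends (curᵃ ⟨ var iᵛ ⟩≔ lit 0) (1 + (r + y)) s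
        (Advanced iᵛ i r (λ _ → Rows (suc i)))
      row i r y s i<n refl ((n≡ , h≡ , outside , marks) , below) = sound (curᵃ ⟨ var iᵛ ⟩≔ lit 0)
        (0 , natVar s iᵛ , 0 , refl , y , ≤-refl , refl ,
         (n≡ , h≡ , (λ {k} n≤k → update-elim (_≡ 0) {natVar s iᵛ} {k} {f = natArray s curᵃ 0} (λ _ → refl) (λ _ → outside n≤k)) ,
          marks) ,
         update-upTo (λ _ x → x ≡ 0) below refl)
      entry : ∀ a → ∀ b r y s → b < h → natVar s jᵛ ≡ b → MarkRow a b s → Ends mark (1 + (r + y)) s
        (Advanced jᵛ b r (λ _ → MarkRow a (suc b)))
      entry a b r y s b<h refl (refl , ((n≡ , h≡ , outside , marks) , rows , above) , left) = sound mark
        (a₀ , b₀ , 0 , refl , y , ≤-refl , refl , refl ,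
         ((n≡ , h≡ , outside ,
           (λ {a′} {b′} → update₂-elim (λ x → x ≢ 0 → a′ < h × b′ < h) {a₀} {b₀} {a′} {b′} {f = M}
             (λ _ _ ne → ⊥-elim (ne refl)) (λ _ → marks))) ,
          rows ,
          (λ {a′} a′<a b′ → update₂-elim (_≡ 0) {a₀} {b₀} {a′} {b′} {f = M} (λ _ _ → refl) (λ _ → above a′<a b′))) ,
         (λ {b′} b′≤b → update₂-elim (_≡ 0) {a₀} {b₀} {a₀} {b′} {f = M} (λ _ _ → refl)
           (λ ne → left (≤∧≢⇒< (≤-pred b′≤b) (λ e → ne (refl , e))))))
        where
        a₀ = natVar s iᵛ
        b₀ = natVar s jᵛ
        M = natArray s markᵃ
      markRow : ∀ a r y s → a < h → natVar s iᵛ ≡ a → Marks a s → Ends (for jᵛ (var hᵛ) mark) (forCost h 1 + (r + y)) s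
        (Advanced iᵛ a r (λ _ → Marks (suc a)))
      markRow a r y s a<h a≡ (tidy , rows , above) =
        weaken (λ { (y′ , le , a≡ , (tidy , rows , above) , left) → y′ , le , a≡ , tidy , rows ,
            (λ a′≤a b′ → next tidy above left (m≤n⇒m<n∨m≡n (≤-pred a′≤a)) b′) })
          (sound (for jᵛ (var hᵛ) mark) (forRule jᵛ (var hᵛ) mark h 1 (λ b _ → MarkRow a b)
            (λ { _ _ _ (_ , ((_ , h≡ , _) , _) , _) → h≡ }) (entry a) (a≡ , (tidy , rows , above) , (λ ()))))
        where
        next : ∀ {n′ h′ cur M} → n′ ≡ n × h′ ≡ h × Tidy cur M → (∀ {a′} → a′ < a → ∀ b → M a′ b ≡ 0) →
               (∀ {b′} → b′ < h → M a b′ ≡ 0) → ∀ {a′} → a′ < a ⊎ a′ ≡ a → ∀ b′ → M a′ b′ ≡ 0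
        next _ above left (inj₁ a′<a) b′ = above a′<a b′
        next {M = M} (_ , _ , _ , marks) above left (inj₂ refl) b′ with M a b′ ≟ 0
        ... | yes e = e
        ... | no ne = left (proj₂ (marks ne))
      finish : ∀ {s} → Marks h s → (∀ i → natArray s curᵃ 0 i ≡ 0) × (∀ a b → natArray s markᵃ a b ≡ 0)
      finish {s} ((_ , _ , outside , marks) , rows , above) = cur0 , mark0
        where
        cur0 : ∀ i → natArray s curᵃ 0 i ≡ 0
        cur0 i with n ≤? i
        ... | yes n≤i = outside n≤i
        ... | no n≰i  = rows (≰⇒> n≰i)
        mark0 : ∀ a b → natArray s markᵃ a b ≡ 0
        mark0 a b with natArray s markᵃ a b ≟ 0
        ... | yes e = e
        ... | no ne = above (proj₁ (marks ne)) b

  module HarvestRun (𝓡 : Reals) {size : ℕ} (O : OptimalTransport.Oracle 𝓡 size) (τ n h : ℕ)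
    (Edge : Graph) (bounded : ∀ {i j} → Edge i j → i < n × j < n) (Old : Graph) where
    open RealRAM 𝓡
    open Update 𝓡
    open Logic 𝓡 O τ
    open Matchings using (suc-∸1)
    open ℕ-Sums using (sumTo)
    open Tests

    record Harvest (D n′ h′ bs : ℕ) (cur : ℕ → ℕ) (mark : ℕ → ℕ → ℕ) (deg : ℕ → ℕ) (adj : ℕ → ℕ → ℕ) : Set where
      constructor harvesting
      field
        n≡        : n′ ≡ n
        h≡        : h′ ≡ h
        cur-edge  : ∀ {i o} → cur i ≡ suc o → Edge i (bs + o)
        mark-edge : ∀ {a b u} → mark a b ≡ suc u → a < h × b < h × Edge u (bs + a) × Edge u (bs + b)
        old       : ∀ {i j} → Old i j → Adjacent deg adj i j
        correct   : ∀ {i j} → Adjacent deg adj i j → Edge i j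
        small     : sumTo n deg ≤ D

    HarvestAt : ℕ → Store → Set
    HarvestAt D s = Harvest D (natVar s nᵛ) (natVar s hᵛ) (natVar s baseᵛ) (natArray s curᵃ 0) (natArray s markᵃ)
                            (natArray s degᵃ 0) (natArray s adjᵃ)

    grow : ∀ {D D′ n′ h′ bs cur mark deg adj} → D ≤ D′ → Harvest D n′ h′ bs cur mark deg adj → Harvest D′ n′ h′ bs cur mark deg adj
    grow le H = record { Harvest H ; small = ≤-trans (Harvest.small H) le }

    appended : ∀ {D n′ h′ bs cur mark deg adj i j} → Edge i j → Harvest D n′ h′ bs cur mark deg adj →
      Harvest (suc D) n′ h′ bs cur mark (Append.deg⁺ 𝓡 deg adj i j) (Append.adj⁺ 𝓡 deg adj i j)
    appended {deg = deg} {adj} {i} {j} edge H = record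
      { Harvest H
      ; old = λ o → A.append-old (Harvest.old H o)
      ; correct = λ a → correct′ (A.append-only a)
      ; small = ≤-trans (≤-reflexive (A.append-size (proj₁ (bounded edge)))) (s≤s (Harvest.small H))
      }
      where
      module A = Append 𝓡 deg adj i j
      correct′ : ∀ {i′ j′} → (i′ ≡ i × j′ ≡ j) ⊎ Adjacent deg adj i′ j′ → Edge i′ j′
      correct′ (inj₁ (refl , refl)) = edge
      correct′ (inj₂ a) = Harvest.correct H a

    RowsIn : ℕ → Store → Set
    RowsIn i s = ∀ {k o} → k < i → natArray s curᵃ 0 k ≡ suc o →
                 Adjacent (natArray s degᵃ 0) (natArray s adjᵃ) k (natVar s baseᵛ + o)

    MarkIn : ℕ → ℕ → Store → Set
    MarkIn a b s = ∀ {u} → natArray s markᵃ a b ≡ suc u →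
                   Adjacent (natArray s degᵃ 0) (natArray s adjᵃ) u (natVar s baseᵛ + a) ×
                   Adjacent (natArray s degᵃ 0) (natArray s adjᵃ) u (natVar s baseᵛ + b)

    module _ {D : ℕ} where

      Rows : ℕ → Store → Set
      Rows i s = HarvestAt (D + i) s × RowsIn i s

      Marks : ℕ → Store → Set
      Marks a s = HarvestAt (D + n + a * (h * 2)) s × RowsIn n s × (∀ {a′} → a′ < a → ∀ b → MarkIn a′ b s)

      MarkRow : ℕ → ℕ → Store → Set
      MarkRow a b s = natVar s iᵛ ≡ a × HarvestAt (D + n + a * (h * 2) + b * 2) s × RowsIn n s ×
                      (∀ {a′} → a′ < a → ∀ b → MarkIn a′ b s) × (∀ {b′} → b′ < b → MarkIn a b′ s)

      takeRow takeMark : Program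
      takeRow = cond (positive (curᵃ ⟨ var iᵛ ⟩))
        (rowᵛ ≔ᴺ (var iᵛ) ⨾ colᵛ ≔ᴺ (column (pred (curᵃ ⟨ var iᵛ ⟩))) ⨾ append) skip
      takeMark = cond (positive (markᵃ [ var iᵛ , var jᵛ ]))
        (rowᵛ ≔ᴺ (pred (markᵃ [ var iᵛ , var jᵛ ])) ⨾
         colᵛ ≔ᴺ (column (var iᵛ)) ⨾ append ⨾
         colᵛ ≔ᴺ (column (var jᵛ)) ⨾ append) skip

      takeRow-ok : ∀ i r y s → i < n → natVar s iᵛ ≡ i → Rows i s → Ends takeRow (5 + (r + y)) s
        (Advanced iᵛ i r (λ _ → Rows (suc i)))
      takeRow-ok i r y s i<n refl (H , rows) = sound takeRow
        ((λ present → i , refl , bs + o , refl , i , deg i , bs + o , refl , 0 , i , suc (deg i) , refl ,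
            y , ≤-refl , refl ,
            grow (≤-reflexive (sym (+-suc D i))) (appended (Harvest.cur-edge H (cur≡ present)) H) ,
            (λ k≤i e → add present (m≤n⇒m<n∨m≡n (≤-pred k≤i)) e)) ,
         (λ absent → y , drop≤ 3 , refl , grow (+-monoʳ-≤ D (n≤1+n i)) H ,
            (λ k≤i e → keep absent (m≤n⇒m<n∨m≡n (≤-pred k≤i)) e)))
        where
        bs = natVar s baseᵛ
        cur = natArray s curᵃ 0
        deg = natArray s degᵃ 0
        o = cur i ∸ 1
        module A = Append 𝓡 deg (natArray s adjᵃ) i (bs + o)
        cur≡ : (0 <ᵇ cur i) ≡ true → cur i ≡ suc o
        cur≡ present = sym (suc-∸1 (0<-true present))
        add : (0 <ᵇ cur i) ≡ true → ∀ {k o′} → k < i ⊎ k ≡ i → cur k ≡ suc o′ → Adjacent A.deg⁺ A.adj⁺ k (bs + o′)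
        add present (inj₁ k<i) e = A.append-old (rows k<i e)
        add present (inj₂ refl) e rewrite suc-injective (trans (sym e) (cur≡ present)) = A.append-new
        keep : (0 <ᵇ cur i) ≡ false → ∀ {k o′} → k < i ⊎ k ≡ i → cur k ≡ suc o′ → Adjacent deg (natArray s adjᵃ) k (bs + o′)
        keep absent (inj₁ k<i) e = rows k<i e
        keep absent (inj₂ refl) e = ⊥-elim (0≢1+n (trans (sym (0<-false absent)) e))

      takeMark-ok : ∀ a b r y s → b < h → natVar s jᵛ ≡ b → MarkRow a b s → Ends takeMark (8 + (r + y)) s
        (Advanced jᵛ b r (λ _ → MarkRow a (suc b)))
      takeMark-ok a b r y s b<h refl (refl , H , rows , above , left) = sound takeMark
        ((λ present → u , refl , bs + a₀ , refl , u , deg u , bs + a₀ , refl , 0 , u , suc (deg u) , refl ,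
            bs + b₀ , refl , u , A₁.deg⁺ u , bs + b₀ , refl , 0 , u , suc (A₁.deg⁺ u) , refl ,
            y , ≤-refl , refl , refl ,
            grow (≤-reflexive (two S (b₀ * 2)))
              (appended (proj₂ (proj₂ (proj₂ (Harvest.mark-edge H (mark≡ present)))))
                (appended (proj₁ (proj₂ (proj₂ (Harvest.mark-edge H (mark≡ present))))) H)) ,
            (λ k<n e → A₂.append-old (A₁.append-old (rows k<n e))) ,
            (λ a′<a b′ e → both (above a′<a b′ e)) ,
            (λ b′≤b e → add present (m≤n⇒m<n∨m≡n (≤-pred b′≤b)) e)) ,
         (λ absent → y , drop≤ 6 , refl , refl ,
            grow (+-monoʳ-≤ S (≤-trans (n≤1+n _) (n≤1+n _))) H , rows , above ,
            (λ b′≤b e → keep absent (m≤n⇒m<n∨m≡n (≤-pred b′≤b)) e)))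
        where
        a₀ = natVar s iᵛ
        b₀ = natVar s jᵛ
        bs = natVar s baseᵛ
        S = D + n + a₀ * (h * 2)
        deg = natArray s degᵃ 0
        adj = natArray s adjᵃ
        M = natArray s markᵃ
        u = M a₀ b₀ ∸ 1
        module A₁ = Append 𝓡 deg adj u (bs + a₀)
        module A₂ = Append 𝓡 A₁.deg⁺ A₁.adj⁺ u (bs + b₀)
        two : ∀ S x → suc (suc (S + x)) ≡ S + suc (suc x)
        two = solve-∀
        mark≡ : (0 <ᵇ M a₀ b₀) ≡ true → M a₀ b₀ ≡ suc u
        mark≡ present = sym (suc-∸1 (0<-true present))
        both : ∀ {u′ j j′} → Adjacent deg adj u′ j × Adjacent deg adj u′ j′ →
               Adjacent A₂.deg⁺ A₂.adj⁺ u′ j × Adjacent A₂.deg⁺ A₂.adj⁺ u′ j′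
        both (p , q) = A₂.append-old (A₁.append-old p) , A₂.append-old (A₁.append-old q)
        add : (0 <ᵇ M a₀ b₀) ≡ true → ∀ {b′ u′} → b′ < b₀ ⊎ b′ ≡ b₀ → M a₀ b′ ≡ suc u′ →
              Adjacent A₂.deg⁺ A₂.adj⁺ u′ (bs + a₀) × Adjacent A₂.deg⁺ A₂.adj⁺ u′ (bs + b′)
        add present (inj₁ b′<b) e = both (left b′<b e)
        add present (inj₂ refl) e rewrite suc-injective (trans (sym e) (mark≡ present)) =
          A₂.append-old A₁.append-new , A₂.append-new
        keep : (0 <ᵇ M a₀ b₀) ≡ false → ∀ {b′ u′} → b′ < b₀ ⊎ b′ ≡ b₀ → M a₀ b′ ≡ suc u′ →
               Adjacent deg adj u′ (bs + a₀) × Adjacent deg adj u′ (bs + b′)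
        keep absent (inj₁ b′<b) e = left b′<b e
        keep absent (inj₂ refl) e = ⊥-elim (0≢1+n (trans (sym (0<-false absent)) e))

      markRow-ok : ∀ a r y s → a < h → natVar s iᵛ ≡ a → Marks a s →
        Ends (for jᵛ (var hᵛ) takeMark) (forCost h 8 + (r + y)) s
        (Advanced iᵛ a r (λ _ → Marks (suc a)))
      markRow-ok a r y s a<h a≡ (H , rows , above) =
        weaken (λ { {s = s} (y′ , le , a≡ , H , rows , above , left) → y′ , le , a≡ ,
            grow (≤-reflexive (shuffle (D + n) (a * (h * 2)) (h * 2))) H , rows ,
            (λ a′≤a b → next {s} H above left (m≤n⇒m<n∨m≡n (≤-pred a′≤a)) b) })
          (sound (for jᵛ (var hᵛ) takeMark) (forRule jᵛ (var hᵛ) takeMark h 8 (λ b _ → MarkRow a b)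
            (λ { _ _ _ (_ , H , _) → Harvest.h≡ H }) (takeMark-ok a)
            (a≡ , grow (≤-reflexive (sym (+-identityʳ _))) H , rows , above , (λ ()))))
        where
        shuffle : ∀ x y z → x + y + z ≡ x + (z + y)
        shuffle = solve-∀
        next : ∀ {s E} → HarvestAt E s → (∀ {a′} → a′ < a → ∀ b → MarkIn a′ b s) → (∀ {b} → b < h → MarkIn a b s) →
               ∀ {a′} → a′ < a ⊎ a′ ≡ a → ∀ b → MarkIn a′ b s
        next H above left (inj₁ a′<a) b e = above a′<a b e
        next H above left (inj₂ refl) b e = left (proj₁ (proj₂ (Harvest.mark-edge H e))) e

      harvest-ok : ∀ {r s} → HarvestAt D s →
        Ends harvest (forCost n 5 + (forCost h (forCost h 8) + r)) s
          (λ k s′ → r ≤ k × HarvestAt (D + n + h * (h * 2)) s′ × RowsIn n s′ × (∀ a b → MarkIn a b s′))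
      harvest-ok {r} {s} H =
        more (≤-reflexive (cong (forCost n 5 +_) (+-identityʳ _)))
          (sound (for iᵛ (var nᵛ) takeRow) (forRule iᵛ (var nᵛ) takeRow n 5 (λ i _ → Rows i)
            (λ { _ _ _ (H , _) → Harvest.n≡ H }) takeRow-ok {y = 0}
            (grow (≤-reflexive (sym (+-identityʳ D))) H , (λ ()))))
        followedBy λ (y , le , H , rows) →
          more (≤-trans (≤-reflexive (cong (forCost h (forCost h 8) +_) (+-identityʳ r)))
              (≤-trans (m≤m+n _ y) le))
          (weaken (λ { (y , le , H , rows , marks) → ≤-trans (m≤m+n r y) le , H , rows ,
                (λ a b e → marks (proj₁ (Harvest.mark-edge H e)) b e) })
            (sound (for iᵛ (var hᵛ) (for jᵛ (var hᵛ) takeMark))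
              (forRule iᵛ (var hᵛ) (for jᵛ (var hᵛ) takeMark) h (forCost h 8) (λ a _ → Marks a)
                (λ { _ _ _ (H , _) → Harvest.h≡ H }) markRow-ok {r} {0}
                (grow (≤-reflexive (sym (+-identityʳ _))) H , rows , (λ ())))))

  module BlocksRun (𝓡 : Reals) {size : ℕ} (O : OptimalTransport.Oracle 𝓡 size) (τ : ℕ)
    (n h : ℕ) (n≤h*h : n ≤ h * h) (edge : ℕ → ℕ → ℕ) (bounded : ∀ {i j} → edge i j ≢ 0 → i < n × j < n)
    (X₀ : ℕ → ℕ → Reals.ℝ 𝓡) where
    open RealRAM 𝓡
    open Logic 𝓡 O τ
    open ℕ-Sums using (count; sumTo; sumTo-cong; sumTo-ε; sign)
    open Tests
    module R = RealFacts 𝓡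
    open ClearRun 𝓡 O τ n h using (Tidy; TidyAt; clear-ok)

    Edge : Graph
    Edge i j = edge i j ≢ 0

    blockSize : ℕ
    blockSize = n + h * (h * 2)

    -- The first β blocks of columns have been processed.
    record Blocks (β n′ h′ base′ : ℕ) (edge′ : ℕ → ℕ → ℕ) (X : ℕ → ℕ → R.ℝ) (deg : ℕ → ℕ) (adj : ℕ → ℕ → ℕ) : Set where
      field
        n≡          : n′ ≡ n
        h≡          : h′ ≡ h
        base≡       : base′ ≡ β * h
        edge≡       : edge′ ≡ edge
        nonNegative : ∀ i j → R.0# R.≤ X i j
        conserved   : ∀ v → Balanced 𝓡 Edge v → R.pairing n v X ≡ R.pairing n v X₀
        done        : ∀ {i j} → Edge i j → j < base′ → X i j ≢ R.0# → Adjacent deg adj i j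
        correct     : ∀ {i j} → Adjacent deg adj i j → Edge i j
        small       : sumTo n deg ≤ β * blockSize

    BlocksAt : ℕ → Store → Set
    BlocksAt β s = Blocks β (natVar s nᵛ) (natVar s hᵛ) (natVar s baseᵛ) (natArray s edgeᵃ) (realArray s planᵃ)
                          (natArray s degᵃ 0) (natArray s adjᵃ)

    blockCost : ℕ → ℕ
    blockCost r = forCost n 1 + (forCost h (forCost h 1) + (forCost h (forCost n 36) +
      (forCost n 5 + (forCost h (forCost h 8) + suc r))))

    blockCost-+ : ∀ r → blockCost r ≡ blockCost 0 + r
    blockCost-+ r = identity (forCost n 1) (forCost h (forCost h 1)) (forCost h (forCost n 36)) (forCost n 5) (forCost h (forCost h 8)) r
      where
      identity : ∀ a b c d e r → a + (b + (c + (d + (e + suc r)))) ≡ a + (b + (c + (d + (e + 1)))) + r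
      identity = solve-∀

    block : Program
    block = clear ⨾ thin ⨾ harvest ⨾ baseᵛ ≔ᴺ (var baseᵛ ⊕ var hᵛ)

    module _ {β : ℕ} {s : Store} (B : BlocksAt β s) (tidy : Tidy (natArray s curᵃ 0) (natArray s markᵃ)) where
      open Blocks B

      Old : Graph
      Old = Adjacent (natArray s degᵃ 0) (natArray s adjᵃ)

      module T = ThinRun 𝓡 O τ n h edge bounded X₀ Old
      module H = HarvestRun 𝓡 O τ n h Edge bounded Old

      block-ok : ∀ {r} → Ends block (blockCost r) s (λ k s′ → r ≤ k × BlocksAt (suc β) s′ × Tidy (natArray s′ curᵃ 0) (natArray s′ markᵃ))
      block-ok {r} =
        framed (clear-ok (n≡ , h≡ , tidy)) followedBy λ { {k₁} {s₁} ((le , cur0 , mark0) , f) → more le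
        (framed (T.thin-ok
            (trans (f (natVarᴸ nᵛ) refl) n≡ , trans (f (natVarᴸ hᵛ) refl) h≡ , trans (f (natArrayᴸ edgeᵃ) refl) edge≡)
            (begin-kept (f (natVarᴸ baseᵛ) refl) (f (realArrayᴸ planᵃ) refl) cur0 mark0)
            (trans (sumTo-cong n (λ i _ → cong sign (cur0 i))) (sumTo-ε n)))
        followedBy λ { {k₂} {s₂} ((le , K) , g) → more le
        (framed (H.harvest-ok {D = β * blockSize} (begin-harvest
            (trans (g (natVarᴸ nᵛ) refl) (trans (f (natVarᴸ nᵛ) refl) n≡))
            (trans (g (natVarᴸ hᵛ) refl) (trans (f (natVarᴸ hᵛ) refl) h≡))
            (trans (g (natArrayᴸ degᵃ) refl) (f (natArrayᴸ degᵃ) refl))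
            (trans (g (natArrayᴸ adjᵃ) refl) (f (natArrayᴸ adjᵃ) refl)) K))
        followedBy λ { {k₃} {s₃} ((le , G , rows , marks) , e) → more le
        (sound (baseᵛ ≔ᴺ (var baseᵛ ⊕ var hᵛ)) (natVar s₃ baseᵛ + natVar s₃ hᵛ , refl , ≤-refl ,
          finish G rows marks
            (move (e (natVarᴸ baseᵛ) refl) (e (natArrayᴸ curᵃ) refl) (e (natArrayᴸ markᵃ) refl) (e (realArrayᴸ planᵃ) refl) K)
            (trans (e (natVarᴸ baseᵛ) refl) (trans (g (natVarᴸ baseᵛ) refl) (trans (f (natVarᴸ baseᵛ) refl) base≡)))
            (trans (e (natArrayᴸ edgeᵃ) refl) (trans (g (natArrayᴸ edgeᵃ) refl) (trans (f (natArrayᴸ edgeᵃ) refl) edge≡)))))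
        }) }) }
        where
        begin-kept : ∀ {bs cur mark X} → bs ≡ natVar s baseᵛ → X ≡ realArray s planᵃ →
                     (∀ i → cur i ≡ 0) → (∀ a b → mark a b ≡ 0) → T.Inv.Kept bs (λ _ _ → ⊥) T.Nowhere cur mark X
        begin-kept refl refl cur0 mark0 = record
          { cur-edge = λ {i} e → ⊥-elim (0≢1+n (trans (sym (cur0 i)) e))
          ; mark-edge = λ {a} {b} e → ⊥-elim (0≢1+n (trans (sym (mark0 a b)) e))
          ; nonNegative = nonNegative
          ; conserved = conserved
          ; covered = λ _ ()
          ; old = done
          }
        begin-harvest : ∀ {n′ h′ bs cur mark X deg″ adj Seen} → n′ ≡ n → h′ ≡ h → deg″ ≡ natArray s degᵃ →
          adj ≡ natArray s adjᵃ → T.Inv.Kept bs Seen T.Nowhere cur mark X →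
          H.Harvest (β * blockSize) n′ h′ bs cur mark (deg″ 0) adj
        begin-harvest {bs = bs} n≡ h≡ refl refl K = record
          { n≡ = n≡ ; h≡ = h≡
          ; cur-edge = λ e → proj₂ (Inv.cur-edge e)
          ; mark-edge = Inv.mark-edge
          ; old = λ o → o
          ; correct = correct
          ; small = small
          }
          where module Inv = T.Inv.Kept bs K
        move : ∀ {bs bs′ cur₂ cur₂′ mark mark′ X X′ Seen} → bs′ ≡ bs → cur₂′ ≡ cur₂ → mark′ ≡ mark → X′ ≡ X →
               T.Inv.Kept bs Seen T.Nowhere (cur₂ 0) mark X → T.Inv.Kept bs′ Seen T.Nowhere (cur₂′ 0) mark′ X′
        move refl refl refl refl K = K
        finish : ∀ {n′ h′ bs edge′ cur mark X deg adj} →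
          H.Harvest (β * blockSize + n + h * (h * 2)) n′ h′ bs cur mark deg adj →
          (∀ {k o} → k < n → cur k ≡ suc o → Adjacent deg adj k (bs + o)) →
          (∀ a b {u} → mark a b ≡ suc u → Adjacent deg adj u (bs + a) × Adjacent deg adj u (bs + b)) →
          T.Inv.Kept bs (λ _ o → o < h) T.Nowhere cur mark X → bs ≡ β * h → edge′ ≡ edge →
          Blocks (suc β) n′ h′ (bs + h′) edge′ X deg adj × Tidy cur mark
        finish {h′ = h′} {bs} {cur = cur} {mark} {X} {deg} {adj} G rows marks K base≡ edge≡ = record
          { n≡ = G.n≡ ; h≡ = G.h≡
          ; base≡ = trans (cong₂ _+_ base≡ G.h≡) (+-comm (β * h) h)
          ; edge≡ = edge≡
          ; nonNegative = K.nonNegative ; conserved = K.conserved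
          ; done = done′
          ; correct = G.correct
          ; small = ≤-trans G.small (≤-reflexive (trans (+-assoc (β * blockSize) n _) (+-comm (β * blockSize) blockSize)))
          } ,
          (λ {k} n≤k → outside n≤k (cur k) refl) ,
          (λ {a} {b} ne → inside (mark a b) refl ne)
          where
          module G = H.Harvest G
          module K = T.Inv.Kept bs K
          done′ : ∀ {i j} → Edge i j → j < bs + h′ → X i j ≢ R.0# → Adjacent deg adj i j
          done′ {i} {j} e j< x with j <? bs
          ... | yes j<bs = G.old (K.old e j<bs x)
          ... | no j≮bs = subst (Adjacent deg adj i) col≡ (go (K.covered e′ o<h x′))
            where
            o = j ∸ bs
            col≡ : bs + o ≡ j
            col≡ = m+[n∸m]≡n (≮⇒≥ j≮bs)
            o<h : o < h
            o<h = +-cancelˡ-< bs o h (subst₂ _<_ (sym col≡) (cong (bs +_) G.h≡) j<)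
            e′ : Edge i (bs + o)
            e′ = subst (Edge i) (sym col≡) e
            x′ : X i (bs + o) ≢ R.0#
            x′ = subst (λ j → X i j ≢ R.0#) (sym col≡) x
            go : T.Inv.Covered bs cur mark i o ⊎ ⊥ → Adjacent deg adj i (bs + o)
            go (inj₁ (inj₁ c)) = rows (proj₁ (bounded e)) c
            go (inj₁ (inj₂ (a , b , m , inj₁ refl))) = proj₁ (marks a b m)
            go (inj₁ (inj₂ (a , b , m , inj₂ refl))) = proj₂ (marks a b m)
          outside : ∀ {k} → n ≤ k → ∀ x → cur k ≡ x → cur k ≡ 0
          outside n≤k zero    e = e
          outside n≤k (suc o) e = ⊥-elim (<⇒≱ (proj₁ (bounded (G.cur-edge e))) n≤k)
          inside : ∀ {a b} x → mark a b ≡ x → mark a b ≢ 0 → a < h × b < h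
          inside zero    e ne = ⊥-elim (ne e)
          inside (suc u) e ne = let a<h , b<h , _ = G.mark-edge e in a<h , b<h

    Blocking : Assertion
    Blocking k s = ∃[ β ] ∃[ d ] β + d ≡ h × suc (d * suc (blockCost 0)) ≡ k × BlocksAt β s ×
                                Tidy (natArray s curᵃ 0) (natArray s markᵃ)

    blocking-ok : ∀ k s → Blocking k s → (natVar s baseᵛ <ᵇ natVar s nᵛ) ≡ true → spend (λ k → Ends block k s (↓ Blocking)) k
    blocking-ok k s (β , zero , total , refl , B , tidy) test = ⊥-elim (<⇒≱ β*h<n (≤-trans n≤h*h (≤-reflexive (cong (_* h) (trans (sym total) (+-identityʳ β))))))
      where
      β*h<n : β * h < n
      β*h<n = subst₂ _<_ (Blocks.base≡ B) (Blocks.n≡ B) (<-true test)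
    blocking-ok k s (β , suc d , total , refl , B , tidy) test =
      more (≤-reflexive (trans (blockCost-+ (suc (d * suc (blockCost 0)))) (+-suc (blockCost 0) _)))
        (weaken (λ (le , B , tidy) → _ , le , suc β , d , trans (sym (+-suc β d)) total , refl , B , tidy) (block-ok B tidy))

    Sparse : Store → Set
    Sparse s = let X = realArray s planᵃ ; deg = natArray s degᵃ 0 ; adj = natArray s adjᵃ in
      (∀ i j → R.0# R.≤ X i j) × (∀ v → Balanced 𝓡 Edge v → R.pairing n v X ≡ R.pairing n v X₀) ×
      (∀ {i j} → Edge i j → X i j ≢ R.0# → Adjacent deg adj i j) × (∀ {i j} → Adjacent deg adj i j → Edge i j) ×
      sumTo n deg ≤ h * blockSize

    sparsifyCost : ℕ
    sparsifyCost = 2 + h * suc (blockCost 0)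

    sparsify-ok : ∀ {s} → natVar s nᵛ ≡ n → natVar s hᵛ ≡ h → natArray s edgeᵃ ≡ edge →
      (∀ i → natArray s curᵃ 0 i ≡ 0) → (∀ a b → natArray s markᵃ a b ≡ 0) → (∀ i → natArray s degᵃ 0 i ≡ 0) →
      realArray s planᵃ ≡ X₀ → (∀ i j → R.0# R.≤ X₀ i j) → Ends sparsify sparsifyCost s (λ _ → Sparse)
    sparsify-ok {s} n≡ h≡ edge≡ cur0 mark0 deg0 refl 0≤X₀ = sound sparsify (0 , refl ,
      loop (var baseᵛ <ᴺ var nᵛ) block Blocking blocking-ok stop (0 , h , refl , refl ,
        record
          { n≡ = n≡ ; h≡ = h≡ ; base≡ = refl ; edge≡ = edge≡ ; nonNegative = 0≤X₀ ; conserved = λ _ _ → refl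
          ; done = λ _ ()
          ; correct = λ { {i} (k , k<deg , _) → ⊥-elim (n≮0 (subst (k <_) (deg0 i) k<deg)) }
          ; small = ≤-reflexive (trans (sumTo-cong n (λ i _ → deg0 i)) (sumTo-ε n))
          } ,
        (λ _ → cur0 _) , (λ ne → ⊥-elim (ne (mark0 _ _)))))
      where
      stop : ∀ k s → Blocking k s → (natVar s baseᵛ <ᵇ natVar s nᵛ) ≡ false → spend (λ _ → Sparse s) k
      stop k s (β , d , total , refl , B , _) test = nonNegative , conserved ,
        (λ e → done e (≤-trans (proj₂ (bounded e)) (subst (_≤ natVar s baseᵛ) (Blocks.n≡ B) (<-false test)))) , correct ,
        ≤-trans small (*-monoˡ-≤ blockSize (≤-trans (m≤m+n β d) (≤-reflexive total)))
        where open Blocks B using (nonNegative; conserved; done; correct; small)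

  module TimeBound (𝓡 : Reals) {B ε : Reals.ℝ 𝓡} (0<B : Reals._<_ 𝓡 (Reals.0# 𝓡) B) (0≤ε : Reals._≤_ 𝓡 (Reals.0# 𝓡) ε) where
    module R = RealFacts 𝓡
    open R using (ℝ; 0#; fromℕ; _⁻¹)

    gain : ∀ {n z₁ z₂} → B R.* fromℕ z₂ R.≤ B R.* fromℕ z₁ R.+ fromℕ n R.* ε → B R.* fromℕ (z₂ ∸ z₁) R.≤ fromℕ n R.* ε
    gain {n} {z₁} {z₂} le with ≤-total z₁ z₂
    ... | inj₁ z₁≤z₂ = R.+-cancelʳ-≤ (B R.* fromℕ z₁) (subst₂ R._≤_ split (R.+-comm _ _) le)
      where
      split : B R.* fromℕ z₂ ≡ B R.* fromℕ (z₂ ∸ z₁) R.+ B R.* fromℕ z₁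
      split = trans (cong (λ z → B R.* fromℕ z) (sym (m∸n+n≡m z₁≤z₂)))
        (trans (cong (B R.*_) (R.fromℕ-+ (z₂ ∸ z₁) z₁)) (R.distribˡ B _ _))
    ... | inj₂ z₂≤z₁ = subst (λ k → B R.* fromℕ k R.≤ fromℕ n R.* ε) (sym (m≤n⇒m∸n≡0 z₂≤z₁))
      (subst (R._≤ fromℕ n R.* ε) (sym (R.zeroʳ B)) (R.*-nonNegative (R.fromℕ-nonNegative n) 0≤ε))

    timeBound : ∀ c₁ c₂ {n t τ k} → t ≤ τ + (c₁ * (n * n) + c₂ * (n * n * k)) → n * n ≤ τ →
      B R.* fromℕ k R.≤ fromℕ n R.* ε →
      fromℕ t R.≤ (fromℕ (suc c₁) R.+ fromℕ c₂ R.* B ⁻¹) R.* (fromℕ τ R.+ fromℕ (n ℕ.^ 3) R.* ε)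
    timeBound c₁ c₂ {n} {t} {τ} {k} t≤ S≤τ Bk≤ = R.≤-trans (R.fromℕ-mono t≤′) (R.≤-trans (R.≤-reflexive expand)
      (R.≤-trans (R.+-mono-≤ R.≤-refl (R.*-monoˡ-≤ (R.fromℕ-nonNegative c₂) Sk≤)) (R.≤-trans (R.x≤x+y 0≤cross) (R.≤-reflexive product))))
      where
      S = n * n
      a b β x y : ℝ
      a = fromℕ (suc c₁)
      b = fromℕ c₂
      β = B ⁻¹
      x = fromℕ τ
      y = fromℕ (n ℕ.^ 3) R.* ε
      B≢0 : B ≢ 0#
      B≢0 e = proj₂ 0<B (sym e)
      0≤β : 0# R.≤ β
      0≤β = R.⁻¹-nonNegative (proj₁ 0<B) B≢0
      t≤′ : t ≤ suc c₁ * τ + c₂ * (S * k)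
      t≤′ = ≤-trans t≤ (≤-trans (+-monoʳ-≤ τ (+-monoˡ-≤ _ (*-monoʳ-≤ c₁ S≤τ))) (≤-reflexive (sym (+-assoc τ _ _))))
      expand : fromℕ (suc c₁ * τ + c₂ * (S * k)) ≡ a R.* x R.+ b R.* (fromℕ S R.* fromℕ k)
      expand = trans (R.fromℕ-+ (suc c₁ * τ) (c₂ * (S * k))) (cong₂ R._+_ (R.fromℕ-* (suc c₁) τ)
        (trans (R.fromℕ-* c₂ (S * k)) (cong (b R.*_) (R.fromℕ-* S k))))
      k≤ : fromℕ k R.≤ β R.* (fromℕ n R.* ε)
      k≤ = subst (R._≤ β R.* (fromℕ n R.* ε)) (trans (sym (R.*-assoc β B _))
        (trans (cong (R._* fromℕ k) (trans (R.*-comm β B) (R.*-inverseʳ B B≢0))) (R.*-identityˡ _)))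
        (R.*-monoˡ-≤ 0≤β Bk≤)
      cube : fromℕ (n ℕ.^ 3) ≡ fromℕ S R.* fromℕ n
      cube = trans (cong fromℕ (trans (cong (λ x → n * (n * x)) (*-identityʳ n)) (sym (*-assoc n n n)))) (R.fromℕ-* S n)
      Sk≤ : fromℕ S R.* fromℕ k R.≤ β R.* y
      Sk≤ = R.≤-trans (R.*-monoˡ-≤ (R.fromℕ-nonNegative S) k≤) (R.≤-reflexive (trans
        (R.solve 4 (λ s β n e → s R.:* (β R.:* (n R.:* e)) R.:= β R.:* (s R.:* n R.:* e)) refl (fromℕ S) β (fromℕ n) ε)
        (cong (λ z → β R.* (z R.* ε)) (sym cube))))
      0≤cross : 0# R.≤ a R.* y R.+ b R.* β R.* x
      0≤cross = R.+-nonNegative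
        (R.*-nonNegative (R.fromℕ-nonNegative (suc c₁)) (R.*-nonNegative (R.fromℕ-nonNegative (n ℕ.^ 3)) 0≤ε))
        (R.*-nonNegative (R.*-nonNegative (R.fromℕ-nonNegative c₂) 0≤β) (R.fromℕ-nonNegative τ))
      product : a R.* x R.+ b R.* (β R.* y) R.+ (a R.* y R.+ b R.* β R.* x) ≡ (a R.+ b R.* β) R.* (x R.+ y)
      product = R.solve 5 (λ a b β x y → a R.:* x R.:+ b R.:* (β R.:* y) R.:+ (a R.:* y R.:+ b R.:* β R.:* x) R.:=
        (a R.:+ b R.:* β) R.:* (x R.:+ y)) refl a b β x y

  module Assembly (𝓡 : Reals) {B : Reals.ℝ 𝓡} (0<B : Reals._<_ 𝓡 (Reals.0# 𝓡) B)
    {n : ℕ} (0<n : 0 < n) {ε : Reals.ℝ 𝓡} (0≤ε : Reals._≤_ 𝓡 (Reals.0# 𝓡) ε) (τ : ℕ)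
    (O : OptimalTransport.Oracle 𝓡 n) (isOracle : OptimalTransport.IsTransportOracle 𝓡 B ε O) (E : EdgeSet n) where
    open RealRAM 𝓡
    open Logic 𝓡 O τ
    open InitialStore 𝓡 E ε B
    open Matchings
    open ℕ-Sums using (count; count≤; sumTo; sumTo-*ˡ; sumTo-∙; sumTo-const)

    s₀ : Store
    s₀ = initial E ε B

    at : ∀ {f g : ℕ → ℕ → ℕ} → f ≡ g → ∀ i j → f i j ≡ g i j
    at e i j = cong (λ f → f i j) e

    module Setup = SetupRun 𝓡 O τ 0<n edge B ε 0<B isOracle

    opaque
      e₁ : Ends setup Setup.setupCost s₀ (λ _ s → Setup.Answer (realArray s planᵃ))
      e₁ = Setup.setup-ok {s₀} (refl , refl , refl , λ _ _ → refl)

    s₁ : Store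
    s₁ = Ends.final e₁

    f₁ : ∀ l → changes setup l ≡ false → value l s₁ ≡ value l s₀
    f₁ = unchanged (Ends.run e₁)

    module Small = SmallRun 𝓡 O τ n

    opaque
      e₂ : Ends root Small.rootCost s₁ (λ _ s → let h = natVar s hᵛ in 0 < h × n ≤ h * h × h * h ≤ 4 * n)
      e₂ = Small.root-ok {s₁} 0<n (f₁ (natVarᴸ nᵛ) refl)

    s₂ : Store
    s₂ = Ends.final e₂

    f₂ : ∀ l → changes root l ≡ false → value l s₂ ≡ value l s₁
    f₂ = unchanged (Ends.run e₂)

    h : ℕ
    h = natVar s₂ hᵛ

    0<h : 0 < h
    0<h = proj₁ (Ends.post e₂)

    module Blocks = BlocksRun 𝓡 O τ n h (proj₁ (proj₂ (Ends.post e₂))) edge bounded (realArray s₁ planᵃ)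

    blank₂ : ∀ a → changes root (natArrayᴸ a) ≡ false → changes setup (natArrayᴸ a) ≡ false → natArray s₂ a ≡ natArray s₀ a
    blank₂ a c c′ = trans (f₂ (natArrayᴸ a) c) (f₁ (natArrayᴸ a) c′)

    n≡₂ : natVar s₂ nᵛ ≡ n
    n≡₂ = trans (f₂ (natVarᴸ nᵛ) refl) (f₁ (natVarᴸ nᵛ) refl)

    opaque
      e₃ : Ends sparsify Blocks.sparsifyCost s₂ (λ _ → Blocks.Sparse)
      e₃ = Blocks.sparsify-ok {s₂} n≡₂ refl (blank₂ edgeᵃ refl refl) (at (blank₂ curᵃ refl refl) 0) (at (blank₂ markᵃ refl refl))
        (at (blank₂ degᵃ refl refl) 0) (f₂ (realArrayᴸ planᵃ) refl) (proj₁ (proj₂ (Ends.post e₁)))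

    s₃ : Store
    s₃ = Ends.final e₃

    f₃ : ∀ l → changes sparsify l ≡ false → value l s₃ ≡ value l s₂
    f₃ = unchanged (Ends.run e₃)

    deg : ℕ → ℕ
    deg = natArray s₃ degᵃ 0

    adj : ℕ → ℕ → ℕ
    adj = natArray s₃ adjᵃ

    correct : ∀ {i j} → Adjacent deg adj i j → edge i j ≢ 0
    correct = proj₁ (proj₂ (proj₂ (proj₂ (Ends.post e₃))))

    adj-bounded : ∀ {i j} → Adjacent deg adj i j → i < n × j < n
    adj-bounded a = bounded (correct a)

    module Auctioning = AuctionRun 𝓡 O τ n h 0<h deg adj adj-bounded
    module Auctions = AuctionInvariant 𝓡 n h deg adj adj-bounded

    n≡₃ : natVar s₃ nᵛ ≡ n
    n≡₃ = trans (f₃ (natVarᴸ nᵛ) refl) n≡₂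

    blank₃ : ∀ a → changes sparsify (natArrayᴸ a) ≡ false → changes root (natArrayᴸ a) ≡ false →
             changes setup (natArrayᴸ a) ≡ false → natArray s₃ a ≡ natArray s₀ a
    blank₃ a c c′ c″ = trans (f₃ (natArrayᴸ a) c) (blank₂ a c′ c″)

    opaque
      e₄ : Ends auction Auctioning.auctionCost s₃ (λ _ s → Auctions.Auction n 0 (natArray s priceᵃ 0) (natArray s levelᵃ 0)
        (natArray s ptrᵃ 0) (natArray s leftᵃ 0) (natArray s rightᵃ 0))
      e₄ = Auctioning.auction-ok s₃ n≡₃ (f₃ (natVarᴸ hᵛ) refl) refl refl (at (blank₃ priceᵃ refl refl refl) 0)
        (at (blank₃ levelᵃ refl refl refl) 0) (at (blank₃ ptrᵃ refl refl refl) 0) (at (blank₃ leftᵃ refl refl refl) 0)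
        (at (blank₃ rightᵃ refl refl refl) 0)

    s₄ : Store
    s₄ = Ends.final e₄

    f₄ : ∀ l → changes auction l ≡ false → value l s₄ ≡ value l s₃
    f₄ = unchanged (Ends.run e₄)

    z₀ : ℕ
    z₀ = count n (natArray s₄ leftᵃ 0)

    module SparseAugmenting = AugmentRun 𝓡 O τ n deg adj adj-bounded

    n≡₄ : natVar s₄ nᵛ ≡ n
    n≡₄ = trans (f₄ (natVarᴸ nᵛ) refl) n≡₃

    z₀-total : n ∸ z₀ + z₀ ≡ n
    z₀-total = m∸n+n≡m (count≤ n _)

    opaque
      e₅ : Ends augment (2 + suc (n ∸ z₀) * SparseAugmenting.augmentCost) s₄ (λ k s → ∃[ z ] ∃[ d ] d + z ≡ n ×
        d * SparseAugmenting.augmentCost ≤ k × SparseAugmenting.BaseAt z s × SparseAugmenting.Certificate z)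
      e₅ = SparseAugmenting.augment-ok {s₄} z₀-total (SparseAugmenting.base n≡₄
        (cong (λ f → f 0) (f₄ (natArrayᴸ degᵃ) refl)) (f₄ (natArrayᴸ adjᵃ) refl) (Auctions.Auction.matched (Ends.post e₄)) refl)

    s₅ : Store
    s₅ = Ends.final e₅

    f₅ : ∀ l → changes augment l ≡ false → value l s₅ ≡ value l s₄
    f₅ = unchanged (Ends.run e₅)

    z₁ : ℕ
    z₁ = proj₁ (Ends.post e₅)

    base₅ : SparseAugmenting.BaseAt z₁ s₅
    base₅ = proj₁ (proj₂ (proj₂ (proj₂ (proj₂ (Ends.post e₅)))))

    module Base₅ = SparseAugmenting.Base base₅

    certificate₅ : SparseAugmenting.Certificate z₁
    certificate₅ = proj₂ (proj₂ (proj₂ (proj₂ (proj₂ (Ends.post e₅)))))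

    module Densing = DenseRun 𝓡 O τ n edge bounded

    deg₅-outside : ∀ {i} → n ≤ i → natArray s₅ degᵃ 0 i ≡ 0
    deg₅-outside {i} n≤i with natArray s₅ degᵃ 0 i in e
    ... | zero  = refl
    ... | suc d = ⊥-elim (<⇒≱ (proj₁ (adj-bounded (0 , subst (0 <_) (trans (sym e) (cong (λ f → f i) Base₅.deg≡)) (s≤s z≤n) , refl))) n≤i)

    edge≡₅ : natArray s₅ edgeᵃ ≡ edge
    edge≡₅ = trans (f₅ (natArrayᴸ edgeᵃ) refl) (trans (f₄ (natArrayᴸ edgeᵃ) refl) (blank₃ edgeᵃ refl refl refl))

    opaque
      e₆ : Ends dense Densing.denseCost s₅ (λ _ s → let deg = natArray s degᵃ 0 ; adj = natArray s adjᵃ in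
        (∀ {i j} → Adjacent deg adj i j → edge i j ≢ 0) × (∀ {i j} → edge i j ≢ 0 → Adjacent deg adj i j) × sumTo n deg ≤ n * n)
      e₆ = Densing.dense-ok {s₅} Base₅.n≡ edge≡₅ deg₅-outside

    s₆ : Store
    s₆ = Ends.final e₆

    f₆ : ∀ l → changes dense l ≡ false → value l s₆ ≡ value l s₅
    f₆ = unchanged (Ends.run e₆)

    deg₆ : ℕ → ℕ
    deg₆ = natArray s₆ degᵃ 0

    adj₆ : ℕ → ℕ → ℕ
    adj₆ = natArray s₆ adjᵃ

    correct₆ : ∀ {i j} → Adjacent deg₆ adj₆ i j → edge i j ≢ 0
    correct₆ = proj₁ (Ends.post e₆)

    complete₆ : ∀ {i j} → edge i j ≢ 0 → Adjacent deg₆ adj₆ i j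
    complete₆ = proj₁ (proj₂ (Ends.post e₆))

    module DenseAugmenting = AugmentRun 𝓡 O τ n deg₆ adj₆ (λ a → bounded (correct₆ a))

    left≡₆ : natArray s₆ leftᵃ 0 ≡ natArray s₅ leftᵃ 0
    left≡₆ = cong (λ f → f 0) (f₆ (natArrayᴸ leftᵃ) refl)

    right≡₆ : natArray s₆ rightᵃ 0 ≡ natArray s₅ rightᵃ 0
    right≡₆ = cong (λ f → f 0) (f₆ (natArrayᴸ rightᵃ) refl)

    base₆ : DenseAugmenting.BaseAt z₁ s₆
    base₆ = DenseAugmenting.base (trans (f₆ (natVarᴸ nᵛ) refl) Base₅.n≡) refl refl
      (subst₂ (Matched (Adjacent deg₆ adj₆)) (sym left≡₆) (sym right≡₆) (monotone (λ a → complete₆ (correct a)) Base₅.matched))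
      (trans (cong (count n) left≡₆) Base₅.size≡)

    d₁ : ℕ
    d₁ = proj₁ (proj₂ (Ends.post e₅))

    z₁-total : d₁ + z₁ ≡ n
    z₁-total = proj₁ (proj₂ (proj₂ (Ends.post e₅)))

    opaque
      e₇ : Ends augment (2 + suc d₁ * DenseAugmenting.augmentCost) s₆ (λ k s → ∃[ z ] ∃[ d ] d + z ≡ n ×
        d * DenseAugmenting.augmentCost ≤ k × DenseAugmenting.BaseAt z s × DenseAugmenting.Certificate z)
      e₇ = DenseAugmenting.augment-ok {s₆} z₁-total base₆

    s₇ : Store
    s₇ = Ends.final e₇

    f₇ : ∀ l → changes augment l ≡ false → value l s₇ ≡ value l s₆
    f₇ = unchanged (Ends.run e₇)

    z₂ : ℕ
    z₂ = proj₁ (Ends.post e₇)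

    d₂ : ℕ
    d₂ = proj₁ (proj₂ (Ends.post e₇))

    base₇ : DenseAugmenting.BaseAt z₂ s₇
    base₇ = proj₁ (proj₂ (proj₂ (proj₂ (proj₂ (Ends.post e₇)))))

    module Base₇ = DenseAugmenting.Base base₇

    certificate₇ : DenseAugmenting.Certificate z₂
    certificate₇ = proj₂ (proj₂ (proj₂ (proj₂ (proj₂ (Ends.post e₇)))))

    blank₇ : natArray s₇ outᵃ ≡ natArray s₀ outᵃ
    blank₇ = trans (f₇ (natArrayᴸ outᵃ) refl) (trans (f₆ (natArrayᴸ outᵃ) refl) (trans (f₅ (natArrayᴸ outᵃ) refl)
      (trans (f₄ (natArrayᴸ outᵃ) refl) (blank₃ outᵃ refl refl refl))))

    left : ℕ → ℕ
    left = natArray s₇ leftᵃ 0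

    opaque
      e₈ : Ends report Small.reportCost s₇ (λ _ s → ∀ {i} → i < n → ∀ j → natArray s outᵃ i j ≡ ind left i j)
      e₈ = Small.report-ok {s₇} Base₇.n≡ (at blank₇)

    s₈ : Store
    s₈ = Ends.final e₈

    matched₇ : Matched (λ i j → edge i j ≢ 0) left (natArray s₇ rightᵃ 0)
    matched₇ = monotone correct₆ Base₇.matched

    isMaximum : IsMaximumMatching E (output n s₈)
    isMaximum = Outcome.isMaximum 𝓡 E ε B {s₈} matched₇ (Ends.post e₈)
      (≤-trans (proj₁ (proj₂ (proj₂ certificate₇))) (≤-reflexive (sym Base₇.size≡)))
      (λ e → proj₂ (proj₂ (proj₂ certificate₇)) (complete₆ e))

    run : Run O τ maximumMatching s₀ s₈ _
    run = seq (Ends.run e₁) (seq (Ends.run e₂) (seq (Ends.run e₃) (seq (Ends.run e₄) (seq (Ends.run e₅) (seq (Ends.run e₆)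
      (seq (Ends.run e₇) (Ends.run e₈)))))))

    open RealFacts 𝓡 using (fromℕ) renaming (_*_ to _·_; _+_ to _⊹_; _≤_ to _≤ᵣ_)

    sparse-gain : h * (z₁ ∸ z₀) ≤ n
    sparse-gain = ≤-trans (≤-reflexive (*-distribˡ-∸ h z₁ z₀)) (≤-trans (m≤n+o⇒m∸n≤o (h * z₁) (h * z₀)
      (≤-trans (subst (λ z → h * z ≤ suc h * z₀) Base₅.size≡ (Auctions.nearly-maximum (Ends.post e₄) Base₅.matched))
        (≤-reflexive (+-comm z₀ (h * z₀))))) (count≤ n _))

    dense-gain : B · fromℕ z₂ ≤ᵣ B · fromℕ z₁ ⊹ fromℕ n · ε
    dense-gain = Deficit.deficit 𝓡 n 0<n edge bounded B ε 0<B (proj₁ setup-post) (proj₂ (proj₂ setup-post))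
      (proj₁ sparse) (proj₁ (proj₂ sparse))
      (λ e x → proj₂ (proj₂ (proj₂ certificate₅)) (proj₁ (proj₂ (proj₂ sparse)) e x))
      (proj₁ (proj₂ (proj₂ certificate₅))) matched₇ Base₇.size≡
      where
      setup-post = Ends.post e₁
      sparse = Ends.post e₃

    module Bound = Bounds n h 0<n 0<h (proj₂ (proj₂ (Ends.post e₂)))

    edges₃ : sumTo n deg ≤ 9 * (n * h)
    edges₃ = ≤-trans (proj₂ (proj₂ (proj₂ (proj₂ (Ends.post e₃))))) Bound.edges≲

    within : ∀ {p k s Q} (e : Ends p k s Q) → Ends.time e ≤ k
    within e = ≤-trans (m≤m+n _ _) (Ends.paid e)

    goal≡ : Auctions.goal ≡ suc h * (n + sumTo n deg)
    goal≡ = trans (sym (sumTo-*ˡ n (suc h) (λ i → suc (deg i)))) (cong (suc h *_)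
      (trans (sumTo-∙ n (λ _ → 1) deg) (cong (_+ sumTo n deg) (trans (sumTo-const n 1) (*-identityʳ n)))))

    opaque
      time≤ : Ends.time e₁ + (Ends.time e₂ + (Ends.time e₃ + (Ends.time e₄ + (Ends.time e₅ + (Ends.time e₆ + (Ends.time e₇ + Ends.time e₈)))))) ≤
              τ + (factor * (n * n) + gainFactor * (n * n * (z₂ ∸ z₁)))
      time≤ = Bound.total≲ {Ends.time e₁} {Ends.time e₂} {Ends.time e₃} {Ends.time e₄} {Ends.time e₅} {Ends.time e₆} {Ends.time e₇} {Ends.time e₈} {τ}
        (≤-trans (within e₁) (Bound.setup≲ τ))
        (≤-trans (within e₂) Bound.root≲)
        (≤-trans (within e₃) (Bound.sparsify≲ Bound.block≲))
        (≤-trans (within e₄) (≤-trans (≤-reflexive (cong (λ g → forCost n 2 + g * 12) goal≡)) (Bound.auction≲ edges₃)))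
        (≤-trans (gain≲ {c = SparseAugmenting.augmentCost} {n ∸ z₀} {z₀} {d₁} {z₁} z₀-total z₁-total (Ends.paid e₅) (proj₁ (proj₂ (proj₂ (proj₂ (Ends.post e₅))))))
          (Bound.sparseAugment≲ (Bound.SparseAugment.augmentCost≲ {c = 9} edges₃) sparse-gain))
        (≤-trans (within e₆) Bound.dense≲)
        (≤-trans (gain≲ {c = DenseAugmenting.augmentCost} {d₁} {z₁} {d₂} {z₂} z₁-total (proj₁ (proj₂ (proj₂ (Ends.post e₇)))) (Ends.paid e₇) (proj₁ (proj₂ (proj₂ (proj₂ (Ends.post e₇))))))
          (Bound.denseAugment≲ {z₂ ∸ z₁} (Bound.DenseAugment.augmentCost≲ {c = 1}
            (≤-trans (proj₂ (proj₂ (Ends.post e₆))) (≤-reflexive (sym (*-identityˡ (n * n))))))))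
        (≤-trans (within e₈) Bound.report≲)

open Combinatorial
open Continuous
open Combined

lemma6 : (𝓡 : Reals) →
    let open Reals 𝓡
        open OptimalTransport 𝓡
        open RealRAM 𝓡
    in
    ∃[ P ] (∀ (B : ℝ) → 0# < B →
    ∃[ K ] (∀ (T : ℕ → ℝ → ℕ) (n : ℕ) → .{{_ : NonZero n}} →
            ∀ (ε : ℝ) → 0# ≤ ε →
            n ℕ.* n ℕ.≤ T n ε →
            ∀ (O : Oracle n) → IsTransportOracle B ε O →
            ∀ (E : EdgeSet n) →
            ∃[ s ] ∃[ t ]
              ( Run O (T n ε) P (initial E ε B) s t
              × IsMaximumMatching E (output n s)
              × fromℕ t ≤ K * (fromℕ (T n ε) + fromℕ (n ℕ.^ 3) * ε))))
lemma6 𝓡 = maximumMatching , λ B 0<B →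
  (let open Reals 𝓡 in fromℕ (suc factor) + fromℕ gainFactor * B ⁻¹) , λ T n ε 0≤ε n*n≤T O isOracle E →
  let open Assembly 𝓡 0<B (ℕ.>-nonZero⁻¹ n) 0≤ε (T n ε) O isOracle E
      open TimeBound 𝓡 0<B 0≤ε in
  s₈ , _ , run , isMaximum , timeBound factor gainFactor {n} {k = z₂ ∸ z₁} time≤ n*n≤T (gain {n} {z₁} {z₂} dense-gain)
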